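{- For every NP-S-complete problem $\Pi$, the problem $\textsc{Interdiction- }\Pi$ is $\Sigma_2^p$-complete.
   Context: An NP-S problem is a triple $\Pi=(\mathcal I,\mathcal U,\mathcal S)$ where $\mathcal I\subseteq\{0,1\}^*$ is the set of instances; each $I\in\mathcal I$ has a finite universe $\mathcal U(I)$ with $|\mathcal U(I)|=|I|^{O(1)}$ and a (possibly empty) solution set $\mathcal S(I)\subseteq 2^{\mathcal U(I)}$; and there is a deterministic polynomial-time Turing machine $V$ such that for all $I\in\mathcal I$ and $C\subseteq\mathcal U(I)$: $V(I,C)=1$ iff $C\in\mathcal S(I)$. Encoding convention: the elements of $\mathcal U(I)$ can be listed in time polynomial in $|I|$, and subsets are given as 0/1-vectors. Decision problems are posed on inputs of the stated form (in particular with $I\in\mathcal I$). Solution-embedding (SE) reduction: $\Pi\leq_{\mathrm{SE}}\Pi'$ for NP-S problems $\Pi=(\mathcal I,\mathcal U,\mathcal S)$, $\Pi'=(\mathcal I',\mathcal U',\mathcal S')$ if there is a polynomial-time computable $g:\mathcal I\to\mathcal I'$ with $\mathcal S(I)\ne\emptyset\iff\mathcal S'(g(I))\neq\emptyset$, and there are injective functions $f_I:\mathcal U(I)\to\mathcal U'(g(I))$, $I\in\mathcal I$, uniformly computable in time polynomial in $|I|$, such that $\{f_I(S):S\in\mathcal S(I)\}=\{S'\cap f_I(\mathcal U(I)):S'\in\mathcal S'(g(I))\}$ for all $I\in\mathcal I$. $\Pi$ is NP-S-complete if $\Pi$ is in NP-S and $\Pi'\leq_{\mathrm{SE}}\Pi$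 for every NP-S problem $\Pi'$. $\textsc{Interdiction- }\Pi$: the input is an instance $I\in\mathcal I$, a set $D\subseteq\mathcal U(I)$ and a budget $\Gamma\in\mathbb Z$. The question is whether $$\exists B\subseteq D\text{ with }|B|\le\Gamma:\ \forall S\in\mathcal S(I):\ B\cap S\neq\emptyset.$$ Completeness is with respect to polynomial-time many-one reductions. -}

module Defs where

open import Data.Bool using (Bool; true; false)
open import Data.Fin using (Fin; _≟_)
open import Data.Fin.Properties using (any?)
open import Data.Fin.Subset using (Subset; ⊤; _∩_; _⊆_; ∣_∣; Nonempty)
open import Data.Fin.Subset.Properties using (_∈?_)
open import Data.Integer using (ℤ; +_; -[1+_])
import Data.Integer as ℤ
open import Data.List using (List; []; _∷_; [_]; _++_; concatMap; foldr; length; lookup; map)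
open import Data.List.Relation.Unary.Unique.Propositional using (Unique)
open import Data.Maybe using (Maybe; just; nothing; fromMaybe)
import Data.Maybe as Maybe
open import Data.Nat using (ℕ; zero; suc; _+_; _*_; _≤_)
open import Data.Nat.Binary using (ℕᵇ; 2[1+_]; 1+[2_]; fromℕ)
import Data.Nat.Binary as ℕᵇ
open import Data.Product using (Σ; ∃; ∃-syntax; _×_; _,_; proj₁; proj₂)
open import Data.Vec using (Vec; tabulate; replicate; toList; zipWith; _[_]≔_)
import Data.Vec as Vec
open import Function using (_∘_; _⇔_; _↔_)
open import Function.Definitions using (Injective)
open import Level using (0ℓ)
open import Relation.Binary.PropositionalEquality using (_≡_)
open import Relation.Nullary.Decidable using (does; _×-dec_)
open import Relation.Unary using (Pred; _≐_)

Str : Set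
Str = List Bool

-- Polynomials over ℕ, constant coefficient first.
Poly : Set
Poly = List ℕ

eval : Poly → ℕ → ℕ
eval p n = foldr (λ a r → a + n * r) 0 p

------------------------------------------------------------------------
-- Deterministic multi-tape Turing machines

-- `nothing` is the blank.
Symbol : Set
Symbol = Maybe Bool

data Move : Set where
  left stay right : Move

-- A two-way infinite tape: the cells left of the head (nearest first), the
-- scanned cell, and the cells right of the head.  Cells not listed are blank.
record Tape : Set where
  constructor tape
  field
    before  : List Symbol
    scanned : Symbol
    after   : List Symbol

open Tape public

move : Move → Tape → Tape
move stay  t                     = t
move left  (tape []       s rs)  = tape [] nothing (s ∷ rs)
move left  (tape (l ∷ ls) s rs)  = tape ls l (s ∷ rs)
move right (tape ls s [])        = tape (s ∷ ls) nothing []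
move right (tape ls s (r ∷ rs))  = tape (s ∷ ls) r rs

act : Symbol × Move → Tape → Tape
act (s , m) t = move m (tape (before t) s (after t))

blankTape : Tape
blankTape = tape [] nothing []

-- The head starts on the first bit of the written string.
write : Str → Tape
write []       = blankTape
write (b ∷ bs) = tape [] (just b) (map just bs)

bitsUpToBlank : List Symbol → Str
bitsUpToBlank []             = []
bitsUpToBlank (nothing ∷ _)  = []
bitsUpToBlank (just b  ∷ ss) = b ∷ bitsUpToBlank ss

-- The string read from the head rightwards up to the first blank.
read : Tape → Str
read t = bitsUpToBlank (scanned t ∷ after t)

record Machine : Set₁ where
  field
    tapes  : ℕ
    State  : Set
    finite : ∃[ n ] State ↔ Fin n
    start  : State
    -- The tape initially holding the input, and the one finally holding the
    -- output; they may coincide.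
    input  : Fin tapes
    output : Fin tapes
    -- `nothing` means that the machine halts.
    δ      : State → Vec Symbol tapes → Maybe (State × Vec (Symbol × Move) tapes)

  Config : Set
  Config = State × Vec Tape tapes

  initial : Str → Config
  initial w = start , replicate tapes blankTape [ input ]≔ write w

  step : Config → Maybe Config
  step (q , ts) =
    Maybe.map (λ (q′ , as) → q′ , zipWith act as ts) (δ q (Vec.map scanned ts))

  run : ℕ → Config → Config
  run zero    c = c
  run (suc t) c = run t (fromMaybe c (step c))

  HaltsWith : Str → Config → Set
  HaltsWith w (q , ts) = step (q , ts) ≡ nothing × read (Vec.lookup ts output) ≡ w

-- `PolyTime inp out`: one machine takes inp a to out a, for every a : A, in
-- time polynomial in the length of inp a.  Its behaviour on strings outside
-- the image of inp is unconstrained.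
PolyTime : {A : Set} (inp out : A → Str) → Set₁
PolyTime inp out =
  Σ Machine λ M → let open Machine M in
  Σ Poly λ p →
  ∀ a → ∃[ t ] t ≤ eval p (length (inp a))
             × HaltsWith (out a) (run t (initial (inp a)))

------------------------------------------------------------------------
-- Encodings

-- Self-delimiting: every bit of v is preceded by true, and false ends v.
⟨_,_⟩ : Str → Str → Str
⟨ v , w ⟩ = concatMap (λ b → true ∷ b ∷ []) v ++ false ∷ w

encodeList : List Str → Str
encodeList = foldr ⟨_,_⟩ []

-- ℕᵇ is bijective base 2 (digits 1 and 2), least significant digit first.
encodeℕᵇ : ℕᵇ → Str
encodeℕᵇ ℕᵇ.zero  = []
encodeℕᵇ 1+[2 n ] = false ∷ encodeℕᵇ n
encodeℕᵇ 2[1+ n ] = true  ∷ encodeℕᵇ n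

encodeℤ : ℤ → Str
encodeℤ (+ n)    = false ∷ encodeℕᵇ (fromℕ n)
encodeℤ -[1+ n ] = true  ∷ encodeℕᵇ (fromℕ (suc n))

------------------------------------------------------------------------
-- NP-S problems

-- The elements of the universe of I are bit strings; 𝓤 I lists them without
-- repetition.  An element is referred to by its position in this list, which
-- is also its coordinate in the 0/1-vectors encoding subsets.
record NPSProblem : Set₁ where
  field
    𝓘 : Pred Str 0ℓ

  Instance : Set
  Instance = ∃ 𝓘

  field
    𝓤        : Instance → List Str
    𝓤-unique : ∀ I → Unique (𝓤 I)

  Element : Instance → Set
  Element I = Fin (length (𝓤 I))

  SubsetOf𝓤 : Instance → Set
  SubsetOf𝓤 I = Subset (length (𝓤 I))

  field
    𝓢        : ∀ I → Pred (SubsetOf𝓤 I) 0ℓ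
    𝓤-size   : Σ Poly λ p → ∀ I → length (𝓤 I) ≤ eval p (length (proj₁ I))
    𝓤-listed : PolyTime proj₁ (encodeList ∘ 𝓤)
    V        : Str → Str → Bool
    V-poly   : PolyTime {A = Str × Str} (λ (w , c) → ⟨ w , c ⟩) (λ (w , c) → [ V w c ])
    V-spec   : ∀ I (C : SubsetOf𝓤 I) → V (proj₁ I) (toList C) ≡ true ⇔ 𝓢 I C

  Solvable : Instance → Set
  Solvable I = ∃ (𝓢 I)

image : ∀ {m n} → (Fin m → Fin n) → Subset m → Subset n
image f S = tabulate λ j → does (any? λ i → (i ∈? S) ×-dec (f i ≟ j))

record _≤SE_ (Π Π′ : NPSProblem) : Set₁ where
  private
    module P  = NPSProblem Π
    module P′ = NPSProblem Π′
  field
    g          : P.Instance → P′.Instance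
    g-poly     : PolyTime proj₁ (proj₁ ∘ g)
    g-correct  : ∀ I → P.Solvable I ⇔ P′.Solvable (g I)
    f          : ∀ I → P.Element I → P′.Element (g I)
    f-inj      : ∀ I → Injective _≡_ _≡_ (f I)
    -- Elements of the universe of I have length polynomial in |I|, because
    -- they are listed in polynomial time; so this is time polynomial in |I|.
    f-poly     : PolyTime {A = Σ P.Instance P.Element}
                   (λ (I , u) → ⟨ proj₁ I , lookup (P.𝓤 I) u ⟩)
                   (λ (I , u) → lookup (P′.𝓤 (g I)) (f I u))
    embedding  : ∀ I →
      (λ T → ∃[ S ] P.𝓢 I S × T ≡ image (f I) S) ≐
      (λ T → ∃[ S′ ] P′.𝓢 (g I) S′ × T ≡ S′ ∩ image (f I) ⊤)

NPSComplete : NPSProblem → Set₁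
NPSComplete Π = ∀ Π′ → Π′ ≤SE Π

------------------------------------------------------------------------
-- Decision problems, many-one reductions and the class Σ₂ᵖ

-- Problems on inputs of a stated form: `code` gives the string presented to
-- a machine.  It need not be injective, since an Input may carry a proof that
-- it has the stated form.
record DecisionProblem : Set₁ where
  field
    Input : Set
    code  : Input → Str
    Yes   : Pred Input 0ℓ

record _≤ₚ_ (L L′ : DecisionProblem) : Set₁ where
  private
    module L  = DecisionProblem L
    module L′ = DecisionProblem L′
  field
    reduce  : L.Input → L′.Input
    poly    : PolyTime L.code (L′.code ∘ reduce)
    correct : ∀ x → L.Yes x ⇔ L′.Yes (reduce x)

record InΣ₂ᵖ (L : DecisionProblem) : Set₁ where
  open DecisionProblem L
  field
    bound  : Poly
    W      : Str → Str → Str → Bool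
    W-poly : PolyTime {A = Str × Str × Str}
               (λ (x , y , z) → ⟨ x , ⟨ y , z ⟩ ⟩) (λ (x , y , z) → [ W x y z ])
    W-spec : ∀ x → let m = eval bound (length (code x)) in
      Yes x ⇔ (Σ (Vec Bool m) λ y → (z : Vec Bool m) →
                 W (code x) (toList y) (toList z) ≡ true)

Σ₂ᵖ-Complete : DecisionProblem → Set₁
Σ₂ᵖ-Complete L = InΣ₂ᵖ L × (∀ L′ → InΣ₂ᵖ L′ → L′ ≤ₚ L)

------------------------------------------------------------------------

Interdiction : NPSProblem → DecisionProblem
Interdiction Π = record
  { Input = Σ Instance λ I → SubsetOf𝓤 I × ℤ
  ; code  = λ (I , D , Γ) → ⟨ proj₁ I , ⟨ toList D , encodeℤ Γ ⟩ ⟩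
  ; Yes   = λ (I , D , Γ) →
      ∃[ B ] B ⊆ D × + ∣ B ∣ ℤ.≤ Γ × (∀ S → 𝓢 I S → Nonempty (B ∩ S))
  }
  where open NPSProblem Π

{-# OPTIONS --safe #-}

-- Membership: the coordinates of a blocker and of a solution are read off the first |𝓤 I| bits of the
-- two witnesses, so "every solution meets B" becomes "V rejects S or B meets S".
--
-- Hardness: let L be given by ∃ y ∀ z W(x,y,z) with |y| = |z| = m.  Consider the NP-S problem whose universe
-- has, for each i < m, two literals aᵢ, bᵢ and an element cᵢ, and whose solutions are the sets that contain
-- both aᵢ and bᵢ for some i, together with the sets that contain aᵢ or bᵢ for every i and encode, through
-- their bᵢ and cᵢ, a pair (y,z) with ¬ W(x,y,z).  A set of at most m literals that meets all solutions of the first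
-- sort contains exactly one of aᵢ, bᵢ for every i, that is, it encodes some y; it then meets those of the
-- second sort iff W(x,y,z) for all z.  An SE reduction of this problem to Π carries the
-- literals into the universe of Π, and since D consists of images of literals, only the trace of a
-- solution on the embedded universe matters.
--
-- The machines are obtained from a small language of register programs (a tape is a stack), in which
-- polynomial-time functions are closed under composition, pairing, branching and length-bounded
-- recursion on notation.
module Submission where

open import Defs
open import Data.Bool using (Bool; true; false; if_then_else_; not; _∧_; _∨_)
open import Data.Bool.Properties using (⇔→≡)
open import Data.Empty using (⊥)
open import Data.Fin using (Fin; zero; suc; toℕ; fromℕ<; opposite; _≟_)
open import Data.Fin.Properties using (+↔⊎; 1↔⊤; 2↔Bool; toℕ<n; toℕ-fromℕ<; any?; opposite-involutive)
import Data.Fin.Properties as Fin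
open import Data.Fin.Subset using (Subset; ⊤; _∩_; _⊆_; ∣_∣; Nonempty; _∈_; _-_)
open import Data.Fin.Subset.Properties using (x∈p∩q⁺; x∈p∩q⁻; x∈p⇒∣p-x∣<∣p∣; x∈p∧x≢y⇒x∈p-y; ∈⊤; _∈?_)
open import Data.Integer using (+_)
import Data.Integer as ℤ
open import Data.List using (List; []; _∷_; [_]; _++_; concatMap; drop; length; map; _ʳ++_)
import Data.List as List
open import Data.List.Membership.Propositional.Properties using (∈-lookup)
open import Data.List.Properties using (length-++; length-ʳ++; length-reverse; length-map; length-replicate; length-drop; drop-drop; drop-[]; reverse-involutive; ++-assoc)
open import Data.List.Relation.Unary.All as All using (All; []; _∷_)
open import Data.List.Relation.Unary.AllPairs using ([]; _∷_)
open import Data.List.Relation.Unary.Unique.Propositional using (Unique)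
open import Data.Maybe using (Maybe; just; nothing; is-just)
import Data.Maybe as Maybe
open import Data.Nat using (ℕ; zero; suc; _+_; _*_; _∸_; _≤_; _<_; z≤n; s≤s; s≤s⁻¹; _<?_)
open import Data.Nat.Binary using (ℕᵇ; 2[1+_]; 1+[2_]; fromℕ; fromℕ')
import Data.Nat.Binary as ℕᵇ
open import Data.Nat.Binary.Properties using (fromℕ≡fromℕ'; fromℕ-injective)
open import Data.Nat.Properties hiding (_≟_; _<?_)
import Data.Nat.Properties as ℕ
open import Data.Nat.Tactic.RingSolver using (solve-∀)
open import Data.Product using (Σ; ∃-syntax; _×_; _,_; proj₁; proj₂; map₁)
open import Data.Sum using (_⊎_; inj₁; inj₂)
open import Data.Sum.Function.Propositional using (_⊎-↔_)
open import Data.Unit using (tt)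
import Data.Unit as Unit
open import Data.Vec using (Vec; []; _∷_; toList; fromList; lookup; tabulate; updateAt; zipWith; replicate; _[_]≔_; here; there)
import Data.Vec as Vec
open import Data.Vec.Properties using (map-[]≔; map-replicate; lookup∘updateAt; lookup-replicate; []≔-lookup; length-toList; []=⇒lookup; lookup⇒[]=; toList∘fromList; lookup∘tabulate)
open import Data.Vec.Relation.Binary.Pointwise.Inductive as PW using (Pointwise; []; _∷_)
open import Data.Vec.Relation.Unary.All as VAll using ([]; _∷_)
open import Function using (_∘_; id; _↔_; _⇔_; mk⇔)
open import Function.Bundles using (module Equivalence)
open import Function.Construct.Composition using (_⇔-∘_)
open import Function.Construct.Symmetry using (⇔-sym)
open import Function.Definitions using (Injective)
open import Function.Properties.Inverse using (↔-sym; ↔-trans)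
open import Level using (0ℓ)
open import Relation.Binary.PropositionalEquality using (_≡_; _≢_; refl; sym; trans; cong; cong₂; subst; subst₂)
open import Relation.Nullary using (¬_; Dec; does; yes; no; contradiction)
open import Relation.Nullary.Decidable using (dec-true; _×-dec_)
open import Relation.Unary using (Pred; _≐_)

-- The main obstacle lies with the machines. The verifier of `Π`, the maps of an SE reduction and
-- the predicate of `L` are given as arbitrary Turing machines. They are specified only on strings
-- that code legal inputs and may leave anything on their tapes, yet they have to run as subroutines
-- inside loops. Hence `inp ⇝ out` is indexed by a set of legal inputs rather than by all strings,
-- the bodies of branches and loops are indexed by subtypes that record what is known there, and a
-- call includes cleaning up. On the combinatorial side, blockers and solutions code y in opposite
-- ways: for a true bit a blocker holds aᵢ and a solution holds bᵢ. A solution of the second sort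
-- with one literal from each pair thus escapes exactly the blocker that has the same y. The cᵢ stay
-- outside `D`, since a blocker that could take them would interfere with the choice of z.

private variable
  k m n N : ℕ
  A A′ : Set

-- Program fragments and their control flow

-- A program fragment on k tapes; halting hands control to the context.
record Code (k : ℕ) : Set₁ where
  field
    Q      : Set
    finite : ∃[ n ] Q ↔ Fin n
    start  : Q
    δ      : Q → Vec Symbol k → Maybe (Q × Vec (Symbol × Move) k)

  step : Q × Vec Tape k → Maybe (Q × Vec Tape k)
  step (q , ts) =
    Maybe.map (λ (q′ , as) → q′ , zipWith act as ts) (δ q (Vec.map scanned ts))

module _ (C : Code k) where
  open Code C

  data Steps : Q × Vec Tape k → ℕ → Q × Vec Tape k → Set where
    []  : ∀ {c} → Steps c 0 c
    _∷_ : ∀ {c d e n} → step c ≡ just d → Steps d n e → Steps c (suc n) e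

  Exec : Vec Tape k → ℕ → Vec Tape k → Set
  Exec ts n ts′ = ∃[ q ] Steps (start , ts) n (q , ts′) × step (q , ts′) ≡ nothing

  -- A Hoare triple for total correctness with a step bound. The conditions are predicates on tapes
  -- because the blank cells that a program leaves around its strings are no part of its
  -- specification.
  record Within (n : ℕ) (P R : Vec Tape k → Set) : Set where
    constructor within
    field
      runs : ∀ {ts} → P ts → ∃[ m ] m ≤ n × ∃[ ts′ ] Exec ts m ts′ × R ts′

open Within public

-- Only transitions are preserved. Where C halts, D is free to continue, and there the combinators
-- attach their jumps.
Embeds : (C D : Code k) → (Code.Q C → Code.Q D) → Set
Embeds C D ι = ∀ q ss {q′ as} → Code.δ C q ss ≡ just (q′ , as) → Code.δ D (ι q) ss ≡ just (ι q′ , as)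

module _ (C : Code k) where
  open Code C

  step-δ : ∀ q ts {q′ as} → δ q (Vec.map scanned ts) ≡ just (q′ , as) → step (q , ts) ≡ just (q′ , zipWith act as ts)
  step-δ q ts eq rewrite eq = refl

  step-δ⁻ : ∀ {q ts c} → step (q , ts) ≡ just c →
            ∃[ q′ ] ∃[ as ] δ q (Vec.map scanned ts) ≡ just (q′ , as) × c ≡ (q′ , zipWith act as ts)
  step-δ⁻ {q} {ts} eq with δ q (Vec.map scanned ts)
  step-δ⁻ refl | just (q′ , as) = q′ , as , refl , refl

  halt-δ⁻ : ∀ {q ts} → step (q , ts) ≡ nothing → δ q (Vec.map scanned ts) ≡ nothing
  halt-δ⁻ {q} {ts} eq with δ q (Vec.map scanned ts)
  halt-δ⁻ refl | nothing = refl

  halt-δ : ∀ q ts → δ q (Vec.map scanned ts) ≡ nothing → step (q , ts) ≡ nothing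
  halt-δ q ts eq rewrite eq = refl

embed-steps : (C D : Code k) (ι : Code.Q C → Code.Q D) → Embeds C D ι →
              ∀ {c n d} → Steps C c n d → Steps D (map₁ ι c) n (map₁ ι d)
embed-steps C D ι em [] = []
embed-steps C D ι em (s ∷ r) with step-δ⁻ C s
... | q′ , as , eq , refl = step-δ D _ _ (em _ _ eq) ∷ embed-steps C D ι em r

_++ˢ_ : {C : Code k} → ∀ {c d e m n} → Steps C c m d → Steps C d n e → Steps C c (m + n) e
[]      ++ˢ r = r
(s ∷ l) ++ˢ r = s ∷ (l ++ˢ r)

idle : Symbol → Symbol × Move
idle s = s , stay

idle-act : (ts : Vec Tape k) → zipWith act (Vec.map idle (Vec.map scanned ts)) ts ≡ ts
idle-act []       = refl
idle-act (t ∷ ts) = cong (t ∷_) (idle-act ts)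

goto : {Q : Set} → Q → Vec Symbol k → Maybe (Q × Vec (Symbol × Move) k)
goto q ss = just (q , Vec.map idle ss)

goto-step : (C : Code k) → ∀ q ts {q′} → Code.δ C q (Vec.map scanned ts) ≡ goto q′ (Vec.map scanned ts) →
            Code.step C (q , ts) ≡ just (q′ , ts)
goto-step C q ts eq = trans (step-δ C q ts eq) (cong (λ ts → just (_ , ts)) (idle-act ts))

⊎-finite : {A B : Set} → ∃[ m ] A ↔ Fin m → ∃[ n ] B ↔ Fin n → ∃[ o ] (A ⊎ B) ↔ Fin o
⊎-finite (m , i) (n , j) = m + n , ↔-trans (i ⊎-↔ j) (↔-sym +↔⊎)

seqCode : Code k → Code k → Code k
seqCode C D = record
  { Q      = C.Q ⊎ D.Q
  ; finite = ⊎-finite C.finite D.finite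
  ; start  = inj₁ C.start
  ; δ      = δ }
  where
  module C = Code C
  module D = Code D
  δ : C.Q ⊎ D.Q → Vec Symbol _ → Maybe ((C.Q ⊎ D.Q) × Vec (Symbol × Move) _)
  δ (inj₁ q) ss with C.δ q ss
  ... | just (q′ , as) = just (inj₁ q′ , as)
  ... | nothing        = goto (inj₂ D.start) ss
  δ (inj₂ q) ss = Maybe.map (map₁ inj₂) (D.δ q ss)

seqCode-exec : (C D : Code k) → ∀ {ts m ts′ n ts″} → Exec C ts m ts′ → Exec D ts′ n ts″ → Exec (seqCode C D) ts (m + suc n) ts″
seqCode-exec C D {ts′ = ts′} {ts″ = ts″} (q , r , h) (q′ , r′ , h′) =
  inj₂ q′ , embed-steps C (seqCode C D) inj₁ em₁ r ++ˢ (goto-step (seqCode C D) (inj₁ q) ts′ jump ∷ embed-steps D (seqCode C D) inj₂ em₂ r′) ,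
  halt-δ (seqCode C D) (inj₂ q′) ts″ (cong (Maybe.map (map₁ inj₂)) (halt-δ⁻ D h′))
  where
  em₁ : Embeds C (seqCode C D) inj₁
  em₁ q ss eq rewrite eq = refl
  em₂ : Embeds D (seqCode C D) inj₂
  em₂ q ss eq rewrite eq = refl
  jump : Code.δ (seqCode C D) (inj₁ q) (Vec.map scanned ts′) ≡ goto (inj₂ (Code.start D)) (Vec.map scanned ts′)
  jump rewrite halt-δ⁻ C h = refl

seqCode-within : (C D : Code k) → ∀ {m n P R S} → Within C m P R → Within D n R S → Within (seqCode C D) (m + suc n) P S
seqCode-within C D wC wD .runs p with wC .runs p
... | m , m≤ , ts′ , e , r with wD .runs r
... | n , n≤ , ts″ , e′ , s = m + suc n , +-mono-≤ m≤ (s≤s n≤) , ts″ , seqCode-exec C D e e′ , s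

ifCode : Fin k → (Symbol → Bool) → Code k → Code k → Code k
ifCode i p C D = record
  { Q      = Unit.⊤ ⊎ (C.Q ⊎ D.Q)
  ; finite = ⊎-finite (1 , ↔-sym 1↔⊤) (⊎-finite C.finite D.finite)
  ; start  = inj₁ tt
  ; δ      = δ }
  where
  module C = Code C
  module D = Code D
  St : Set
  St = Unit.⊤ ⊎ (C.Q ⊎ D.Q)
  δ : St → Vec Symbol _ → Maybe (St × Vec (Symbol × Move) _)
  δ (inj₁ tt) ss with p (lookup ss i)
  ... | true  = goto (inj₂ (inj₁ C.start)) ss
  ... | false = goto (inj₂ (inj₂ D.start)) ss
  δ (inj₂ (inj₁ q)) ss = Maybe.map (map₁ (inj₂ ∘ inj₁)) (C.δ q ss)
  δ (inj₂ (inj₂ q)) ss = Maybe.map (map₁ (inj₂ ∘ inj₂)) (D.δ q ss)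

lookup-scanned : (i : Fin k) (ts : Vec Tape k) → lookup (Vec.map scanned ts) i ≡ scanned (lookup ts i)
lookup-scanned zero    (t ∷ ts) = refl
lookup-scanned (suc i) (t ∷ ts) = lookup-scanned i ts

ifCode-exec-true : (i : Fin k) (p : Symbol → Bool) (C D : Code k) → ∀ {ts n ts′} →
               p (scanned (lookup ts i)) ≡ true → Exec C ts n ts′ → Exec (ifCode i p C D) ts (suc n) ts′
ifCode-exec-true i p C D {ts} {ts′ = ts′} eq (q , r , h) =
  _ , goto-step (ifCode i p C D) (inj₁ tt) ts jump ∷ embed-steps C (ifCode i p C D) (inj₂ ∘ inj₁) em r ,
  halt-δ (ifCode i p C D) (inj₂ (inj₁ q)) ts′ (cong (Maybe.map (map₁ (inj₂ ∘ inj₁))) (halt-δ⁻ C h))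
  where
  em : Embeds C (ifCode i p C D) (inj₂ ∘ inj₁)
  em q ss eq rewrite eq = refl
  jump : Code.δ (ifCode i p C D) (inj₁ tt) (Vec.map scanned ts) ≡ goto (inj₂ (inj₁ (Code.start C))) (Vec.map scanned ts)
  jump rewrite lookup-scanned i ts | eq = refl

ifCode-exec-false : (i : Fin k) (p : Symbol → Bool) (C D : Code k) → ∀ {ts n ts′} →
                p (scanned (lookup ts i)) ≡ false → Exec D ts n ts′ → Exec (ifCode i p C D) ts (suc n) ts′
ifCode-exec-false i p C D {ts} {ts′ = ts′} eq (q , r , h) =
  _ , goto-step (ifCode i p C D) (inj₁ tt) ts jump ∷ embed-steps D (ifCode i p C D) (inj₂ ∘ inj₂) em r ,
  halt-δ (ifCode i p C D) (inj₂ (inj₂ q)) ts′ (cong (Maybe.map (map₁ (inj₂ ∘ inj₂))) (halt-δ⁻ D h))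
  where
  em : Embeds D (ifCode i p C D) (inj₂ ∘ inj₂)
  em q ss eq rewrite eq = refl
  jump : Code.δ (ifCode i p C D) (inj₁ tt) (Vec.map scanned ts) ≡ goto (inj₂ (inj₂ (Code.start D))) (Vec.map scanned ts)
  jump rewrite lookup-scanned i ts | eq = refl

whileCode : Fin k → (Symbol → Bool) → Code k → Code k
whileCode i p C = record
  { Q      = Unit.⊤ ⊎ C.Q
  ; finite = ⊎-finite (1 , ↔-sym 1↔⊤) C.finite
  ; start  = inj₁ tt
  ; δ      = δ }
  where
  module C = Code C
  δ : Unit.⊤ ⊎ C.Q → Vec Symbol _ → Maybe ((Unit.⊤ ⊎ C.Q) × Vec (Symbol × Move) _)
  δ (inj₁ tt) ss with p (lookup ss i)
  ... | true  = goto (inj₂ C.start) ss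
  ... | false = nothing
  δ (inj₂ q) ss with C.δ q ss
  ... | just (q′ , as) = just (inj₂ q′ , as)
  ... | nothing        = goto (inj₁ tt) ss

whileCode-exec-stop : (i : Fin k) (p : Symbol → Bool) (C : Code k) → ∀ {ts} →
                  p (scanned (lookup ts i)) ≡ false → Exec (whileCode i p C) ts 0 ts
whileCode-exec-stop i p C {ts} eq = _ , [] , halt-δ (whileCode i p C) (inj₁ tt) ts stop
  where
  stop : Code.δ (whileCode i p C) (inj₁ tt) (Vec.map scanned ts) ≡ nothing
  stop rewrite lookup-scanned i ts | eq = refl

-- The two additional steps lead from the test into the body, and back to the test from the state in
-- which the body halts.
whileCode-exec-step : (i : Fin k) (p : Symbol → Bool) (C : Code k) → ∀ {ts m ts′ n ts″} →
                  p (scanned (lookup ts i)) ≡ true → Exec C ts m ts′ → Exec (whileCode i p C) ts′ n ts″ →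
                  Exec (whileCode i p C) ts (suc (m + suc n)) ts″
whileCode-exec-step i p C {ts} {ts′ = ts′} eq (q , r , h) (q′ , r′ , h′) =
  _ , goto-step (whileCode i p C) (inj₁ tt) ts enter ∷ (embed-steps C (whileCode i p C) inj₂ em r ++ˢ (goto-step (whileCode i p C) (inj₂ q) ts′ back ∷ r′)) , h′
  where
  em : Embeds C (whileCode i p C) inj₂
  em q ss eq rewrite eq = refl
  enter : Code.δ (whileCode i p C) (inj₁ tt) (Vec.map scanned ts) ≡ goto (inj₂ (Code.start C)) (Vec.map scanned ts)
  enter rewrite lookup-scanned i ts | eq = refl
  back : Code.δ (whileCode i p C) (inj₂ q) (Vec.map scanned ts′) ≡ goto (inj₁ tt) (Vec.map scanned ts′)
  back rewrite halt-δ⁻ C h = refl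

Scans : Fin k → (Symbol → Bool) → Bool → (Vec Tape k → Set) → Set
Scans i p b P = ∀ ts → P ts → p (scanned (lookup ts i)) ≡ b

ifCode-within-true : (i : Fin k) (p : Symbol → Bool) (C D : Code k) → ∀ {n P R} →
                 Scans i p true P → Within C n P R → Within (ifCode i p C D) (suc n) P R
ifCode-within-true i p C D sc w .runs x with w .runs x
... | m , m≤ , ts′ , e , r = suc m , s≤s m≤ , ts′ , ifCode-exec-true i p C D (sc _ x) e , r

ifCode-within-false : (i : Fin k) (p : Symbol → Bool) (C D : Code k) → ∀ {n P R} →
                  Scans i p false P → Within D n P R → Within (ifCode i p C D) (suc n) P R
ifCode-within-false i p C D sc w .runs x with w .runs x
... | m , m≤ , ts′ , e , r = suc m , s≤s m≤ , ts′ , ifCode-exec-false i p C D (sc _ x) e , r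

whileCode-stop : (i : Fin k) (p : Symbol → Bool) (C : Code k) → ∀ {P} →
             Scans i p false P → Within (whileCode i p C) 0 P P
whileCode-stop i p C sc .runs x = 0 , z≤n , _ , whileCode-exec-stop i p C (sc _ x) , x

whileCode-step : (i : Fin k) (p : Symbol → Bool) (C : Code k) → ∀ {m n P R S} →
             Scans i p true P → Within C m P R → Within (whileCode i p C) n R S →
             Within (whileCode i p C) (2 + m + n) P S
whileCode-step i p C {m} {n} sc w w′ .runs x with w .runs x
... | m′ , m≤ , ts′ , e , r with w′ .runs r
... | n′ , n≤ , ts″ , e′ , s =
  _ , s≤s (≤-trans (+-mono-≤ m≤ (s≤s n≤)) (≤-reflexive (+-suc m n))) , ts″ , whileCode-exec-step i p C (sc _ x) e e′ , s

within-≤ : {C : Code k} → ∀ {m n P R} → m ≤ n → Within C m P R → Within C n P R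
within-≤ m≤n w .runs x with w .runs x
... | m , m≤ , r = m , ≤-trans m≤ m≤n , r

within-conseq : {C : Code k} → ∀ {n} {P P′ R R′ : Vec Tape k → Set} → (∀ {ts} → P′ ts → P ts) → (∀ {ts} → R ts → R′ ts) →
                Within C n P R → Within C n P′ R′
within-conseq f g w .runs x with w .runs (f x)
... | m , m≤ , ts , e , r = m , m≤ , ts , e , g r

primCode : (Vec Symbol k → Vec (Symbol × Move) k) → Code k
primCode {k} f = record { Q = Bool ; finite = 2 , ↔-sym 2↔Bool ; start = false ; δ = δ }
  where
  δ : Bool → Vec Symbol k → Maybe (Bool × Vec (Symbol × Move) k)
  δ false ss = just (true , f ss)
  δ true  ss = nothing

primCode-exec : (f : Vec Symbol k → Vec (Symbol × Move) k) → ∀ ts → Exec (primCode f) ts 1 (zipWith act (f (Vec.map scanned ts)) ts)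
primCode-exec f ts = true , refl ∷ [] , refl

exec-within : {C : Code k} → ∀ {n P R} (F : Vec Tape k → Vec Tape k) → (∀ ts → Exec C ts n (F ts)) →
              (∀ {ts} → P ts → R (F ts)) → Within C n P R
exec-within F e g .runs {ts} x = _ , ≤-refl , F ts , e ts , g x

-- Opaque, so that the unifier does not compare programs state by state.
opaque
  infixr 5 _⨟_
  _⨟_ : Code k → Code k → Code k
  _⨟_ = seqCode

  if : Fin k → (Symbol → Bool) → Code k → Code k → Code k
  if = ifCode

  while : Fin k → (Symbol → Bool) → Code k → Code k
  while = whileCode

  prim : (Vec Symbol k → Vec (Symbol × Move) k) → Code k
  prim = primCode

  ⨟-exec : (C D : Code k) → ∀ {ts m ts′ n ts″} → Exec C ts m ts′ → Exec D ts′ n ts″ → Exec (C ⨟ D) ts (m + suc n) ts″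
  ⨟-exec = seqCode-exec

  ⨟-within : (C D : Code k) → ∀ {m n P R S} → Within C m P R → Within D n R S → Within (C ⨟ D) (m + suc n) P S
  ⨟-within = seqCode-within

  if-within-true : (i : Fin k) (p : Symbol → Bool) (C D : Code k) → ∀ {n P R} →
                   Scans i p true P → Within C n P R → Within (if i p C D) (suc n) P R
  if-within-true = ifCode-within-true

  if-within-false : (i : Fin k) (p : Symbol → Bool) (C D : Code k) → ∀ {n P R} →
                    Scans i p false P → Within D n P R → Within (if i p C D) (suc n) P R
  if-within-false = ifCode-within-false

  while-stop : (i : Fin k) (p : Symbol → Bool) (C : Code k) → ∀ {P} →
               Scans i p false P → Within (while i p C) 0 P P
  while-stop = whileCode-stop

  while-step : (i : Fin k) (p : Symbol → Bool) (C : Code k) → ∀ {m n P R S} →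
               Scans i p true P → Within C m P R → Within (while i p C) n R S →
               Within (while i p C) (2 + m + n) P S
  while-step = whileCode-step

  prim-exec : (f : Vec Symbol k → Vec (Symbol × Move) k) → ∀ ts → Exec (prim f) ts 1 (zipWith act (f (Vec.map scanned ts)) ts)
  prim-exec = primCode-exec

-- Tapes as stacks

onTape : Fin k → (Symbol → Symbol × Move) → Vec Symbol k → Vec (Symbol × Move) k
onTape zero    a (s ∷ ss) = a s ∷ Vec.map idle ss
onTape (suc i) a (s ∷ ss) = idle s ∷ onTape i a ss

onTape-act : (i : Fin k) (a : Symbol → Symbol × Move) (ts : Vec Tape k) →
             zipWith act (onTape i a (Vec.map scanned ts)) ts ≡ updateAt ts i (λ t → act (a (scanned t)) t)
onTape-act zero    a (t ∷ ts) = cong (_ ∷_) (idle-act ts)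
onTape-act (suc i) a (t ∷ ts) = cong (t ∷_) (onTape-act i a ts)

onTape-exec : (i : Fin k) (a : Symbol → Symbol × Move) → ∀ ts →
              Exec (prim (onTape i a)) ts 1 (updateAt ts i (λ t → act (a (scanned t)) t))
onTape-exec i a ts = subst (Exec (prim (onTape i a)) ts 1) (onTape-act i a ts) (prim-exec (onTape i a) ts)

-- Blanking the vacated cell keeps everything left of the head blank, as `Holds` demands.
pop : Fin k → Code k
pop i = prim (onTape i λ _ → nothing , right)

pushAct : Bool → Tape → Tape
pushAct b t = act (just b , stay) (move left t)

popAct : Tape → Tape
popAct t = act (nothing , right) t

pop-exec : (i : Fin k) → ∀ ts → Exec (pop i) ts 1 (updateAt ts i popAct)
pop-exec i = onTape-exec i _

-- A transition writes before it moves, so a push takes two: one to reach the blank cell left of the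
-- stack, one to fill it.
push : Bool → Fin k → Code k
push b i = prim (onTape i λ s → s , left) ⨟ prim (onTape i λ _ → just b , stay)

updateAt-∘ : {A : Set} (i : Fin k) {f g : A → A} (xs : Vec A k) → updateAt (updateAt xs i f) i g ≡ updateAt xs i (g ∘ f)
updateAt-∘ zero    (x ∷ xs) = refl
updateAt-∘ (suc i) (x ∷ xs) = cong (x ∷_) (updateAt-∘ i xs)

push-exec : (b : Bool) (i : Fin k) → ∀ ts → Exec (push b i) ts 3 (updateAt ts i (pushAct b))
push-exec b i ts = subst (Exec (push b i) ts 3) (updateAt-∘ i ts)
  (⨟-exec _ _ (onTape-exec i (λ s → s , left) ts) (onTape-exec i (λ _ → just b , stay) _))

-- The right-hand list may carry additional blanks.
infix 4 _⊑_ _⊑ᵗ_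
data _⊑_ : List Symbol → List Symbol → Set where
  blanks : ∀ {l} → All (_≡ nothing) l → [] ⊑ l
  _∷_    : ∀ s {l l′} → l ⊑ l′ → s ∷ l ⊑ s ∷ l′

record _⊑ᵗ_ (t t′ : Tape) : Set where
  constructor ⊑tape
  field
    before⊑  : before t ⊑ before t′
    scanned≡ : scanned t ≡ scanned t′
    after⊑   : after t ⊑ after t′

open _⊑ᵗ_ public

⊑-refl : ∀ {l} → l ⊑ l
⊑-refl {[]}    = blanks []
⊑-refl {s ∷ l} = s ∷ ⊑-refl

⊑ᵗ-refl : ∀ {t} → t ⊑ᵗ t
⊑ᵗ-refl = ⊑tape ⊑-refl refl ⊑-refl

-- A head that leaves the listed cells finds a blank, which is also what a surplus listed cell
-- contains; so no action can tell the two tapes apart.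
act-mono : ∀ a {t t′} → t ⊑ᵗ t′ → act a t ⊑ᵗ act a t′
act-mono (s , stay)  (⊑tape b e a)                        = ⊑tape b refl a
act-mono (s , left)  (⊑tape (blanks []) e a)              = ⊑tape (blanks []) refl (s ∷ a)
act-mono (s , left)  (⊑tape (blanks (refl ∷ al)) e a)     = ⊑tape (blanks al) refl (s ∷ a)
act-mono (s , left)  (⊑tape (x ∷ b) e a)                  = ⊑tape b refl (s ∷ a)
act-mono (s , right) (⊑tape b e (blanks []))              = ⊑tape (s ∷ b) refl (blanks [])
act-mono (s , right) (⊑tape b e (blanks (refl ∷ al)))     = ⊑tape (s ∷ b) refl (blanks al)
act-mono (s , right) (⊑tape b e (x ∷ a))                  = ⊑tape (s ∷ b) refl a

-- A tape whose head is on the top of a stack, all cells left of it being blank.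
Holds : Str → Tape → Set
Holds s t = write s ⊑ᵗ t

push-holds : ∀ b s {t} → Holds s t → Holds (b ∷ s) (pushAct b t)
push-holds b [] (⊑tape (blanks []) refl (blanks al)) = ⊑tape (blanks []) refl (blanks (refl ∷ al))
push-holds b [] (⊑tape (blanks (refl ∷ bl)) refl (blanks al)) = ⊑tape (blanks bl) refl (blanks (refl ∷ al))
push-holds b (c ∷ s) (⊑tape (blanks []) refl a) = ⊑tape (blanks []) refl (just c ∷ a)
push-holds b (c ∷ s) (⊑tape (blanks (refl ∷ bl)) refl a) = ⊑tape (blanks bl) refl (just c ∷ a)

-- On an empty stack the head merely drifts over blanks, in accordance with `drop 1 [] = []`.
pop-holds : ∀ s {t} → Holds s t → Holds (drop 1 s) (popAct t)
pop-holds [] (⊑tape (blanks bl) e (blanks [])) = ⊑tape (blanks (refl ∷ bl)) refl (blanks [])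
pop-holds [] (⊑tape (blanks bl) e (blanks (refl ∷ al))) = ⊑tape (blanks (refl ∷ bl)) refl (blanks al)
pop-holds (b ∷ []) (⊑tape (blanks bl) e (blanks [])) = ⊑tape (blanks (refl ∷ bl)) refl (blanks [])
pop-holds (b ∷ []) (⊑tape (blanks bl) e (blanks (refl ∷ al))) = ⊑tape (blanks (refl ∷ bl)) refl (blanks al)
pop-holds (b ∷ c ∷ s) (⊑tape (blanks bl) e (_ ∷ a)) = ⊑tape (blanks (refl ∷ bl)) refl a

top : Str → Symbol
top []      = nothing
top (b ∷ _) = just b

holds-top : ∀ s {t} → Holds s t → scanned t ≡ top s
holds-top []      h = sym (scanned≡ h)
holds-top (b ∷ s) h = sym (scanned≡ h)

bits-mono : ∀ {l l′} → l ⊑ l′ → bitsUpToBlank l ≡ bitsUpToBlank l′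
bits-mono (blanks [])         = refl
bits-mono (blanks (refl ∷ _)) = refl
bits-mono (nothing ∷ r)       = refl
bits-mono (just b ∷ r)        = cong (b ∷_) (bits-mono r)

read-mono : ∀ {t t′} → t ⊑ᵗ t′ → read t ≡ read t′
read-mono (⊑tape _ refl a) = bits-mono (_ ∷ a)

read-write : ∀ s → read (write s) ≡ s
read-write []      = refl
read-write (b ∷ s) = cong (b ∷_) (bits-just s)
  where
  bits-just : ∀ s → bitsUpToBlank (map just s) ≡ s
  bits-just []      = refl
  bits-just (b ∷ s) = cong (b ∷_) (bits-just s)

Rep : Vec Str k → Vec Tape k → Set
Rep = Pointwise Holds

rep-update : (i : Fin k) {f : Str → Str} {F : Tape → Tape} → (∀ s {t} → Holds s t → Holds (f s) (F t)) →
             ∀ {σ ts} → Rep σ ts → Rep (updateAt σ i f) (updateAt ts i F)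
rep-update zero    h (x ∷ xs) = h _ x ∷ xs
rep-update (suc i) h (x ∷ xs) = x ∷ rep-update i h xs

push-rep : ∀ b (i : Fin k) {σ} → Within (push b i) 3 (Rep σ) (Rep (updateAt σ i (b ∷_)))
push-rep b i = exec-within _ (push-exec b i) (rep-update i (push-holds b))

pop-rep : ∀ (i : Fin k) {σ} → Within (pop i) 1 (Rep σ) (Rep (updateAt σ i (drop 1)))
pop-rep i = exec-within _ (pop-exec i) (rep-update i pop-holds)

scans-rep : (i : Fin k) (p : Symbol → Bool) {σ : Vec Str k} → ∀ {b} → p (top (lookup σ i)) ≡ b → Scans i p b (Rep σ)
scans-rep i p {σ} eq ts r = trans (cong p (holds-top (lookup σ i) (PW.lookup r i))) eq

-- Register 0 is the input and output of every program, so the idle register goes behind it. It may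
-- hold any string, which is how pairing and loops keep data during a call.
insertCode : Code (suc k) → Code (suc (suc k))
insertCode {k} C = record { Q = C.Q ; finite = C.finite ; start = C.start ; δ = δ }
  where
  module C = Code C
  spread : Symbol → C.Q × Vec (Symbol × Move) (suc k) → C.Q × Vec (Symbol × Move) (suc (suc k))
  spread e (q , a ∷ as) = q , a ∷ idle e ∷ as
  δ : C.Q → Vec Symbol (suc (suc k)) → Maybe (C.Q × Vec (Symbol × Move) (suc (suc k)))
  δ q (s ∷ e ∷ ss) = Maybe.map (spread e) (C.δ q (s ∷ ss))

insertAt1 : {A : Set} → A → Vec A (suc k) → Vec A (suc (suc k))
insertAt1 y (x ∷ xs) = x ∷ y ∷ xs

insertCode-steps : (C : Code (suc k)) (y : Tape) → ∀ {q ts n q′ ts′} → Steps C (q , ts) n (q′ , ts′) →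
               Steps (insertCode C) (q , insertAt1 y ts) n (q′ , insertAt1 y ts′)
insertCode-steps C y [] = []
insertCode-steps C y {q} {t ∷ ts} (s ∷ r) with step-δ⁻ C s
... | q₁ , a ∷ as , eq , refl = step-δ (insertCode C) q (t ∷ y ∷ ts) eq′ ∷ insertCode-steps C y r
  where
  eq′ : Code.δ (insertCode C) q (Vec.map scanned (t ∷ y ∷ ts)) ≡ just (q₁ , a ∷ idle (scanned y) ∷ as)
  eq′ rewrite eq = refl

insertCode-within : (C : Code (suc k)) → ∀ {n x y x′} {σ σ′ : Vec Str k} →
                Within C n (Rep (x ∷ σ)) (Rep (x′ ∷ σ′)) → Within (insertCode C) n (Rep (x ∷ y ∷ σ)) (Rep (x′ ∷ y ∷ σ′))
insertCode-within C w .runs {t ∷ u ∷ ts} (p ∷ h ∷ ps) with w .runs (p ∷ ps)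
... | m , m≤ , t′ ∷ ts′ , (q , r , s) , (p′ ∷ ps′) =
  m , m≤ , t′ ∷ u ∷ ts′ , (q , insertCode-steps C u r , halt-δ (insertCode C) q (t′ ∷ u ∷ ts′) eq) , p′ ∷ h ∷ ps′
  where
  eq : Code.δ (insertCode C) q (Vec.map scanned (t′ ∷ u ∷ ts′)) ≡ nothing
  eq rewrite halt-δ⁻ C s = refl

opaque
  insert : Code (suc k) → Code (suc (suc k))
  insert = insertCode

  insert-within : (C : Code (suc k)) → ∀ {n x y x′} {σ σ′ : Vec Str k} →
                  Within C n (Rep (x ∷ σ)) (Rep (x′ ∷ σ′)) → Within (insert C) n (Rep (x ∷ y ∷ σ)) (Rep (x′ ∷ y ∷ σ′))
  insert-within = insertCode-within

-- Polynomial bounds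

eval-mono : ∀ p {m n} → m ≤ n → eval p m ≤ eval p n
eval-mono []      le = z≤n
eval-mono (a ∷ p) le = +-monoʳ-≤ a (*-mono-≤ le (eval-mono p le))

_+ᵖ_ : Poly → Poly → Poly
[]      +ᵖ q       = q
(a ∷ p) +ᵖ []      = a ∷ p
(a ∷ p) +ᵖ (b ∷ q) = a + b ∷ p +ᵖ q

eval-+ᵖ : ∀ p q n → eval (p +ᵖ q) n ≡ eval p n + eval q n
eval-+ᵖ []      q       n = refl
eval-+ᵖ (a ∷ p) []      n = sym (+-identityʳ _)
eval-+ᵖ (a ∷ p) (b ∷ q) n rewrite eval-+ᵖ p q n = lemma a b n (eval p n) (eval q n)
  where
  lemma : ∀ a b n x y → a + b + n * (x + y) ≡ a + n * x + (b + n * y)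
  lemma = solve-∀

_*ᵖ_ : Poly → Poly → Poly
[]      *ᵖ q = []
(a ∷ p) *ᵖ q = map (a *_) q +ᵖ (0 ∷ p *ᵖ q)

eval-map : ∀ a q n → eval (map (a *_) q) n ≡ a * eval q n
eval-map a []      n = sym (*-zeroʳ a)
eval-map a (b ∷ q) n rewrite eval-map a q n = lemma a b n (eval q n)
  where
  lemma : ∀ a b n x → a * b + n * (a * x) ≡ a * (b + n * x)
  lemma = solve-∀

eval-*ᵖ : ∀ p q n → eval (p *ᵖ q) n ≡ eval p n * eval q n
eval-*ᵖ []      q n = refl
eval-*ᵖ (a ∷ p) q n
  rewrite eval-+ᵖ (map (a *_) q) (0 ∷ p *ᵖ q) n | eval-map a q n | eval-*ᵖ p q n = lemma a n (eval p n) (eval q n)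
  where
  lemma : ∀ a n x y → a * y + n * (x * y) ≡ (a + n * x) * y
  lemma = solve-∀

record Bounded (inp : A → Str) (h : A → ℕ) : Set where
  constructor bounded
  field
    poly : Poly
    bound : ∀ a → h a ≤ eval poly (length (inp a))

open Bounded public

module _ {inp : A → Str} where
  constᵇ : ∀ c → Bounded inp (λ _ → c)
  constᵇ c = bounded [ c ] λ a → m≤m+n c _

  lenᵇ : Bounded inp (length ∘ inp)
  lenᵇ = bounded (0 ∷ 1 ∷ []) λ a → ≤-reflexive (sym (lemma (length (inp a))))
    where
    lemma : ∀ n → 0 + n * (1 + n * 0) ≡ n
    lemma = solve-∀

  infixl 6 _+ᵇ_
  infixl 7 _*ᵇ_
  _+ᵇ_ : ∀ {g h} → Bounded inp g → Bounded inp h → Bounded inp (λ a → g a + h a)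
  (bounded p f +ᵇ bounded q g) = bounded (p +ᵖ q) λ a →
    ≤-trans (+-mono-≤ (f a) (g a)) (≤-reflexive (sym (eval-+ᵖ p q (length (inp a)))))

  _*ᵇ_ : ∀ {g h} → Bounded inp g → Bounded inp h → Bounded inp (λ a → g a * h a)
  (bounded p f *ᵇ bounded q g) = bounded (p *ᵖ q) λ a →
    ≤-trans (*-mono-≤ (f a) (g a)) (≤-reflexive (sym (eval-*ᵖ p q (length (inp a)))))

  sucᵇ : ∀ {h} → Bounded inp h → Bounded inp (λ a → suc (h a))
  sucᵇ b = constᵇ 1 +ᵇ b

  infixr 5 _⨟ᵇ_
  -- This is the running time of `_⨟_`, one jump included, so that bounds can be assembled in
  -- parallel with programs.
  _⨟ᵇ_ : ∀ {g h} → Bounded inp g → Bounded inp h → Bounded inp (λ a → g a + suc (h a))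
  b ⨟ᵇ c = b +ᵇ sucᵇ c

  ≤ᵇ : ∀ {g h} → (∀ a → g a ≤ h a) → Bounded inp h → Bounded inp g
  ≤ᵇ le (bounded p f) = bounded p λ a → ≤-trans (le a) (f a)

  evalᵇ : ∀ {h} p → Bounded inp h → Bounded inp (eval p ∘ h)
  evalᵇ []      b = constᵇ 0
  evalᵇ (c ∷ p) b = constᵇ c +ᵇ b *ᵇ evalᵇ p b

∘ᵇ : ∀ {inp : A → Str} {inp′ : A′ → Str} {t} (h : A → A′) → Bounded inp (length ∘ inp′ ∘ h) → Bounded inp′ t →
     Bounded inp (t ∘ h)
∘ᵇ h b (bounded p f) = ≤ᵇ (f ∘ h) (evalᵇ p b)

-- Register programs

isTrue : Symbol → Bool
isTrue (just true) = true
isTrue _           = false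

isTrue-just : ∀ b → isTrue (just b) ≡ b
isTrue-just true  = refl
isTrue-just false = refl

-- The popped bit survives only in the control state, where it selects one of two copies of the
-- body.
drain : Fin k → (Bool → Code k) → Code k
drain i f = while i is-just (if i isTrue (pop i ⨟ f true) (pop i ⨟ f false))

HoldsAt : Fin k → Str → (Vec Tape k → Set) → Set
HoldsAt i s P = ∀ ts → P ts → Holds s (lookup ts i)

rep-holds : (i : Fin k) → ∀ {σ : Vec Str k} {s} → lookup σ i ≡ s → HoldsAt i s (Rep σ)
rep-holds i refl ts r = PW.lookup r i

holds-scans : (i : Fin k) (p : Symbol → Bool) → ∀ s {P} → HoldsAt i s P → Scans i p (p (top s)) P
holds-scans i p s h ts x = cong p (holds-top s (h ts x))

drain-stop : (i : Fin k) (f : Bool → Code k) → ∀ {P} → HoldsAt i [] P → Within (drain i f) 0 P P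
drain-stop i f h = while-stop i is-just _ (holds-scans i is-just [] h)

drain-step : (i : Fin k) (f : Bool → Code k) → ∀ {b xs P P′ R S} → HoldsAt i (b ∷ xs) P →
             (∀ {ts} → P ts → P′ (updateAt ts i popAct)) →
             Within (f b) m P′ R → Within (drain i f) n R S → Within (drain i f) (5 + m + n) P S
drain-step {m = m} i f {b} {xs} {P} {P′} {R} h popped w w′ =
  while-step i is-just _ (holds-scans i is-just (b ∷ xs) h) (body b h w) w′
  where
  body : ∀ b → HoldsAt i (b ∷ xs) P → Within (f b) m P′ R →
         Within (if i isTrue (pop i ⨟ f true) (pop i ⨟ f false)) (3 + m) P R
  body true  h w = if-within-true i isTrue _ _ (holds-scans i isTrue (true ∷ xs) h)
                     (⨟-within (pop i) (f true) (exec-within _ (pop-exec i) popped) w)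
  body false h w = if-within-false i isTrue _ _ (holds-scans i isTrue (false ∷ xs) h)
                     (⨟-within (pop i) (f false) (exec-within _ (pop-exec i) popped) w)

drain-step-rep : (i : Fin k) (f : Bool → Code k) → ∀ {σ b xs R S} → lookup σ i ≡ b ∷ xs →
                 Within (f b) m (Rep (updateAt σ i (drop 1))) R → Within (drain i f) n R S →
                 Within (drain i f) (5 + m + n) (Rep σ) S
drain-step-rep i f eq = drain-step i f (rep-holds i eq) (rep-update i pop-holds)

drain-stop-rep : (i : Fin k) (f : Bool → Code k) → ∀ {σ} → lookup σ i ≡ [] → Within (drain i f) 0 (Rep σ) (Rep σ)
drain-stop-rep i f eq = drain-stop i f (rep-holds i eq)

ends-at : {C : Code k} {X : Set} (R : X → Vec Tape k → Set) → ∀ {P x y} → x ≡ y → Within C n P (R x) → Within C n P (R y)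
ends-at R refl w = w

moveRev : Fin k → Fin k → Code k
moveRev i j = drain i λ b → push b j

-- The function `σ` displays a register vector in terms of the two stacks concerned. For concrete
-- registers both equations hold by `refl`.
moveRev-within : (i j : Fin k) (σ : Str → Str → Vec Str k) → (∀ xs ys → lookup (σ xs ys) i ≡ xs) →
                 (∀ b xs ys → updateAt (updateAt (σ (b ∷ xs) ys) i (drop 1)) j (b ∷_) ≡ σ xs (b ∷ ys)) →
                 ∀ xs ys → Within (moveRev i j) (length xs * 8) (Rep (σ xs ys)) (Rep (σ [] (xs ʳ++ ys)))
moveRev-within i j σ l u []       ys = drain-stop-rep i (λ b → push b j) (l [] ys)
moveRev-within i j σ l u (b ∷ xs) ys =
  drain-step-rep i (λ b → push b j) (l (b ∷ xs) ys)
    (subst (λ σ′ → Within (push b j) 3 _ (Rep σ′)) (u b xs ys) (push-rep b j))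
    (moveRev-within i j σ l u xs (b ∷ ys))

clear : Fin k → Code k
clear i = while i is-just (pop i)

clear-within : (i : Fin k) (σ : Str → Vec Str k) → (∀ xs → lookup (σ xs) i ≡ xs) →
               (∀ b xs → updateAt (σ (b ∷ xs)) i (drop 1) ≡ σ xs) →
               ∀ xs → Within (clear i) (length xs * 3) (Rep (σ xs)) (Rep (σ []))
clear-within i σ l u [] = while-stop i is-just _ (scans-rep i is-just (cong (is-just ∘ top) (l [])))
clear-within i σ l u (b ∷ xs) =
  while-step i is-just _ (scans-rep i is-just (cong (is-just ∘ top) (l (b ∷ xs))))
    (subst (λ σ′ → Within (pop i) 1 _ (Rep σ′)) (u b xs) (pop-rep i))
    (clear-within i σ l u xs)

-- Splitting and joining pairs

-- The values of π₁ and π₂ on strings that are not pairs are irrelevant.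
π₁ : Str → Str
π₁ []             = []
π₁ (false ∷ s)    = []
π₁ (true ∷ [])    = [ false ]
π₁ (true ∷ b ∷ s) = b ∷ π₁ s

afterFirst : Str → Str
afterFirst []             = []
afterFirst (false ∷ s)    = false ∷ s
afterFirst (true ∷ [])    = []
afterFirst (true ∷ b ∷ s) = afterFirst s

π₂ : Str → Str
π₂ = drop 1 ∘ afterFirst

π₁-pair : ∀ v {w} → π₁ ⟨ v , w ⟩ ≡ v
π₁-pair []      = refl
π₁-pair (b ∷ v) = cong (b ∷_) (π₁-pair v)

π₂-pair : ∀ v {w} → π₂ ⟨ v , w ⟩ ≡ w
π₂-pair []      = refl
π₂-pair (b ∷ v) = π₂-pair v

length-π₁ : ∀ s → length (π₁ s) ≤ length s
length-π₁ []             = z≤n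
length-π₁ (false ∷ s)    = z≤n
length-π₁ (true ∷ [])    = s≤s z≤n
length-π₁ (true ∷ b ∷ s) = s≤s (m≤n⇒m≤1+n (length-π₁ s))

length-afterFirst : ∀ s → length (afterFirst s) ≤ length s
length-afterFirst []             = z≤n
length-afterFirst (false ∷ s)    = ≤-refl
length-afterFirst (true ∷ [])    = z≤n
length-afterFirst (true ∷ b ∷ s) = m≤n⇒m≤1+n (m≤n⇒m≤1+n (length-afterFirst s))

length-drop1 : (s : Str) → length (drop 1 s) ≤ length s
length-drop1 []      = z≤n
length-drop1 (b ∷ s) = n≤1+n _

length-π₂ : ∀ s → length (π₂ s) ≤ length s
length-π₂ s = ≤-trans (length-drop1 (afterFirst s)) (length-afterFirst s)

splitBody : Code (2 + k)
splitBody = pop zero ⨟ if zero isTrue (pop zero ⨟ push true (suc zero)) (pop zero ⨟ push false (suc zero))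

splitLoop split : Code (2 + k)
splitLoop = while zero isTrue splitBody
split = splitLoop ⨟ pop zero

splitLoop-within : ∀ s acc {σ : Vec Str k} → Within splitLoop (length s * 10) (Rep (s ∷ acc ∷ σ))
                     (Rep (afterFirst s ∷ (π₁ s ʳ++ acc) ∷ σ))
splitLoop-within []          acc = while-stop zero isTrue _ (scans-rep zero isTrue refl)
splitLoop-within (false ∷ s) acc = within-≤ z≤n (while-stop zero isTrue _ (scans-rep zero isTrue refl))
-- The payload bit is missing. The program sees a blank, which `isTrue` counts as false, and the
-- malformed case of `π₁` is defined to agree.
splitLoop-within (true ∷ []) acc =
  while-step zero isTrue _ (scans-rep zero isTrue refl)
    (⨟-within (pop zero) _ (pop-rep zero)
      (if-within-false zero isTrue _ _ (scans-rep zero isTrue refl)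
        (⨟-within (pop zero) (push false (suc zero)) (pop-rep zero) (push-rep false (suc zero)))))
    (splitLoop-within [] (false ∷ acc))
splitLoop-within (true ∷ true ∷ s) acc =
  within-≤ (+-monoʳ-≤ 10 (m≤n+m (length s * 10) 10)) (while-step zero isTrue _ (scans-rep zero isTrue refl)
    (⨟-within (pop zero) _ (pop-rep zero)
      (if-within-true zero isTrue _ _ (scans-rep zero isTrue refl)
        (⨟-within (pop zero) (push true (suc zero)) (pop-rep zero) (push-rep true (suc zero)))))
    (splitLoop-within s (true ∷ acc)))
splitLoop-within (true ∷ false ∷ s) acc =
  within-≤ (+-monoʳ-≤ 10 (m≤n+m (length s * 10) 10)) (while-step zero isTrue _ (scans-rep zero isTrue refl)
    (⨟-within (pop zero) _ (pop-rep zero)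
      (if-within-false zero isTrue _ _ (scans-rep zero isTrue refl)
        (⨟-within (pop zero) (push false (suc zero)) (pop-rep zero) (push-rep false (suc zero)))))
    (splitLoop-within s (false ∷ acc)))

split-within : ∀ s acc {σ : Vec Str k} → Within split (length s * 10 + 2) (Rep (s ∷ acc ∷ σ))
                 (Rep (π₂ s ∷ (π₁ s ʳ++ acc) ∷ σ))
split-within s acc = ⨟-within splitLoop (pop zero) (splitLoop-within s acc) (pop-rep zero)

joinUp : Str → Str → Str
joinUp []      w = w
joinUp (b ∷ r) w = joinUp r (true ∷ b ∷ w)

-- The first component waits on its stack in reverse, so its last bit is framed first and the code
-- grows from right to left.
joinUp-ʳ++ : ∀ v r w → joinUp (v ʳ++ r) w ≡ joinUp r (concatMap (λ b → true ∷ b ∷ []) v ++ w)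
joinUp-ʳ++ []      r w = refl
joinUp-ʳ++ (b ∷ v) r w = joinUp-ʳ++ v (b ∷ r) w

joinBit : Bool → Code (2 + k)
joinBit b = push b zero ⨟ push true zero

join : Code (2 + k)
join = drain (suc zero) joinBit

join-within : ∀ r w {σ : Vec Str k} → Within join (length r * 12) (Rep (w ∷ r ∷ σ)) (Rep (joinUp r w ∷ [] ∷ σ))
join-within []      w = drain-stop-rep (suc zero) joinBit refl
join-within (b ∷ r) w =
  drain-step-rep (suc zero) joinBit refl
    (⨟-within (push b zero) (push true zero) (push-rep b zero) (push-rep true zero))
    (join-within r (true ∷ b ∷ w))

forkBit : Bool → Code (3 + k)
forkBit b = push b (suc zero) ⨟ push b (suc (suc zero))

join-reverse : ∀ v w {σ : Vec Str k} →
               Within join (length v * 12) (Rep ((false ∷ w) ∷ (v ʳ++ []) ∷ σ)) (Rep (⟨ v , w ⟩ ∷ [] ∷ σ))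
join-reverse v w {σ} = subst₂ (λ n s → Within join (n * 12) (Rep ((false ∷ w) ∷ (v ʳ++ []) ∷ σ)) (Rep (s ∷ [] ∷ σ)))
  (length-reverse v) (joinUp-ʳ++ v [] (false ∷ w)) (join-within (v ʳ++ []) (false ∷ w))

-- Draining destroys a register, so a string is copied by draining it into two others at once.
fork : Code (3 + k)
fork = drain zero forkBit

fork-within : ∀ xs ys zs {σ : Vec Str k} → Within fork (length xs * 12) (Rep (xs ∷ ys ∷ zs ∷ σ))
                (Rep ([] ∷ (xs ʳ++ ys) ∷ (xs ʳ++ zs) ∷ σ))
fork-within []       ys zs = drain-stop-rep zero forkBit refl
fork-within (b ∷ xs) ys zs =
  drain-step-rep zero forkBit refl
    (⨟-within (push b (suc zero)) (push b (suc (suc zero))) (push-rep b (suc zero)) (push-rep b (suc (suc zero))))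
    (fork-within xs (b ∷ ys) (b ∷ zs))

-- Closure properties of computable functions

-- All registers but the first are empty before and after, so that programs can be composed and repeated.

record Prog {A : Set} (inp out : A → Str) (time : A → ℕ) (k : ℕ) : Set₁ where
  field
    code     : Code (suc k)
    computes : ∀ a → Within code (time a) (Rep (inp a ∷ replicate k [])) (Rep (out a ∷ replicate k []))

open Prog public

infix 3 _⇝_
record _⇝_ {A : Set} (inp out : A → Str) : Set₁ where
  field
    {registers} : ℕ
    {time}      : A → ℕ
    timeᵇ       : Bounded inp time
    prog        : Prog inp out time registers

open _⇝_ public

widen : ∀ n {inp out : A → Str} {time} → Prog inp out time k → Prog inp out time (n + k)
widen zero    p = p
widen (suc n) p = record
  { code     = insert (code (widen n p))
  ; computes = λ a → insert-within _ (computes (widen n p) a) }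

widenʳ : ∀ n {inp out : A → Str} {time} → Prog inp out time k → Prog inp out time (k + n)
widenʳ {k = k} n {inp} {out} {time} p = subst (Prog inp out time) (+-comm n k) (widen n p)

size : Tape → ℕ
size t = length (before t) + length (after t)

size-act : ∀ a t → size (act a t) ≤ suc (size t)
size-act (s , stay)  t                     = n≤1+n _
size-act (s , left)  (tape [] _ rs)        = ≤-refl
size-act (s , left)  (tape (l ∷ ls) _ rs)  = ≤-trans (≤-reflexive (+-suc (length ls) _)) (n≤1+n _)
size-act (s , right) (tape ls _ [])        = ≤-refl
size-act (s , right) (tape ls _ (r ∷ rs))  = ≤-trans (≤-reflexive (sym (+-suc (length ls) _))) (n≤1+n _)

size-zipWith : ∀ (i : Fin k) as ts → size (lookup (zipWith act as ts) i) ≤ suc (size (lookup ts i))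
size-zipWith zero    (a ∷ as) (t ∷ ts) = size-act a t
size-zipWith (suc i) (a ∷ as) (t ∷ ts) = size-zipWith i as ts

size-steps : (C : Code k) (i : Fin k) → ∀ {q ts n q′ ts′} → Steps C (q , ts) n (q′ , ts′) →
             size (lookup ts′ i) ≤ n + size (lookup ts i)
size-steps C i []      = ≤-refl
size-steps C i {ts = ts} (_∷_ {n = n} s r) with step-δ⁻ C s
... | q , as , eq , refl = ≤-trans (size-steps C i r)
  (≤-trans (+-monoʳ-≤ n (size-zipWith i as ts)) (≤-reflexive (+-suc n _)))

size-write : ∀ s → size (write s) ≤ length s
size-write []      = z≤n
size-write (b ∷ s) = ≤-trans (≤-reflexive (length-map just s)) (n≤1+n _)

⊑-length : ∀ {l l′} → l ⊑ l′ → length l ≤ length l′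
⊑-length (blanks _) = z≤n
⊑-length (_ ∷ r)    = s≤s (⊑-length r)

length-write : ∀ s → length s ≤ suc (length (after (write s)))
length-write []      = z≤n
length-write (b ∷ s) = s≤s (≤-reflexive (sym (length-map just s)))

rep-write : (σ : Vec Str k) → Rep σ (Vec.map write σ)
rep-write []      = []
rep-write (s ∷ σ) = ⊑ᵗ-refl ∷ rep-write σ

-- A tape grows by at most one cell per step, so the running time bounds the output. This keeps
-- compositions polynomial without separate estimates of intermediate results.
prog-length : ∀ {inp out : A → Str} {time} → Prog inp out time k → ∀ a → length (out a) ≤ suc (time a + length (inp a))
prog-length {k = k} {inp} {out} p a with computes p a .runs (rep-write (inp a ∷ replicate k []))
... | n , n≤ , t ∷ ts , (q , r , _) , h ∷ hs =
  ≤-trans (length-write (out a)) (s≤s (≤-trans (⊑-length (after⊑ h))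
    (≤-trans (m≤n+m _ (length (before t)))
    (≤-trans (size-steps (code p) zero r) (+-mono-≤ n≤ (size-write (inp a)))))))

outᵇ : ∀ {inp out : A → Str} → inp ⇝ out → Bounded inp (length ∘ out)
outᵇ f = ≤ᵇ (prog-length (prog f)) (sucᵇ (timeᵇ f +ᵇ lenᵇ))

programmed : ∀ {inp out : A → Str} {time} (C : Code (suc k)) → Bounded inp time →
             (∀ a → Within C (time a) (Rep (inp a ∷ replicate k [])) (Rep (out a ∷ replicate k []))) → inp ⇝ out
programmed C b w = record { timeᵇ = b ; prog = record { code = C ; computes = w } }

module _ {inp : A → Str} where

  ⇝-ext : ∀ {out out′} → inp ⇝ out → (∀ a → out a ≡ out′ a) → inp ⇝ out′
  ⇝-ext f eq = programmed (code (prog f)) (timeᵇ f) λ a →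
    subst (λ s → Within _ _ _ (Rep (s ∷ _))) (eq a) (computes (prog f) a)

  idP : inp ⇝ inp
  idP = programmed {k = 0} (prim (Vec.map idle)) (constᵇ 1) λ a →
    exec-within id (λ ts → subst (Exec _ ts 1) (idle-act ts) (prim-exec (Vec.map idle) ts)) id

  infixr 9 appP
  -- Only the string `inp′ (h a)` is computed, by `g`. The map `h` itself merely exhibits the legal
  -- input behind this string, so its values may contain proofs.
  appP : {inp′ out′ : A′ → Str} (h : A → A′) → inp′ ⇝ out′ → inp ⇝ (inp′ ∘ h) → inp ⇝ (out′ ∘ h)
  appP h f g = programmed (code (prog g′) ⨟ code (prog f′)) (timeᵇ g ⨟ᵇ ∘ᵇ h (outᵇ g) (timeᵇ f)) λ a →
    ⨟-within _ _ (computes (prog g′) a) (computes (prog f′) (h a))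
    where
    f′ g′ : _
    f′ = record { timeᵇ = timeᵇ f ; prog = widenʳ (registers g) (prog f) }
    g′ = record { timeᵇ = timeᵇ g ; prog = widen (registers f) (prog g) }

  -- While `f` runs, a second copy of the input waits reversed in register 2. While `g` runs, the
  -- output of `f` waits reversed in register 1, which is the form that `join` consumes.
  pairP : ∀ {out out′} → inp ⇝ out → inp ⇝ out′ → inp ⇝ (λ a → ⟨ out a , out′ a ⟩)
  pairP {out} {out′} f g =
    programmed
      (fork ⨟ moveRev (suc zero) zero ⨟ insert (insert (code f′)) ⨟ moveRev zero (suc zero) ⨟
       moveRev (suc (suc zero)) zero ⨟ insert (insert (code g′)) ⨟ push false zero ⨟ join)
      ( lenᵇ *ᵇ constᵇ 12 ⨟ᵇ lenᵇ *ᵇ constᵇ 8 ⨟ᵇ timeᵇ f ⨟ᵇ outᵇ f *ᵇ constᵇ 8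
      ⨟ᵇ lenᵇ *ᵇ constᵇ 8 ⨟ᵇ timeᵇ g ⨟ᵇ constᵇ 3 ⨟ᵇ outᵇ f *ᵇ constᵇ 12)
      λ a →
      ⨟-within _ _ (fork-within (inp a) [] [])
      (⨟-within _ _ (unreverse (inp a) (moveRev-within (suc zero) zero (λ xs ys → ys ∷ xs ∷ (inp a ʳ++ []) ∷ replicate _ [])
                       (λ _ _ → refl) (λ _ _ _ → refl) (inp a ʳ++ []) []))
      (⨟-within _ _ (insert-within _ (insert-within _ (computes f′ a)))
      (⨟-within _ _ (moveRev-within zero (suc zero) (λ xs ys → xs ∷ ys ∷ (inp a ʳ++ []) ∷ replicate _ [])
                       (λ _ _ → refl) (λ _ _ _ → refl) (out a) [])
      (⨟-within _ _ (unreverse (inp a) (moveRev-within (suc (suc zero)) zero (λ xs ys → ys ∷ (out a ʳ++ []) ∷ xs ∷ replicate _ [])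
                       (λ _ _ → refl) (λ _ _ _ → refl) (inp a ʳ++ []) []))
      (⨟-within _ _ (insert-within _ (insert-within _ (computes g′ a)))
      (⨟-within _ _ (push-rep false zero)
      (join-reverse (out a) (out′ a))))))))
    where
    f′ = widenʳ (registers g) (prog f)
    g′ = widen (registers f) (prog g)
    unreverse : ∀ {k} {C : Code (suc k)} {P σ} s → Within C (length (s ʳ++ []) * 8) P (Rep (((s ʳ++ []) ʳ++ []) ∷ σ)) →
                Within C (length s * 8) P (Rep (s ∷ σ))
    unreverse {C = C} {P} {σ} s = subst₂ (λ n s → Within C (n * 8) P (Rep (s ∷ σ)))
      (length-reverse s) (reverse-involutive s)

  nilP : inp ⇝ (λ _ → [])
  nilP = programmed {k = 0} (clear zero) (lenᵇ *ᵇ constᵇ 3) λ a →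
    clear-within zero (λ xs → xs ∷ replicate _ []) (λ _ → refl) (λ _ _ → refl) (inp a)

  id-consP : ∀ b → inp ⇝ (λ a → b ∷ inp a)
  id-consP b = programmed (push b zero) (constᵇ 3) λ a → push-rep {1} b zero

  id-tailP : inp ⇝ (drop 1 ∘ inp)
  id-tailP = programmed (pop zero) (constᵇ 1) λ a → pop-rep {1} zero

  id-topP : ∀ p → inp ⇝ (λ a → [ p (top (inp a)) ])
  id-topP p = programmed
    (if zero p (clear zero ⨟ push true zero) (clear zero ⨟ push false zero))
    (sucᵇ (lenᵇ *ᵇ constᵇ 3 ⨟ᵇ constᵇ 3))
    λ a → run a (p (top (inp a))) refl
    where
    cleared : ∀ b a → Within (clear zero ⨟ push b zero) (length (inp a) * 3 + 4) (Rep (inp a ∷ [])) (Rep ([ b ] ∷ []))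
    cleared b a = ⨟-within _ _ (clear-within zero (λ xs → xs ∷ []) (λ _ → refl) (λ _ _ → refl) (inp a)) (push-rep b zero)
    run : ∀ a b → p (top (inp a)) ≡ b →
          Within (if zero p (clear zero ⨟ push true zero) (clear zero ⨟ push false zero)) (suc (length (inp a) * 3 + 4)) (Rep (inp a ∷ [])) (Rep ([ b ] ∷ []))
    run a true  eq = if-within-true zero p _ _ (scans-rep zero p eq) (cleared true a)
    run a false eq = if-within-false zero p _ _ (scans-rep zero p eq) (cleared false a)

  id-π₁P : inp ⇝ (π₁ ∘ inp)
  id-π₁P = programmed {k = 1} (split ⨟ clear zero ⨟ moveRev (suc zero) zero)
    ((lenᵇ *ᵇ constᵇ 10 +ᵇ constᵇ 2) ⨟ᵇ lenᵇ *ᵇ constᵇ 3 ⨟ᵇ lenᵇ *ᵇ constᵇ 8)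
    λ a →
    ⨟-within _ _ (split-within (inp a) [])
    (⨟-within _ _ (within-≤ (*-monoˡ-≤ 3 (length-π₂ (inp a)))
        (clear-within zero (λ xs → xs ∷ (π₁ (inp a) ʳ++ []) ∷ []) (λ _ → refl) (λ _ _ → refl) (π₂ (inp a))))
    (ends-at Rep (cong (λ s → s ∷ [] ∷ []) (reverse-involutive (π₁ (inp a))))
      (within-≤ (*-monoˡ-≤ 8 (≤-trans (≤-reflexive (length-reverse (π₁ (inp a)))) (length-π₁ (inp a))))
        (moveRev-within (suc zero) zero (λ xs ys → ys ∷ xs ∷ []) (λ _ _ → refl) (λ _ _ _ → refl) (π₁ (inp a) ʳ++ []) []))))

  id-π₂P : inp ⇝ (π₂ ∘ inp)
  id-π₂P = programmed {k = 1} (split ⨟ clear (suc zero))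
    ((lenᵇ *ᵇ constᵇ 10 +ᵇ constᵇ 2) ⨟ᵇ lenᵇ *ᵇ constᵇ 3)
    λ a →
    ⨟-within _ _ (split-within (inp a) [])
      (within-≤ (*-monoˡ-≤ 3 (≤-trans (≤-reflexive (length-reverse (π₁ (inp a)))) (length-π₁ (inp a))))
        (clear-within (suc zero) (λ xs → π₂ (inp a) ∷ xs ∷ []) (λ _ → refl) (λ _ _ → refl) (π₁ (inp a) ʳ++ [])))

-- The tagged input is the pair `⟨ [ b a ] , inp a ⟩` without its first symbol, which puts the
-- deciding bit on top. Each branch has to work only for the inputs that reach it.
branchP : ∀ {inp out : A → Str} (b : A → Bool) →
          (_⇝_ {A = Σ A λ a → b a ≡ true} (inp ∘ proj₁) (out ∘ proj₁)) →
          (_⇝_ {A = Σ A λ a → b a ≡ false} (inp ∘ proj₁) (out ∘ proj₁)) →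
          (λ a → b a ∷ false ∷ inp a) ⇝ out
branchP {A} {inp} {out} b f g = programmed
  (if zero isTrue (pop zero ⨟ pop zero ⨟ code f′) (pop zero ⨟ pop zero ⨟ code g′))
  (sucᵇ (constᵇ 1 ⨟ᵇ constᵇ 1 ⨟ᵇ evalᵇ (poly (timeᵇ f)) shorter +ᵇ evalᵇ (poly (timeᵇ g)) shorter))
  λ a → run a (b a) refl
  where
  f′ = widenʳ (registers g) (prog f)
  g′ = widen (registers f) (prog g)
  shorter : Bounded (λ a → b a ∷ false ∷ inp a) (length ∘ inp)
  shorter = ≤ᵇ (λ a → m≤n+m _ 2) lenᵇ
  -- The running times of the branches are functions on subtypes of A; the polynomials that bound
  -- them can be evaluated for every a.
  both : A → ℕ
  both a = eval (poly (timeᵇ f)) (length (inp a)) + eval (poly (timeᵇ g)) (length (inp a))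
  run : ∀ a c → b a ≡ c → Within (if zero isTrue (pop zero ⨟ pop zero ⨟ code f′) (pop zero ⨟ pop zero ⨟ code g′)) (suc (1 + suc (1 + suc (both a))))
    (Rep ((c ∷ false ∷ inp a) ∷ replicate _ [])) (Rep (out a ∷ replicate _ []))
  run a true  eq = if-within-true zero isTrue _ _ (scans-rep zero isTrue refl)
    (⨟-within _ _ (pop-rep zero) (⨟-within _ _ (pop-rep zero)
      (within-≤ (≤-trans (bound (timeᵇ f) (a , eq)) (m≤m+n _ _)) (computes f′ (a , eq)))))
  run a false eq = if-within-false zero isTrue _ _ (scans-rep zero isTrue refl)
    (⨟-within _ _ (pop-rep zero) (⨟-within _ _ (pop-rep zero)
      (within-≤ (≤-trans (bound (timeᵇ g) (a , eq)) (m≤n+m _ (eval (poly (timeᵇ f)) (length (inp a))))) (computes g′ (a , eq)))))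

-- Recursion on notation: st a ys is the state after the suffix ys of xs a has been consumed.
loopP : ∀ {inp xs : A → Str} (st : A → Str → Str) {h : A → ℕ} →
        Bounded inp h → (∀ a ys → length ys ≤ length (xs a) → length (st a ys) ≤ h a) →
        inp ⇝ (λ a → ⟨ xs a , st a [] ⟩) →
        _⇝_ {A = Σ A λ a → Σ Bool λ b → Σ Str λ ys → length ys < length (xs a)}
            (λ (a , b , ys , _) → b ∷ st a ys) (λ (a , b , ys , _) → st a (b ∷ ys)) →
        inp ⇝ (λ a → st a (xs a))
loopP {A} {inp} {xs} st {h} hᵇ small start f = programmed
  (code start′ ⨟ split ⨟ drain (suc zero) loopBit)
  ( timeᵇ start ⨟ᵇ (outᵇ start *ᵇ constᵇ 10 +ᵇ constᵇ 2)
  -- A round costs five steps in `drain`, three for the push, one for the jump, and the body, whose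
  -- input is the state with one bit in front.
  ⨟ᵇ outᵇ start *ᵇ (constᵇ 9 +ᵇ evalᵇ (poly (timeᵇ f)) (sucᵇ hᵇ)))
  λ a → ⨟-within _ _ (computes start′ a) (⨟-within _ _ (unpaired a)
    (ends-at Rep (cong (λ s → st a s ∷ _) (reverse-involutive (xs a)))
      (within-≤ (*-monoˡ-≤ (9 + body a)
          (≤-trans (≤-reflexive (trans (length-reverse (xs a)) (cong length (sym (π₁-pair (xs a)))))) (length-π₁ ⟨ xs a , st a [] ⟩)))
        (loop a (xs a ʳ++ []) [] (≤-reflexive (cong length (reverse-involutive (xs a))))))))
  where
  start′ : Prog inp (λ a → ⟨ xs a , st a [] ⟩) (time start) (suc (registers f) + registers start)
  start′ = widen (suc (registers f)) (prog start)
  f′ : Prog _ _ (time f) (registers f + registers start)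
  f′ = widenʳ (registers start) (prog f)
  loopBit : Bool → Code (2 + (registers f + registers start))
  loopBit b = push b zero ⨟ insert (code f′)
  body : A → ℕ
  body a = eval (poly (timeᵇ f)) (suc (h a))
  -- `split` leaves `xs a` reversed, so draining begins with its last bit and what has been consumed
  -- is always a suffix.
  unpaired : ∀ a {σ} → Within split (length ⟨ xs a , st a [] ⟩ * 10 + 2)
    (Rep (⟨ xs a , st a [] ⟩ ∷ [] ∷ σ)) (Rep (st a [] ∷ (xs a ʳ++ []) ∷ σ))
  unpaired a {σ} = ends-at Rep (cong₂ (λ s r → s ∷ (r ʳ++ []) ∷ σ) (π₂-pair (xs a)) (π₁-pair (xs a))) (split-within ⟨ xs a , st a [] ⟩ [])
  loop : ∀ a r ys → length (r ʳ++ ys) ≤ length (xs a) →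
         Within (drain (suc zero) loopBit) (length r * (9 + body a))
           (Rep (st a ys ∷ r ∷ replicate _ [])) (Rep (st a (r ʳ++ ys) ∷ [] ∷ replicate _ []))
  loop a []      ys le = drain-stop-rep (suc zero) loopBit refl
  loop a (b ∷ r) ys le = drain-step-rep (suc zero) loopBit refl
    (⨟-within _ _ (push-rep b zero) (insert-within _
      (within-≤ (≤-trans (bound (timeᵇ f) (a , b , ys , lt)) (eval-mono (poly (timeᵇ f)) (s≤s (small a ys (<⇒≤ lt)))))
        (computes f′ (a , b , ys , lt)))))
    (loop a r (b ∷ ys) le)
    where
    lt : length ys < length (xs a)
    lt = ≤-trans (≤-trans (m≤n+m _ (length r)) (≤-reflexive (sym (length-ʳ++ r)))) le

toPolyTime : {inp out : A → Str} → inp ⇝ out → PolyTime inp out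
toPolyTime {A} {inp} {out} f = M , poly (timeᵇ f) , halts
  where
  C = code (prog f)
  M : Machine
  M = record { tapes = suc (registers f) ; State = Code.Q C ; finite = Code.finite C ; start = Code.start C
             ; input = zero ; output = zero ; δ = Code.δ C }
  open Machine M using (run; initial; HaltsWith)
  steps-run : ∀ {c n d} → Steps C c n d → run n c ≡ d
  steps-run []      = refl
  steps-run (s ∷ r) rewrite s = steps-run r
  blank-rep : ∀ k → Rep (replicate k []) (replicate k blankTape)
  blank-rep zero    = []
  blank-rep (suc k) = ⊑ᵗ-refl ∷ blank-rep k
  halts : ∀ a → ∃[ t ] t ≤ eval (poly (timeᵇ f)) (length (inp a)) × HaltsWith (out a) (run t (initial (inp a)))
  halts a with computes (prog f) a .runs (⊑ᵗ-refl ∷ blank-rep (registers f))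
  ... | n , n≤ , t ∷ ts , (q , r , h) , p ∷ _ =
    n , ≤-trans n≤ (bound (timeᵇ f) a) , subst (HaltsWith (out a)) (sym (steps-run r)) (h , trans (sym (read-mono p)) (read-write (out a)))

-- Running an arbitrary machine as a subroutine

Far : ℕ → List Symbol → Set
Far n l = All (_≡ nothing) (drop n l)

Box : ℕ → ℕ → Tape → Set
Box p q t = Far p (before t) × Far q (after t)

far-nil : ∀ n → Far n []
far-nil zero    = []
far-nil (suc n) = []

far-suc : ∀ n {l} → Far n l → Far (suc n) l
far-suc zero    {[]}    f       = []
far-suc zero    {s ∷ l} (_ ∷ f) = f
far-suc (suc n) {[]}    f       = []
far-suc (suc n) {s ∷ l} f       = far-suc n f

far-+ : ∀ m {n l} → Far n l → Far (m + n) l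
far-+ zero    f = f
far-+ (suc m) {n} f = far-suc (m + n) (far-+ m f)

far-≤ : ∀ {m n l} → m ≤ n → Far m l → Far n l
far-≤ {m} {n} {l} m≤n f = subst (λ n → Far n l) (m∸n+n≡m m≤n) (far-+ (n ∸ m) f)

far-⊑ : ∀ {l l′} → l ⊑ l′ → ∀ {n} → length l ≤ n → Far n l′
far-⊑ (blanks b) {n} le = subst (λ n → Far n _) (+-identityʳ n) (far-+ n b)
far-⊑ (s ∷ r) {suc n} (s≤s le) = far-⊑ r le

box-right : ∀ {p q s t} → Box p q t → Box (suc p) q (act (s , right) t)
box-right {q = q} {t = tape ls _ []}       (f , g) = f , far-nil q
box-right {q = q} {t = tape ls _ (r ∷ rs)} (f , g) = f , shrink q g
  where
  shrink : ∀ q → Far q (r ∷ rs) → Far q rs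
  shrink zero    (_ ∷ g) = g
  shrink (suc q) g       = far-suc q g

box-shift : ∀ {p q t} → Box p (suc q) t → Box (suc p) q (act (scanned t , right) t)
box-shift {q = q} {t = tape ls _ []}       (f , g) = f , far-nil q
box-shift {q = q} {t = tape ls _ (r ∷ rs)} (f , g) = f , g

box-suc : ∀ {p q t} → Box p q t → Box (suc p) (suc q) t
box-suc {p} {q} (f , g) = far-suc p f , far-suc q g

-- The invariant of the erasing sweep to the left. The scanned cell is counted in p, so p erasures
-- complete the sweep.
LeftOf : ℕ → Tape → Set
LeftOf p t = Far p (scanned t ∷ before t) × Far 0 (after t)

erase-leftOf : ∀ {p t} → LeftOf (suc p) t → LeftOf p (act (nothing , left) t)
erase-leftOf {zero}  {tape [] _ rs}       (f , g) = refl ∷ [] , refl ∷ g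
erase-leftOf {suc p} {tape [] _ rs}       (f , g) = far-nil p , refl ∷ g
erase-leftOf {p}     {tape (l ∷ ls) _ rs} (f , g) = f , refl ∷ g

leftOf-blank : ∀ {t} → LeftOf 0 t → Holds [] t
leftOf-blank (e ∷ f , g) = ⊑tape (blanks f) (sym e) (blanks g)

_⊑*_ : Vec Tape k → Vec Tape k → Set
_⊑*_ = Pointwise _⊑ᵗ_

⊑*-scanned : {us ts : Vec Tape k} → us ⊑* ts → Vec.map scanned us ≡ Vec.map scanned ts
⊑*-scanned []      = refl
⊑*-scanned (x ∷ r) = cong₂ _∷_ (scanned≡ x) (⊑*-scanned r)

⊑*-act : (as : Vec (Symbol × Move) k) → {us ts : Vec Tape k} → us ⊑* ts → zipWith act as us ⊑* zipWith act as ts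
⊑*-act []       []      = []
⊑*-act (a ∷ as) (x ∷ r) = act-mono a x ∷ ⊑*-act as r

rep-⊑* : {σ : Vec Str k} {ts : Vec Tape k} → Rep σ ts → Vec.map write σ ⊑* ts
rep-⊑* []      = []
rep-⊑* (h ∷ r) = h ∷ rep-⊑* r

read-[] : ∀ {t} → read t ≡ [] → scanned t ≡ nothing
read-[] {tape _ nothing _} eq = refl

read-∷ : ∀ {t b s} → read t ≡ b ∷ s → scanned t ≡ just b
read-∷ {tape _ (just b) _} refl = refl

read-tail : ∀ {t b s} → read t ≡ b ∷ s → read (act (scanned t , right) t) ≡ s
read-tail {tape _ (just b) []}      refl = refl
read-tail {tape _ (just b) (_ ∷ _)} refl = refl

ones : ℕ → Str
ones n = List.replicate n true

ones-++ : ∀ m n → ones m ++ ones n ≡ ones (m + n)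
ones-++ zero    n = refl
ones-++ (suc m) n = cong (true ∷_) (ones-++ m n)

-- The head has just moved off the stack to the left.
Lag : Str → Tape → Set
Lag s t = ∃[ u ] Holds s u × t ≡ move left u

lag-holds : ∀ {s t} → Lag s t → Holds s (move right t)
lag-holds {[]}    (tape [] _ rs , h , refl) = ⊑tape (blanks (refl ∷ [])) (scanned≡ h) (after⊑ h)
lag-holds {b ∷ s} (tape [] _ rs , h , refl) = ⊑tape (blanks (refl ∷ [])) (scanned≡ h) (after⊑ h)
lag-holds {[]}    (tape (l ∷ ls) _ rs , h , refl) = h
lag-holds {b ∷ s} (tape (l ∷ ls) _ rs , h , refl) = h

-- Running a machine M inside a register program.  R₀ holds the input and later the output, R₁ is scratch
-- space, and the remaining registers are the tapes of M.  M may leave scattered garbage on its tapes; since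
-- R₂ counts its steps and the length of its input, all of it lies within that distance of the heads,
-- so the tapes can be erased blindly and M can be called again.
module Call (M : Machine) where
  open Machine M using (run; initial)
  private
    module M = Machine M
    T = M.tapes

  core : Code T
  core = record { Q = M.State ; finite = M.finite ; start = M.start ; δ = M.δ }

  -- `run` idles once the machine has halted, whereas `Steps` consists of genuine transitions only.
  run-steps : ∀ t c → ∃[ n ] n ≤ t × Steps core c n (run t c)
  run-steps zero    c = 0 , z≤n , []
  run-steps (suc t) c with M.step c in eq
  ... | nothing = let n , n≤ , r = run-steps t c in n , m≤n⇒m≤1+n n≤ , r
  ... | just d  = let n , n≤ , r = run-steps t d in suc n , s≤s n≤ , eq ∷ r

  R₀ R₁ R₂ : Fin (3 + T)
  R₀ = zero
  R₁ = suc zero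
  R₂ = suc (suc zero)

  R : Fin T → Fin (3 + T)
  R i = suc (suc (suc i))

  -- The three auxiliary registers are stacks throughout, but the tapes of M are not, so they are
  -- described by an arbitrary predicate.
  record St (x y z : Str) (G : Vec Tape T → Set) (ts : Vec Tape (3 + T)) : Set where
    constructor st
    field
      h₀ : Holds x (lookup ts R₀)
      h₁ : Holds y (lookup ts R₁)
      h₂ : Holds z (lookup ts R₂)
      hG : G (Vec.tail (Vec.tail (Vec.tail ts)))

  St-map : ∀ {x y z G H} → (∀ {ts} → G ts → H ts) → ∀ {ts} → St x y z G ts → St x y z H ts
  St-map f (st a b c g) = st a b c (f g)

  rep-st : ∀ {x y z σ ts} → Rep (x ∷ y ∷ z ∷ σ) ts → St x y z (Rep σ) ts
  rep-st (a ∷ b ∷ c ∷ r) = st a b c r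

  st-rep : ∀ {x y z σ ts} → St x y z (Rep σ) ts → Rep (x ∷ y ∷ z ∷ σ) ts
  st-rep {ts = _ ∷ _ ∷ _ ∷ _} (st a b c r) = a ∷ b ∷ c ∷ r

  push₀ : ∀ b {x y z G} → Within (push b R₀) 3 (St x y z G) (St (b ∷ x) y z G)
  push₀ b {x} = exec-within _ (push-exec b R₀) λ { {_ ∷ _ ∷ _ ∷ _} (st p q r g) → st (push-holds b x p) q r g }

  push₁ : ∀ b {x y z G} → Within (push b R₁) 3 (St x y z G) (St x (b ∷ y) z G)
  push₁ b {y = y} = exec-within _ (push-exec b R₁) λ { {_ ∷ _ ∷ _ ∷ _} (st p q r g) → st p (push-holds b y q) r g }

  push₂ : ∀ b {x y z G} → Within (push b R₂) 3 (St x y z G) (St x y (b ∷ z) G)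
  push₂ b {z = z} = exec-within _ (push-exec b R₂) λ { {_ ∷ _ ∷ _ ∷ _} (st p q r g) → st p q (push-holds b z r) g }

  onTapes : (Symbol → Symbol × Move) → Vec Symbol (3 + T) → Vec (Symbol × Move) (3 + T)
  onTapes a (x ∷ y ∷ z ∷ ss) = idle x ∷ idle y ∷ idle z ∷ Vec.map a ss

  onTapes-within : ∀ a {x y z} {P Q : Tape → Set} → (∀ {t} → P t → Q (act (a (scanned t)) t)) →
                   Within (prim (onTapes a)) 1 (St x y z (VAll.All P)) (St x y z (VAll.All Q))
  onTapes-within a {P = P} {Q} f = exec-within _ (prim-exec (onTapes a))
    λ { {_ ∷ _ ∷ _ ∷ _} (st p q r g) → st p q r (all g) }
    where
    all : ∀ {k} {ts : Vec Tape k} → VAll.All P ts → VAll.All Q (zipWith act (Vec.map a (Vec.map scanned ts)) ts)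
    all []      = []
    all (p ∷ g) = f p ∷ all g

  spread : Symbol → Symbol → M.State × Vec (Symbol × Move) T → M.State × Vec (Symbol × Move) (3 + T)
  spread x y (q , as) = q , idle x ∷ idle y ∷ (just true , left) ∷ as

  -- Every transition of M has to advance the counter within the same single step. An ordinary push
  -- takes two, but if the counter's head rests one cell left of its stack, writing a bit and moving
  -- left is already a push; hence `Lag`.
  lockstep : Code (3 + T)
  lockstep = record { Q = M.State ; finite = M.finite ; start = M.start ; δ = δ }
    where
    δ : M.State → Vec Symbol (3 + T) → Maybe (M.State × Vec (Symbol × Move) (3 + T))
    δ q (x ∷ y ∷ z ∷ ss) = Maybe.map (spread x y) (M.δ q ss)

  lockstep-steps : ∀ {q us n q′ us′} → Steps core (q , us) n (q′ , us′) → ∀ {z x y c ts} → us ⊑* ts → Lag z c →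
                   ∃[ c′ ] ∃[ ts′ ] Steps lockstep (q , x ∷ y ∷ c ∷ ts) n (q′ , x ∷ y ∷ c′ ∷ ts′)
                                  × us′ ⊑* ts′ × Lag (ones n ++ z) c′
  lockstep-steps [] r l = _ , _ , [] , r , l
  lockstep-steps {q} {us} {suc n} (s ∷ ss) {z} {x} {y} {c} {ts} r (u , h , refl) with step-δ⁻ core s
  ... | q₁ , as , eq , refl with lockstep-steps ss {true ∷ z} {x} {y} (⊑*-act as r) (_ , push-holds true z h , refl)
  ... | c′ , ts′ , ss′ , r′ , l = c′ , ts′ , step-δ lockstep q (x ∷ y ∷ move left u ∷ ts) eq′ ∷ ss′ , r′ ,
        subst (λ s → Lag s c′) (snoc n) l
    where
    eq′ : Code.δ lockstep q (Vec.map scanned (x ∷ y ∷ move left u ∷ ts))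
        ≡ just (q₁ , idle (scanned x) ∷ idle (scanned y) ∷ (just true , left) ∷ as)
    eq′ = cong (Maybe.map (spread (scanned x) (scanned y))) (trans (cong (M.δ q) (sym (⊑*-scanned r))) eq)
    snoc : ∀ n → ones n ++ true ∷ z ≡ true ∷ (ones n ++ z)
    snoc zero    = refl
    snoc (suc n) = cong (true ∷_) (snoc n)

  record Lagged (x y z : Str) (G : Vec Tape T → Set) (ts : Vec Tape (3 + T)) : Set where
    constructor st
    field
      h₀ : Holds x (lookup ts R₀)
      h₁ : Holds y (lookup ts R₁)
      h₂ : Lag z (lookup ts R₂)
      hG : G (Vec.tail (Vec.tail (Vec.tail ts)))

  run-within : ∀ {us n q us′ x y z} → Steps core (M.start , us) n (q , us′) → Code.step core (q , us′) ≡ nothing →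
               Within (prim (onTape R₂ λ s → s , left) ⨟ lockstep ⨟ prim (onTape R₂ λ s → s , right)) (1 + suc (n + 2))
                 (St x y z (us ⊑*_)) (St x y (ones n ++ z) (us′ ⊑*_))
  run-within {us} {n} {q} {us′} {x} {y} {z} ss h =
    ⨟-within _ _ (exec-within {R = Lagged x y z (us ⊑*_)} _ (onTape-exec R₂ _) (λ { {_ ∷ _ ∷ _ ∷ _} (st a b c g) → st a b (_ , c , refl) g }))
    (⨟-within _ _ locked (exec-within _ (onTape-exec R₂ _) (λ { {_ ∷ _ ∷ _ ∷ _} (st a b c g) → st a b (lag-holds c) g })))
    where
    locked : Within lockstep n (Lagged x y z (us ⊑*_)) (Lagged x y (ones n ++ z) (us′ ⊑*_))
    locked .runs {a ∷ b ∷ c ∷ ts} (st ha hb hc g) with lockstep-steps ss {z} {a} {b} g hc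
    ... | c′ , ts′ , ss′ , g′ , l = n , ≤-refl , _ , (q , ss′ , halt-δ lockstep q _ eq) , st ha hb l g′
      where
      eq : Code.δ lockstep q (Vec.map scanned (a ∷ b ∷ c′ ∷ ts′)) ≡ nothing
      eq = cong (Maybe.map (spread (scanned a) (scanned b))) (trans (cong (M.δ q) (sym (⊑*-scanned g′))) (halt-δ⁻ core h))

  record Blk (n : ℕ) (s : Str) (ts : Vec Tape T) : Set where
    constructor blk
    field
      near  : VAll.All (Box n n) ts
      reads : read (lookup ts M.output) ≡ s

  all-updateAt : ∀ {k} {P Q : Tape → Set} (i : Fin k) f → (∀ {t} → P t → Q (f t)) → (∀ {t} → P t → Q t) →
                 ∀ {ts} → VAll.All P ts → VAll.All Q (updateAt ts i f)
  all-updateAt zero    f h w (p ∷ ps) = h p ∷ VAll.map w ps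
  all-updateAt (suc i) f h w (p ∷ ps) = w p ∷ all-updateAt i f h w ps

  copyBit : Bool → Code (3 + T)
  copyBit b = push b R₁ ⨟ prim (onTape (R M.output) λ s → s , right) ⨟ push true R₂

  copyOut : Code (3 + T)
  copyOut = while (R M.output) is-just (if (R M.output) isTrue (copyBit true) (copyBit false))

  -- Reading the output moves the head of that tape, so the radius around the heads grows by one per
  -- bit, and the counter grows with it.
  copyBit-within : ∀ b c {x y n s} → Within (copyBit b) 9 (St x y (ones n) (Blk n (c ∷ s))) (St x (b ∷ y) (ones (suc n)) (Blk (suc n) s))
  copyBit-within b c {x} {y} {n} {s} = ⨟-within _ _ (push₁ b) (⨟-within _ _
    (exec-within _ (onTape-exec (R M.output) _) λ { {_ ∷ _ ∷ _ ∷ ts} (st p q r g) → st p q r (move-block g) })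
    (push₂ true))
    where
    move-block : ∀ {ts} → Blk n (c ∷ s) ts → Blk (suc n) s (updateAt ts M.output (λ t → act (scanned t , right) t))
    move-block {ts} (blk near reads) = blk
      (all-updateAt M.output _ (λ {t} b → let f , g = box-right {p = n} {q = n} {s = scanned t} {t = t} b in f , far-suc n g)
        (λ {t} → box-suc {n} {n} {t}) near)
      (trans (cong read (lookup∘updateAt M.output ts)) (read-tail {lookup ts M.output} reads))

  copyOut-within : ∀ s {x y n} → Within copyOut (length s * 12) (St x y (ones n) (Blk n s))
                     (St x (s ʳ++ y) (ones (length s + n)) (Blk (length s + n) []))
  copyOut-within [] = while-stop (R M.output) is-just _ λ { (_ ∷ _ ∷ _ ∷ ts) (st _ _ _ g) → cong is-just (read-[] {lookup ts M.output} (Blk.reads g)) }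
  copyOut-within (true ∷ s) {x} {y} {n} =
    while-step (R M.output) is-just _ (λ { (_ ∷ _ ∷ _ ∷ ts) (st _ _ _ g) → cong is-just (read-∷ {lookup ts M.output} (Blk.reads g)) })
      (if-within-true (R M.output) isTrue _ _ (λ { (_ ∷ _ ∷ _ ∷ ts) (st _ _ _ g) → cong isTrue (read-∷ {lookup ts M.output} (Blk.reads g)) })
        (copyBit-within true true))
      (ends-at (λ m → St x (s ʳ++ (true ∷ y)) (ones m) (Blk m [])) (+-suc (length s) n)
        (copyOut-within s))
  copyOut-within (false ∷ s) {x} {y} {n} =
    while-step (R M.output) is-just _ (λ { (_ ∷ _ ∷ _ ∷ ts) (st _ _ _ g) → cong is-just (read-∷ {lookup ts M.output} (Blk.reads g)) })
      (if-within-false (R M.output) isTrue _ _ (λ { (_ ∷ _ ∷ _ ∷ ts) (st _ _ _ g) → cong isTrue (read-∷ {lookup ts M.output} (Blk.reads g)) })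
        (copyBit-within false false))
      (ends-at (λ m → St x (s ʳ++ (false ∷ y)) (ones m) (Blk m [])) (+-suc (length s) n)
        (copyOut-within s))

  shiftBit eraseBit : Bool → Code (3 + T)
  shiftBit _ = push true R₀ ⨟ push true R₀ ⨟ prim (onTapes λ s → s , right)
  eraseBit _ = prim (onTapes λ _ → nothing , left)

  popped₂ : ∀ {b x y z G ts} → St x y (b ∷ z) G ts → St x y z G (updateAt ts R₂ popAct)
  popped₂ {b} {z = z} {ts = _ ∷ _ ∷ _ ∷ _} (st p q r g) = st p q (pop-holds (b ∷ z) r) g

  popped₀ : ∀ {b x y z G ts} → St (b ∷ x) y z G ts → St x y z G (updateAt ts R₀ popAct)
  popped₀ {b} {x} {ts = _ ∷ _ ∷ _ ∷ _} (st p q r g) = st (pop-holds (b ∷ x) p) q r g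

  -- After n moves to the right nothing is left on that side, and the garbage on the other side
  -- reaches at most `p + n` cells, which `p ≤ r + n` bounds by `n + n + r`; the scanned cell adds
  -- one. The two pushes per move and the single push made beforehand in `call` leave exactly this
  -- number in register 0 for the way back.
  shift-within : ∀ n p r {y} → p ≤ r + n →
    Within (drain R₂ shiftBit) (n * 14) (St (ones (suc r)) y (ones n) (VAll.All (Box p n)))
      (St (ones (suc (n + n + r))) y [] (VAll.All (LeftOf (suc (n + n + r)))))
  shift-within zero p r le = within-conseq id (St-map (VAll.map λ (f , g) → far-≤ (≤-trans le (≤-reflexive (+-identityʳ r))) f , g))
    (drain-stop R₂ shiftBit λ ts → St.h₂)
  shift-within (suc n) p r {y} le =
    drain-step R₂ shiftBit (λ ts → St.h₂) popped₂
      (⨟-within _ _ (push₀ true) (⨟-within _ _ (push₀ true) (onTapes-within _ {P = Box p (suc n)} {Q = Box (suc p) n} λ {t} → box-shift {p} {n} {t})))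
      (ends-at (λ m → St (ones (suc m)) y [] (VAll.All (LeftOf (suc m)))) (lemma n r)
        (shift-within n (suc p) (2 + r) (s≤s (≤-trans le (≤-reflexive (+-suc r n))))))
    where
    lemma : ∀ n r → n + n + (2 + r) ≡ suc n + suc n + r
    lemma = solve-∀

  erase-within : ∀ n {y} → Within (drain R₀ eraseBit) (n * 6) (St (ones n) y [] (VAll.All (LeftOf n))) (St [] y [] (VAll.All (LeftOf 0)))
  erase-within zero    = drain-stop R₀ eraseBit λ ts → St.h₀
  erase-within (suc n) = drain-step R₀ eraseBit (λ ts → St.h₀) popped₀
    (onTapes-within _ {P = LeftOf (suc n)} {Q = LeftOf n} λ {t} → erase-leftOf {n} {t}) (erase-within n)

  blank-rep : ∀ {k} {ts : Vec Tape k} → VAll.All (LeftOf 0) ts → Rep (replicate k []) ts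
  blank-rep []      = []
  blank-rep (b ∷ r) = leftOf-blank b ∷ blank-rep r

  loadBit : Bool → Code (3 + T)
  loadBit b = push b (R M.input) ⨟ push true R₂

  load-within : ∀ xs ys j → Within (drain R₁ loadBit) (length xs * 12)
    (Rep ([] ∷ xs ∷ ones j ∷ (replicate T [] [ M.input ]≔ ys)))
    (Rep ([] ∷ [] ∷ ones (length xs + j) ∷ (replicate T [] [ M.input ]≔ (xs ʳ++ ys))))
  load-within []       ys j = drain-stop-rep R₁ loadBit refl
  load-within (b ∷ xs) ys j = drain-step-rep R₁ loadBit refl
    (⨟-within _ _ (ends-at (λ σ → Rep ([] ∷ xs ∷ ones j ∷ σ)) (updateAt-∘ M.input (replicate T [])) (push-rep b (R M.input)))
      (push-rep true R₂))
    (ends-at (λ m → Rep ([] ∷ [] ∷ ones m ∷ (replicate T [] [ M.input ]≔ (xs ʳ++ (b ∷ ys))))) (+-suc (length xs) j)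
      (load-within xs (b ∷ ys) (suc j)))

  start-write : ∀ w → Vec.map write (replicate T [] [ M.input ]≔ w) ≡ replicate T blankTape [ M.input ]≔ write w
  start-write w = trans (map-[]≔ write (replicate T []) M.input) (cong (_[ M.input ]≔ write w) (map-replicate write [] T))

  start-size : ∀ w i → size (lookup (replicate T blankTape [ M.input ]≔ write w) i) ≤ length w
  start-size w = go M.input
    where
    go : ∀ {k} (j i : Fin k) → size (lookup (replicate k blankTape [ j ]≔ write w) i) ≤ length w
    go zero    zero    = size-write w
    go {suc k} zero    (suc i) = subst (λ t → size t ≤ length w) (sym (lookup-replicate i blankTape)) z≤n
    go (suc j) zero    = z≤n
    go (suc j) (suc i) = go j i

  near-all : ∀ {k n} {us ts : Vec Tape k} → us ⊑* ts → (∀ i → size (lookup us i) ≤ n) → VAll.All (Box n n) ts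
  near-all []      le = []
  near-all {us = u ∷ _} (x ∷ r) le =
    (far-⊑ (before⊑ x) (≤-trans (m≤m+n _ _) (le zero)) , far-⊑ (after⊑ x) (≤-trans (m≤n+m _ (length (before u))) (le zero)))
    ∷ near-all r (le ∘ suc)

  read-size : ∀ t → length (read t) ≤ suc (size t)
  read-size t = ≤-trans (go (scanned t ∷ after t)) (s≤s (m≤n+m _ (length (before t))))
    where
    go : ∀ l → length (bitsUpToBlank l) ≤ length l
    go []            = z≤n
    go (nothing ∷ l) = z≤n
    go (just b ∷ l)  = s≤s (go l)

  call : Code (3 + T)
  call = moveRev R₀ R₁ ⨟ drain R₁ loadBit ⨟ (prim (onTape R₂ λ s → s , left) ⨟ lockstep ⨟ prim (onTape R₂ λ s → s , right)) ⨟
         copyOut ⨟ push true R₀ ⨟ drain R₂ shiftBit ⨟ drain R₀ eraseBit ⨟ moveRev R₁ R₀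

  -- Bounds the radius before the sweep. The second summand covers the steps and the input; the
  -- first covers the moves made while copying the output, whose length is at most `suc (t + l)`.
  reach : ℕ → ℕ → ℕ
  reach t l = suc (t + l) + (t + l)

  callTime : ℕ → ℕ → ℕ
  callTime t l = l * 8 + suc (l * 12 + suc (1 + suc (t + 2) + suc (suc (t + l) * 12 + suc (3 + suc (reach t l * 14 +
                 suc (suc (reach t l + reach t l + 0) * 6 + suc (suc (t + l) * 8)))))))

  call-within : ∀ t w s → Machine.HaltsWith M s (run t (initial w)) →
                Within call (callTime t (length w)) (Rep (w ∷ [] ∷ [] ∷ replicate T [])) (Rep (s ∷ [] ∷ [] ∷ replicate T []))
  call-within t w s (halted , reads) =
    ⨟-within _ _ (moveRev-within R₀ R₁ (λ xs ys → xs ∷ ys ∷ [] ∷ replicate T []) (λ _ _ → refl) (λ _ _ _ → refl) w [])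
    (⨟-within _ _ (within-conseq before-load after-load
        (within-≤ (≤-reflexive (cong (_* 12) (length-reverse w))) (load-within (w ʳ++ []) [] 0)))
    (⨟-within _ _ (within-conseq id ran (within-≤ (s≤s (s≤s (+-monoˡ-≤ 2 d≤))) (run-within steps halted)))
    (⨟-within _ _ (within-≤ (*-monoˡ-≤ 12 s≤) (copyOut-within s))
    (⨟-within _ _ (within-conseq id (St-map Blk.near) (push₀ true))
    (⨟-within _ _ (within-≤ (*-monoˡ-≤ 14 radius≤) (shift-within radius radius 0 ≤-refl))
    (⨟-within _ _ (within-≤ (*-monoˡ-≤ 6 (s≤s (+-monoˡ-≤ 0 (+-mono-≤ radius≤ radius≤)))) (erase-within (suc (radius + radius + 0))))
      (within-conseq (st-rep ∘ St-map blank-rep) id (ends-at (λ s → Rep (s ∷ [] ∷ [] ∷ replicate T [])) (reverse-involutive s)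
        (within-≤ (*-monoˡ-≤ 8 (≤-trans (≤-reflexive (length-reverse s)) s≤))
          (moveRev-within R₁ R₀ (λ xs ys → ys ∷ xs ∷ [] ∷ replicate T []) (λ _ _ → refl) (λ _ _ _ → refl) (s ʳ++ []) []))))))))))
    where
    d = proj₁ (run-steps t (initial w))
    d≤ : d ≤ t
    d≤ = proj₁ (proj₂ (run-steps t (initial w)))
    steps : Steps core (initial w) d (run t (initial w))
    steps = proj₂ (proj₂ (run-steps t (initial w)))
    us = proj₂ (run t (initial w))
    sizes : ∀ i → size (lookup us i) ≤ d + length w
    sizes i = ≤-trans (size-steps core i steps) (+-monoʳ-≤ d (start-size w i))
    radius = length s + (d + length w)
    s≤ : length s ≤ suc (t + length w)
    s≤ = subst (λ s → length s ≤ suc (t + length w)) reads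
      (≤-trans (read-size (lookup us M.output)) (s≤s (≤-trans (sizes M.output) (+-monoˡ-≤ (length w) d≤))))
    radius≤ : radius ≤ reach t (length w)
    radius≤ = +-mono-≤ s≤ (+-monoˡ-≤ (length w) d≤)
    before-load : ∀ {ts} → Rep ([] ∷ (w ʳ++ []) ∷ [] ∷ replicate T []) ts →
                  Rep ([] ∷ (w ʳ++ []) ∷ ones 0 ∷ (replicate T [] [ M.input ]≔ [])) ts
    before-load = subst (λ σ → Rep ([] ∷ (w ʳ++ []) ∷ [] ∷ σ) _)
      (trans (sym ([]≔-lookup (replicate T []) M.input)) (cong (replicate T [] [ M.input ]≔_) (lookup-replicate M.input [])))
    after-load : ∀ {ts} → Rep ([] ∷ [] ∷ ones (length (w ʳ++ []) + 0) ∷ (replicate T [] [ M.input ]≔ ((w ʳ++ []) ʳ++ []))) ts →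
                 St [] [] (ones (length w)) ((replicate T blankTape [ M.input ]≔ write w) ⊑*_) ts
    after-load {ts} r with rep-st r
    ... | st a b c g = st a b
      (subst (λ m → Holds (ones m) (lookup ts R₂)) (trans (+-identityʳ _) (length-reverse w)) c)
      (subst (_⊑* _) (start-write w) (subst (λ s → Vec.map write (replicate T [] [ M.input ]≔ s) ⊑* _) (reverse-involutive w) (rep-⊑* g)))
    ran : ∀ {ts} → St [] [] (ones d ++ ones (length w)) (us ⊑*_) ts → St [] [] (ones (d + length w)) (Blk (d + length w) s) ts
    ran {ts} (st a b c g) = st a b (subst (λ z → Holds z (lookup ts R₂)) (ones-++ d (length w)) c)
      (blk (near-all g sizes) (trans (sym (read-mono (PW.lookup g M.output))) reads))

-- Through this, verifiers and the maps of an SE reduction become programs that can be composed and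
-- put into loops.
fromPolyTime : {inp out : A → Str} → PolyTime inp out → inp ⇝ out
fromPolyTime {A} {inp} {out} (M , p , halts) = programmed call time-bounded computed
  where
  open Call M
  computed : ∀ a → Within call (callTime (proj₁ (halts a)) (length (inp a))) (Rep (inp a ∷ replicate _ [])) (Rep (out a ∷ replicate _ []))
  computed a = call-within (proj₁ (halts a)) (inp a) (out a) (proj₂ (proj₂ (halts a)))
  tᵇ : Bounded inp (proj₁ ∘ halts)
  tᵇ = bounded p (λ a → proj₁ (proj₂ (halts a)))
  reachᵇ : Bounded inp (λ a → reach (proj₁ (halts a)) (length (inp a)))
  reachᵇ = sucᵇ (tᵇ +ᵇ lenᵇ) +ᵇ (tᵇ +ᵇ lenᵇ)
  time-bounded : Bounded inp (λ a → callTime (proj₁ (halts a)) (length (inp a)))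
  time-bounded = lenᵇ *ᵇ constᵇ 8 ⨟ᵇ lenᵇ *ᵇ constᵇ 12 ⨟ᵇ (constᵇ 1 ⨟ᵇ (tᵇ +ᵇ constᵇ 2)) ⨟ᵇ sucᵇ (tᵇ +ᵇ lenᵇ) *ᵇ constᵇ 12 ⨟ᵇ
    constᵇ 3 ⨟ᵇ reachᵇ *ᵇ constᵇ 14 ⨟ᵇ sucᵇ (reachᵇ +ᵇ reachᵇ +ᵇ constᵇ 0) *ᵇ constᵇ 6 ⨟ᵇ sucᵇ (tᵇ +ᵇ lenᵇ) *ᵇ constᵇ 8

-- Polynomial-time functions

module _ {inp : A → Str} where

  thenP : ∀ {mid out : A → Str} → inp ⇝ mid → mid ⇝ out → inp ⇝ out
  thenP f g = appP id g f

  consP : ∀ b {s} → inp ⇝ s → inp ⇝ (λ a → b ∷ s a)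
  consP b f = thenP f (id-consP b)

  tailP : ∀ {s} → inp ⇝ s → inp ⇝ (drop 1 ∘ s)
  tailP f = thenP f id-tailP

  topP : ∀ p {s} → inp ⇝ s → inp ⇝ (λ a → [ p (top (s a)) ])
  topP p f = thenP f (id-topP p)

  constP : ∀ s → inp ⇝ (λ _ → s)
  constP []      = nilP
  constP (b ∷ s) = consP b (constP s)

  π₁P : ∀ {s} → inp ⇝ s → inp ⇝ (π₁ ∘ s)
  π₁P f = thenP f id-π₁P

  π₂P : ∀ {s} → inp ⇝ s → inp ⇝ (π₂ ∘ s)
  π₂P f = thenP f id-π₂P

  fstP : ∀ {v w : A → Str} → inp ⇝ (λ a → ⟨ v a , w a ⟩) → inp ⇝ v
  fstP {v} {w} f = ⇝-ext (π₁P f) (λ a → π₁-pair (v a) {w a})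

  sndP : ∀ {v w : A → Str} → inp ⇝ (λ a → ⟨ v a , w a ⟩) → inp ⇝ w
  sndP {v} {w} f = ⇝-ext (π₂P f) (λ a → π₂-pair (v a) {w a})

restrictP : ∀ {inp out : A → Str} (h : A′ → A) → inp ⇝ out → (inp ∘ h) ⇝ (out ∘ h)
restrictP h f = appP h f idP

module _ {inp : A → Str} where

  condP : ∀ {out} (c : A → Bool) → inp ⇝ (λ a → [ c a ]) →
          (_⇝_ {A = Σ A λ a → c a ≡ true} (inp ∘ proj₁) (out ∘ proj₁)) →
          (_⇝_ {A = Σ A λ a → c a ≡ false} (inp ∘ proj₁) (out ∘ proj₁)) → inp ⇝ out
  condP c t f g = thenP (tailP (pairP t idP)) (branchP c f g)

  ifP : ∀ {c : A → Bool} {x y} → inp ⇝ (λ a → [ c a ]) → inp ⇝ x → inp ⇝ y → inp ⇝ (λ a → if c a then x a else y a)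
  ifP {c} {x} {y} t f g = condP c t
    (⇝-ext (restrictP proj₁ f) (λ (a , eq) → cong (if_then x a else y a) (sym eq)))
    (⇝-ext (restrictP proj₁ g) (λ (a , eq) → cong (if_then x a else y a) (sym eq)))

  notP : ∀ {c : A → Bool} → inp ⇝ (λ a → [ c a ]) → inp ⇝ (λ a → [ not (c a) ])
  notP {c} f = ⇝-ext (ifP f (constP [ false ]) (constP [ true ])) (λ a → lemma (c a))
    where
    lemma : ∀ b → (if b then [ false ] else [ true ]) ≡ [ not b ]
    lemma true  = refl
    lemma false = refl

  andP : ∀ {c d : A → Bool} → inp ⇝ (λ a → [ c a ]) → inp ⇝ (λ a → [ d a ]) → inp ⇝ (λ a → [ c a ∧ d a ])
  andP {c} {d} f g = ⇝-ext (ifP f g (constP [ false ])) (λ a → lemma (c a) (d a))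
    where
    lemma : ∀ b d → (if b then [ d ] else [ false ]) ≡ [ b ∧ d ]
    lemma true  d = refl
    lemma false d = refl

  orP : ∀ {c d : A → Bool} → inp ⇝ (λ a → [ c a ]) → inp ⇝ (λ a → [ d a ]) → inp ⇝ (λ a → [ c a ∨ d a ])
  orP {c} {d} f g = ⇝-ext (ifP f (constP [ true ]) g) (λ a → lemma (c a) (d a))
    where
    lemma : ∀ b d → (if b then [ true ] else [ d ]) ≡ [ b ∨ d ]
    lemma true  d = refl
    lemma false d = refl

  pushP : ∀ {c : A → Bool} {s} → inp ⇝ (λ a → [ c a ]) → inp ⇝ s → inp ⇝ (λ a → c a ∷ s a)
  pushP {c} {s} f g = ⇝-ext (ifP f (consP true g) (consP false g)) (λ a → lemma (c a))
    where
    lemma : ∀ b {s : Str} → (if b then true ∷ s else false ∷ s) ≡ b ∷ s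
    lemma true  = refl
    lemma false = refl

length-pair : ∀ v {w} → length ⟨ v , w ⟩ ≡ length v + length v + suc (length w)
length-pair []          = refl
length-pair (b ∷ v) {w} = cong suc (trans (cong suc (length-pair v)) (cong (_+ suc (length w)) (sym (+-suc (length v) (length v)))))

Pos : (A → Str) → Set
Pos {A} xs = Σ A λ a → Σ Bool λ b → Σ Str λ ys → length ys < length (xs a)

-- The body of `loopP` sees nothing but a bit and the state. Storing the input and the consumed
-- suffix in the state as well makes both available in every round.
module Rec {inp xs : A → Str} (st : A → Str → Str) where

  stepInp : Pos xs → Str
  stepInp (a , b , ys , _) = ⟨ inp a , ⟨ b ∷ ys , st a ys ⟩ ⟩

  ctxP : stepInp ⇝ (inp ∘ proj₁)
  ctxP = fstP idP

  outerP : ∀ {out} → inp ⇝ out → stepInp ⇝ (out ∘ proj₁)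
  outerP f = appP proj₁ f ctxP

  bothP : stepInp ⇝ (λ (a , b , ys , _) → ⟨ b ∷ ys , st a ys ⟩)
  bothP = sndP {v = inp ∘ proj₁} idP

  hereP : stepInp ⇝ (λ (_ , b , ys , _) → b ∷ ys)
  hereP = fstP bothP

  restP : stepInp ⇝ (λ (_ , _ , ys , _) → ys)
  restP = tailP hereP

  bitP : stepInp ⇝ (λ (_ , b , _) → [ b ])
  bitP = ⇝-ext (topP isTrue hereP) λ (_ , b , _) → cong [_] (isTrue-just b)

  prevP : stepInp ⇝ (λ (a , _ , ys , _) → st a ys)
  prevP = sndP {v = λ (_ , b , ys , _) → b ∷ ys} (sndP {v = inp ∘ proj₁} idP)

  recP : ∀ {h} → Bounded inp h → (∀ a ys → length ys ≤ length (xs a) → length (st a ys) ≤ h a) →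
         inp ⇝ xs → inp ⇝ (λ a → st a []) → stepInp ⇝ (λ (a , b , ys , _) → st a (b ∷ ys)) →
         inp ⇝ (λ a → st a (xs a))
  recP {h} hᵇ small x start step = sndP {v = xs} (sndP {v = inp} (loopP full bound-full small-full
    (pairP x (pairP idP (pairP (constP []) start)))
    (thenP regroup (pairP ctxP (pairP hereP step)))))
    where
    full : A → Str → Str
    full a ys = ⟨ inp a , ⟨ ys , st a ys ⟩ ⟩
    H : A → ℕ
    H a = length (inp a) + length (inp a) + suc (length (xs a) + length (xs a) + suc (h a))
    bound-full : Bounded inp H
    bound-full = lenᵇ +ᵇ lenᵇ +ᵇ sucᵇ (outᵇ x +ᵇ outᵇ x +ᵇ sucᵇ hᵇ)
    small-full : ∀ a ys → length ys ≤ length (xs a) → length (full a ys) ≤ H a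
    small-full a ys le rewrite length-pair (inp a) {⟨ ys , st a ys ⟩} | length-pair ys {st a ys} =
      +-monoʳ-≤ (length (inp a) + length (inp a)) (s≤s (+-mono-≤ (+-mono-≤ le le) (s≤s (small a ys le))))
    loopInp : Pos xs → Str
    loopInp (a , b , ys , _) = b ∷ full a ys
    tl : loopInp ⇝ (λ (a , _ , ys , _) → full a ys)
    tl = tailP idP
    bit : loopInp ⇝ (λ (_ , b , _) → [ b ])
    bit = ⇝-ext (topP isTrue idP) λ (_ , b , _) → cong [_] (isTrue-just b)
    inner : loopInp ⇝ (λ (a , _ , ys , _) → ⟨ ys , st a ys ⟩)
    inner = sndP {v = inp ∘ proj₁} tl
    regroup : loopInp ⇝ stepInp
    regroup = pairP ctx′ (pairP (pushP bit rest′) prev′)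
      where
      ctx′ : loopInp ⇝ (inp ∘ proj₁)
      ctx′ = fstP tl
      rest′ : loopInp ⇝ (λ (_ , _ , ys , _) → ys)
      rest′ = fstP inner
      prev′ : loopInp ⇝ (λ (a , _ , ys , _) → st a ys)
      prev′ = sndP {v = λ (_ , _ , ys , _) → ys} inner

module _ {inp : A → Str} where

  -- Numbers that control loops are given in unary, as lengths of strings with arbitrary content.
  dropP : ∀ {c s} → inp ⇝ c → inp ⇝ s → inp ⇝ (λ a → drop (length (c a)) (s a))
  dropP {c} {s} f g = recP (outᵇ g) small f g (⇝-ext (tailP prevP) (λ (a , _ , ys , _) → drop-1 (length ys) (s a)))
    where
    open Rec {inp = inp} {c} (λ a ys → drop (length ys) (s a))
    small : ∀ a ys → length ys ≤ length (c a) → length (drop (length ys) (s a)) ≤ length (s a)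
    small a ys _ = ≤-trans (≤-reflexive (length-drop (length ys) (s a))) (m∸n≤m (length (s a)) (length ys))
    drop-1 : ∀ n (s : Str) → drop 1 (drop n s) ≡ drop (suc n) s
    drop-1 n s = trans (drop-drop n 1 s) (cong (λ m → drop m s) (+-comm n 1))

  appendP : ∀ {c s} → inp ⇝ c → inp ⇝ s → inp ⇝ (λ a → c a ++ s a)
  appendP {c} {s} f g = recP (outᵇ f +ᵇ outᵇ g)
    (λ a ys le → ≤-trans (≤-reflexive (length-++ ys)) (+-monoˡ-≤ (length (s a)) le)) f g (pushP bitP prevP)
    where
    open Rec {inp = inp} {c} (λ a ys → ys ++ s a)

  onesP : ∀ {c} → inp ⇝ c → inp ⇝ (λ a → ones (length (c a)))
  onesP {c} f = recP (outᵇ f) (λ a ys le → ≤-trans (≤-reflexive (length-replicate (length ys))) le) f (constP [])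
    (consP true prevP)
    where
    open Rec {inp = inp} {c} (λ a ys → ones (length ys))

module _ {inp : A → Str} where

  timesP : ∀ {c} {r : A → ℕ} → inp ⇝ c → inp ⇝ (ones ∘ r) → inp ⇝ (λ a → ones (length (c a) * r a))
  timesP {c} {r} f g = recP (outᵇ f *ᵇ ≤ᵇ (λ a → ≤-reflexive (sym (length-replicate (r a)))) (outᵇ g))
    (λ a ys le → ≤-trans (≤-reflexive (length-replicate (length ys * r a))) (*-monoˡ-≤ (r a) le)) f (constP [])
    (⇝-ext (appendP (outerP g) prevP) (λ (a , _ , ys , _) → ones-++ (r a) (length ys * r a)))
    where
    open Rec {inp = inp} {c} (λ a ys → ones (length ys * r a))

  evalP : ∀ {c} p → inp ⇝ c → inp ⇝ (λ a → ones (eval p (length (c a))))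
  evalP     []      f = constP []
  evalP {c} (x ∷ p) f = ⇝-ext (appendP (constP (ones x)) (timesP f (evalP p f))) (λ a → ones-++ x _)

-- Bijective binary numerals and counting

incr : Str → Str
incr []           = [ false ]
incr (false ∷ ys) = true ∷ ys
incr (true ∷ ys)  = false ∷ incr ys

length-incr : ∀ s → length (incr s) ≤ suc (length s)
length-incr []           = ≤-refl
length-incr (false ∷ ys) = n≤1+n _
length-incr (true ∷ ys)  = s≤s (length-incr ys)

-- `false` is the digit 1 and `true` the digit 2, so the carry comes from `true`, which turns into a
-- 1.
incr-suc : ∀ x → encodeℕᵇ (ℕᵇ.suc x) ≡ incr (encodeℕᵇ x)
incr-suc ℕᵇ.zero  = refl
incr-suc 2[1+ x ] = cong (false ∷_) (incr-suc x)
incr-suc 1+[2 x ] = refl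

bin : ℕ → Str
bin n = encodeℕᵇ (fromℕ n)

bin-suc : ∀ n → bin (suc n) ≡ incr (bin n)
bin-suc n = trans (cong encodeℕᵇ (fromℕ≡fromℕ' (suc n)))
  (trans (incr-suc (fromℕ' n)) (cong (incr ∘ encodeℕᵇ) (sym (fromℕ≡fromℕ' n))))

length-bin : ∀ n → length (bin n) ≤ n
length-bin zero    = z≤n
length-bin (suc n) rewrite bin-suc n = ≤-trans (length-incr (bin n)) (s≤s (length-bin n))

encodeℕᵇ-injective : ∀ x y → encodeℕᵇ x ≡ encodeℕᵇ y → x ≡ y
encodeℕᵇ-injective ℕᵇ.zero  ℕᵇ.zero  eq = refl
encodeℕᵇ-injective 2[1+ x ] 2[1+ y ] eq = cong 2[1+_] (encodeℕᵇ-injective x y (cong (drop 1) eq))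
encodeℕᵇ-injective 1+[2 x ] 1+[2 y ] eq = cong 1+[2_] (encodeℕᵇ-injective x y (cong (drop 1) eq))

bin-injective : ∀ m n → bin m ≡ bin n → m ≡ n
bin-injective m n eq = fromℕ-injective (encodeℕᵇ-injective _ _ eq)

popcount : Str → ℕ
popcount []          = 0
popcount (true ∷ s)  = suc (popcount s)
popcount (false ∷ s) = popcount s

popcount≤length : ∀ s → popcount s ≤ length s
popcount≤length []          = z≤n
popcount≤length (true ∷ s)  = s≤s (popcount≤length s)
popcount≤length (false ∷ s) = m≤n⇒m≤1+n (popcount≤length s)

module _ {inp : A → Str} where

  incrP : ∀ {s} → inp ⇝ s → inp ⇝ (incr ∘ s)
  incrP {s} f = recP (sucᵇ (outᵇ f)) (λ a ys le → ≤-trans (length-incr ys) (s≤s le)) f (constP [ false ])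
    (⇝-ext (ifP bitP (consP false prevP) (consP true restP)) (λ (_ , b , ys , _) → lemma b ys))
    where
    open Rec {inp = inp} {s} (λ a ys → incr ys)
    lemma : ∀ b ys → (if b then false ∷ incr ys else true ∷ ys) ≡ incr (b ∷ ys)
    lemma true  ys = refl
    lemma false ys = refl

module _ {inp : A → Str} where

  binP : ∀ {s} → inp ⇝ s → inp ⇝ (bin ∘ popcount ∘ s)
  binP {s} f = recP (outᵇ f) (λ a ys le → ≤-trans (length-bin (popcount ys)) (≤-trans (popcount≤length ys) le)) f (constP [])
    (⇝-ext (ifP bitP (incrP prevP) prevP) (λ (_ , b , ys , _) → lemma b ys))
    where
    open Rec {inp = inp} {s} (λ a ys → bin (popcount ys))
    lemma : ∀ b ys → (if b then incr (bin (popcount ys)) else bin (popcount ys)) ≡ bin (popcount (b ∷ ys))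
    lemma true  ys = sym (bin-suc (popcount ys))
    lemma false ys = refl

-- Bounded quantifiers, tables and equality of strings

all< any< : ℕ → (ℕ → Bool) → Bool
all< zero    φ = true
all< (suc n) φ = φ n ∧ all< n φ
any< zero    φ = false
any< (suc n) φ = φ n ∨ any< n φ

-- The largest index comes first because in a recursion over suffixes the round at `b ∷ ys` has
-- index `length ys` and pushes its value on top.
tab : ℕ → (ℕ → Bool) → Str
tab zero    φ = []
tab (suc n) φ = φ n ∷ tab n φ

length-tab : ∀ n φ → length (tab n φ) ≡ n
length-tab zero    φ = refl
length-tab (suc n) φ = cong suc (length-tab n φ)

-- The bound is retained because a test may call a machine that is specified only for indices in
-- range.
Below : (A → Str) → Set
Below {A} c = Σ A λ a → Σ Str λ ys → length ys < length (c a)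

module Index (inp c : A → Str) where

  indexInp : Below c → Str
  indexInp (a , ys , _) = ⟨ inp a , ys ⟩

  indexP : indexInp ⇝ (λ (_ , ys , _) → ys)
  indexP = sndP {v = inp ∘ proj₁} idP

  liftP : ∀ {out} → inp ⇝ out → indexInp ⇝ (out ∘ proj₁)
  liftP f = appP proj₁ f (fstP idP)

  private
    module Step {st : A → Str → Str} where
      open Rec {inp = inp} {c} st public
      atP : ∀ {out : Below c → Str} → indexInp ⇝ out → stepInp ⇝ (λ (a , _ , ys , lt) → out (a , ys , lt))
      atP f = appP (λ (a , _ , ys , lt) → a , ys , lt) f (pairP ctxP restP)

  allP : {φ : A → ℕ → Bool} → inp ⇝ c → indexInp ⇝ (λ (a , ys , _) → [ φ a (length ys) ]) →
         inp ⇝ (λ a → [ all< (length (c a)) (φ a) ])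
  allP {φ} f g = recP (constᵇ 1) (λ _ _ _ → ≤-refl) f (constP [ true ]) (andP (atP g) prevP)
    where open Step {λ a ys → [ all< (length ys) (φ a) ]}

  anyP : {φ : A → ℕ → Bool} → inp ⇝ c → indexInp ⇝ (λ (a , ys , _) → [ φ a (length ys) ]) →
         inp ⇝ (λ a → [ any< (length (c a)) (φ a) ])
  anyP {φ} f g = recP (constᵇ 1) (λ _ _ _ → ≤-refl) f (constP [ false ]) (orP (atP g) prevP)
    where open Step {λ a ys → [ any< (length ys) (φ a) ]}

  tabP : {φ : A → ℕ → Bool} → inp ⇝ c → indexInp ⇝ (λ (a , ys , _) → [ φ a (length ys) ]) →
         inp ⇝ (λ a → tab (length (c a)) (φ a))
  tabP {φ} f g = recP (outᵇ f) (λ a ys le → ≤-trans (≤-reflexive (length-tab (length ys) (φ a))) le) f (constP [])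
    (pushP (atP g) prevP)
    where open Step {λ a ys → tab (length ys) (φ a)}

same : Bool → Bool → Bool
same b c = if b then c else not c

same-refl : ∀ b → same b b ≡ true
same-refl true  = refl
same-refl false = refl

same-≡ : ∀ b c → same b c ≡ true → b ≡ c
same-≡ true  true  eq = refl
same-≡ false false eq = refl

sameTop : Str → Str → Bool
sameTop u v = same (is-just (top u)) (is-just (top v)) ∧ same (isTrue (top u)) (isTrue (top v))

-- The length of `u ++ v` covers all positions of both strings, and this string is available to
-- drive the loop. Beyond its end a string shows a blank, so a difference in length is noticed.
eqStr : Str → Str → Bool
eqStr u v = all< (length (u ++ v)) λ i → sameTop (drop i u) (drop i v)

∧-true : ∀ {b c} → b ∧ c ≡ true → b ≡ true × c ≡ true
∧-true {true} {true} eq = refl , refl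

true-∧ : ∀ {b c} → b ≡ true → c ≡ true → b ∧ c ≡ true
true-∧ refl refl = refl

∨-true : ∀ {b c} → b ∨ c ≡ true → b ≡ true ⊎ c ≡ true
∨-true {true}  eq = inj₁ refl
∨-true {false} eq = inj₂ eq

∨-trueʳ : ∀ b {c} → c ≡ true → b ∨ c ≡ true
∨-trueʳ true  eq = refl
∨-trueʳ false eq = eq

∨-trueˡ : ∀ {b c} → b ≡ true → b ∨ c ≡ true
∨-trueˡ refl = refl

all<-elim : ∀ n φ → all< n φ ≡ true → ∀ i → i < n → φ i ≡ true
all<-elim (suc n) φ eq i i<n with m≤n⇒m<n∨m≡n (s≤s⁻¹ i<n)
... | inj₁ i<  = all<-elim n φ (proj₂ (∧-true {φ n} eq)) i i<
... | inj₂ refl = proj₁ (∧-true eq)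

all<-intro : ∀ n φ → (∀ i → i < n → φ i ≡ true) → all< n φ ≡ true
all<-intro zero    φ h = refl
all<-intro (suc n) φ h = true-∧ (h n ≤-refl) (all<-intro n φ λ i lt → h i (m≤n⇒m≤1+n lt))

any<-elim : ∀ n φ → any< n φ ≡ true → ∃[ i ] i < n × φ i ≡ true
any<-elim (suc n) φ eq with ∨-true {φ n} eq
... | inj₁ e = n , ≤-refl , e
... | inj₂ e = let i , lt , e′ = any<-elim n φ e in i , m≤n⇒m≤1+n lt , e′

any<-intro : ∀ n φ i → i < n → φ i ≡ true → any< n φ ≡ true
any<-intro (suc n) φ i i<n e with m≤n⇒m<n∨m≡n (s≤s⁻¹ i<n)
... | inj₁ i<   = ∨-trueʳ (φ n) (any<-intro n φ i i< e)
... | inj₂ refl = ∨-trueˡ e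

sameTop-top : ∀ u v → sameTop u v ≡ true → top u ≡ top v
sameTop-top []      []      eq = refl
sameTop-top (b ∷ u) (c ∷ v) eq = cong just (trans (sym (isTrue-just b)) (trans (same-≡ _ _ eq) (isTrue-just c)))

top-≡ : ∀ (u v : Str) → (∀ i → i < length (u ++ v) → top (drop i u) ≡ top (drop i v)) → u ≡ v
top-≡ []      []      h = refl
top-≡ []      (c ∷ v) h with () ← h 0 (s≤s z≤n)
top-≡ (b ∷ u) []      h with () ← h 0 (s≤s z≤n)
top-≡ (b ∷ u) (c ∷ v) h with refl ← h 0 (s≤s z≤n) =
  cong (b ∷_) (top-≡ u v λ i lt → h (suc i) (s≤s (≤-trans lt (≤-trans (≤-reflexive (length-++ u))
    (≤-trans (+-monoʳ-≤ (length u) (n≤1+n _)) (≤-reflexive (sym (length-++ u))))))))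

eqStr-≡ : ∀ u v → eqStr u v ≡ true → u ≡ v
eqStr-≡ u v eq = top-≡ u v λ i lt → sameTop-top (drop i u) (drop i v) (all<-elim _ _ eq i lt)

eqStr-refl : ∀ u → eqStr u u ≡ true
eqStr-refl u = all<-intro (length (u ++ u)) _ λ i _ → true-∧ (same-refl (is-just (top (drop i u)))) (same-refl (isTrue (top (drop i u))))

module _ {inp : A → Str} where

  sameP : ∀ {c d : A → Bool} → inp ⇝ (λ a → [ c a ]) → inp ⇝ (λ a → [ d a ]) → inp ⇝ (λ a → [ same (c a) (d a) ])
  sameP {c} {d} f g = ⇝-ext (ifP f g (notP g)) (λ a → lemma (c a) (d a))
    where
    lemma : ∀ b d → (if b then [ d ] else [ not d ]) ≡ [ same b d ]
    lemma true  d = refl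
    lemma false d = refl

module _ {inp u v : A → Str} where

  eqP : inp ⇝ u → inp ⇝ v → inp ⇝ (λ a → [ eqStr (u a) (v a) ])
  eqP f g = Index.allP inp (λ a → u a ++ v a) (appendP f g)
    (andP (sameP (topP is-just u′) (topP is-just v′)) (sameP (topP isTrue u′) (topP isTrue v′)))
    where
    open Index inp (λ a → u a ++ v a)
    u′ : indexInp ⇝ (λ (a , ys , _) → drop (length ys) (u a))
    u′ = dropP indexP (liftP f)
    v′ : indexInp ⇝ (λ (a , ys , _) → drop (length ys) (v a))
    v′ = dropP indexP (liftP g)

-- Encoded lists of strings

encodeList-drop : ∀ n us → length (encodeList (drop n us)) ≤ length (encodeList us)
encodeList-drop zero    us       = ≤-refl
encodeList-drop (suc n) []       = z≤n
encodeList-drop (suc n) (u ∷ us) = ≤-trans (encodeList-drop n us)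
  (≤-trans (n≤1+n _) (≤-trans (m≤n+m _ (length u + length u)) (≤-reflexive (sym (length-pair u)))))

length-encodeList : ∀ us → length us ≤ length (encodeList us)
length-encodeList []       = z≤n
length-encodeList (u ∷ us) = ≤-trans (s≤s (length-encodeList us))
  (≤-trans (m≤n+m _ (length u + length u)) (≤-reflexive (sym (length-pair u))))

drop-all : ∀ {X : Set} n (xs : List X) → length xs ≤ n → drop n xs ≡ []
drop-all n       []       le       = drop-[] n
drop-all (suc n) (x ∷ xs) (s≤s le) = drop-all n xs le

module _ {inp : A → Str} (us : A → List Str) where

  dropListP : ∀ {c} → inp ⇝ c → inp ⇝ (encodeList ∘ us) → inp ⇝ (λ a → encodeList (drop (length (c a)) (us a)))
  dropListP {c} f g = recP (outᵇ g) (λ a ys _ → encodeList-drop (length ys) (us a)) f g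
    (⇝-ext (π₂P prevP) (λ (a , _ , ys , _) → next (length ys) (us a)))
    where
    open Rec {inp = inp} {c} (λ a ys → encodeList (drop (length ys) (us a)))
    next : ∀ n us → π₂ (encodeList (drop n us)) ≡ encodeList (drop (suc n) us)
    next zero    []       = refl
    next zero    (u ∷ us) = π₂-pair u
    next (suc n) []       = refl
    next (suc n) (u ∷ us) = next n us

pairInp : (A → Str) → A × Str → Str
pairInp inp (a , u) = ⟨ inp a , u ⟩

module _ {inp : A → Str} (us : A → List Str) (φ : A → Str → Bool) where

  -- The loop runs over the bits of the encoding, of which there are at least as many as entries. It
  -- works backwards through the indices: as long as these lie beyond the list the result stays
  -- empty, and afterwards each round extracts its entry afresh and puts one bit in front.
  mapP : inp ⇝ (encodeList ∘ us) → pairInp inp ⇝ (λ (a , u) → [ φ a u ]) →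
         inp ⇝ (λ a → map (φ a) (us a))
  mapP f p = ⇝-ext
    (recP (outᵇ f) small f (⇝-ext (constP []) (λ a → sym (cong (map (φ a)) (drop-all _ (us a) (length-encodeList (us a))))))
      -- A non-empty list never has an empty encoding, so the top symbol tells whether an entry is
      -- left.
      (⇝-ext (ifP (topP is-just remaining) (pushP current prevP) (constP []))
        λ (a , b , ys , lt) → trans
          (cong (λ n → if is-just (top (rest a ys)) then φ a (π₁ (rest a ys)) ∷ map (φ a) (drop n (us a)) else []) (+-∸-assoc 1 lt))
          (next (φ a) (length (U a) ∸ suc (length ys)) (us a))))
    λ a → cong (λ n → map (φ a) (drop n (us a))) (n∸n≡0 (length (encodeList (us a))))
    where
    U : A → Str
    U = encodeList ∘ us
    rest : A → Str → Str
    rest a ys = encodeList (drop (length (U a) ∸ suc (length ys)) (us a))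
    open Rec {inp = inp} {U} (λ a ys → map (φ a) (drop (length (U a) ∸ length ys) (us a)))
    small : ∀ a ys → length ys ≤ length (U a) → length (map (φ a) (drop (length (U a) ∸ length ys) (us a))) ≤ length (U a)
    small a ys _ = ≤-trans (≤-reflexive (length-map (φ a) (drop (length (U a) ∸ length ys) (us a))))
      (≤-trans (≤-reflexive (length-drop (length (U a) ∸ length ys) (us a)))
        (≤-trans (m∸n≤m (length (us a)) (length (U a) ∸ length ys)) (length-encodeList (us a))))
    -- Subtraction in unary: what remains of `U a` after the drop has the required length.
    suffix : stepInp ⇝ (λ (a , b , ys , _) → encodeList (drop (length (drop (length (b ∷ ys)) (U a))) (us a)))
    suffix = dropListP (us ∘ proj₁) (dropP hereP (outerP f)) (outerP f)
    remaining : stepInp ⇝ (λ (a , b , ys , _) → rest a ys)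
    remaining = ⇝-ext suffix λ (a , b , ys , _) → cong (λ n → encodeList (drop n (us a))) (length-drop (suc (length ys)) (U a))
    current : stepInp ⇝ (λ (a , b , ys , _) → [ φ a (π₁ (rest a ys)) ])
    current = appP (λ (a , b , ys , _) → a , π₁ (rest a ys)) p
      (pairP ctxP (π₁P remaining))
    next : ∀ (f : Str → Bool) n us →
           (if is-just (top (encodeList (drop n us))) then f (π₁ (encodeList (drop n us))) ∷ map f (drop (suc n) us) else [])
           ≡ map f (drop n us)
    next f zero    []       = refl
    next f zero    (u ∷ us) = trans (cong (if_then f (π₁ ⟨ u , encodeList us ⟩) ∷ map f us else []) (just-top u))
                                    (cong (λ v → f v ∷ map f us) (π₁-pair u))
      where
      just-top : ∀ u {w} → is-just (top ⟨ u , w ⟩) ≡ true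
      just-top []      = refl
      just-top (b ∷ u) = refl
    next f (suc n) []       = refl
    next f (suc n) (u ∷ us) = next f n us

-- Budget, inclusion and intersection on bit vectors

bit : Str → ℕ → Bool
bit s i = isTrue (top (drop i s))

bitAtP : ∀ {inp s c : A → Str} → inp ⇝ s → inp ⇝ c → inp ⇝ (λ a → [ bit (s a) (length (c a)) ])
bitAtP f g = topP isTrue (dropP g f)

-- The budget is written in binary and may be exponential in the length of the input, so it cannot
-- be turned into unary. But the count of elements rises in steps of one: it exceeds the budget iff
-- it equals the budget at the moment when another element arrives, and this takes only equality
-- tests.
unreached : Str → Str → Bool
unreached g []          = true
unreached g (true ∷ s)  = not (eqStr (bin (popcount s)) g) ∧ unreached g s
unreached g (false ∷ s) = unreached g s

unreachedP : ∀ {inp g s : A → Str} → inp ⇝ g → inp ⇝ s → inp ⇝ (λ a → [ unreached (g a) (s a) ])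
unreachedP {inp = inp} {g} {s} f h = recP (constᵇ 1) (λ _ _ _ → ≤-refl) h (constP [ true ])
  (⇝-ext (ifP bitP (andP (notP (eqP (binP restP) (outerP f))) prevP) prevP) λ (a , b , ys , _) → lemma b ys)
  where
  open Rec {inp = inp} {s} (λ a ys → [ unreached (g a) ys ])
  lemma : ∀ b ys {g} → (if b then [ not (eqStr (bin (popcount ys)) g) ∧ unreached g ys ] else [ unreached g ys ]) ≡ [ unreached g (b ∷ ys) ]
  lemma true  ys = refl
  lemma false ys = refl

not-true : ∀ {b} → not b ≡ true → b ≡ false
not-true {false} eq = refl

false-not : ∀ {b} → b ≡ false → not b ≡ true
false-not refl = refl

eqStr-false : ∀ {u v} → u ≢ v → eqStr u v ≡ false
eqStr-false {u} {v} ne with eqStr u v in eq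
... | true  = contradiction (eqStr-≡ u v eq) ne
... | false = refl

unreached-≤ : ∀ m s → unreached (bin m) s ≡ true → popcount s ≤ m
unreached-≤ m []          eq = z≤n
unreached-≤ m (true ∷ s)  eq with ∧-true {not (eqStr (bin (popcount s)) (bin m))} eq
... | ne , eq′ = ≤∧≢⇒< (unreached-≤ m s eq′) λ { refl → case-true (trans (sym (eqStr-refl (bin m))) (not-true ne)) }
  where
  case-true : true ≢ false
  case-true ()
unreached-≤ m (false ∷ s) eq = unreached-≤ m s eq

≤-unreached : ∀ m s → popcount s ≤ m → unreached (bin m) s ≡ true
≤-unreached m []          le = refl
≤-unreached m (true ∷ s)  le = true-∧
  (false-not (eqStr-false λ eq → <⇒≢ le (bin-injective (popcount s) m eq)))
  (≤-unreached m s (<⇒≤ le))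
≤-unreached m (false ∷ s) le = ≤-unreached m s le

popcount-toList : (B : Subset n) → popcount (toList B) ≡ ∣ B ∣
popcount-toList []          = refl
popcount-toList (true ∷ B)  = cong suc (popcount-toList B)
popcount-toList (false ∷ B) = popcount-toList B

-- The first bit of `encodeℤ` is the sign, and a negative budget admits no set at all.
withinBudget : Str → Str → Bool
withinBudget γ s = not (isTrue (top γ)) ∧ unreached (drop 1 γ) s

withinBudget⇒≤ : ∀ Γ (B : Subset n) → withinBudget (encodeℤ Γ) (toList B) ≡ true → + ∣ B ∣ ℤ.≤ Γ
withinBudget⇒≤ (+ m) B eq = ℤ.+≤+ (subst (_≤ m) (popcount-toList B) (unreached-≤ m (toList B) eq))

≤⇒withinBudget : ∀ Γ (B : Subset n) → + ∣ B ∣ ℤ.≤ Γ → withinBudget (encodeℤ Γ) (toList B) ≡ true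
≤⇒withinBudget (+ m) B (ℤ.+≤+ le) = ≤-unreached m (toList B) (subst (_≤ m) (sym (popcount-toList B)) le)

bit-lookup : (B : Vec Bool n) (i : Fin n) → bit (toList B) (toℕ i) ≡ lookup B i
bit-lookup (true ∷ B)  zero = refl
bit-lookup (false ∷ B) zero = refl
bit-lookup (b ∷ B) (suc i)  = bit-lookup B i

bit⇒∈ : (B : Subset n) (i : Fin n) → bit (toList B) (toℕ i) ≡ true → i ∈ B
bit⇒∈ B i eq = lookup⇒[]= i B (trans (sym (bit-lookup B i)) eq)

∈⇒bit : (B : Subset n) (i : Fin n) → i ∈ B → bit (toList B) (toℕ i) ≡ true
∈⇒bit B i p = trans (bit-lookup B i) ([]=⇒lookup p)

included meets : Str → Str → ℕ → Bool
included b d n = all< n λ i → not (bit b i) ∨ bit d i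
meets    b s n = any< n λ i → bit b i ∧ bit s i

included⇒⊆ : (B D : Subset n) → included (toList B) (toList D) n ≡ true → B ⊆ D
included⇒⊆ {n} B D eq {i} i∈B with ∨-true (all<-elim n _ eq (toℕ i) (toℕ<n i))
... | inj₁ ni = contradiction (trans (sym (∈⇒bit B i i∈B)) (not-true ni)) λ ()
... | inj₂ i∈D = bit⇒∈ D i i∈D

⊆⇒included : (B D : Subset n) → B ⊆ D → included (toList B) (toList D) n ≡ true
⊆⇒included {n} B D sub = all<-intro n _ go
  where
  go : ∀ i → i < n → not (bit (toList B) i) ∨ bit (toList D) i ≡ true
  go i lt with bit (toList B) i in eq
  ... | false = refl
  ... | true  = subst (λ i → bit (toList D) i ≡ true) (toℕ-fromℕ< lt) (∈⇒bit D (fromℕ< lt) (sub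
                  (bit⇒∈ B (fromℕ< lt) (subst (λ i → bit (toList B) i ≡ true) (sym (toℕ-fromℕ< lt)) eq))))

meets⇒Nonempty : (B S : Subset n) → meets (toList B) (toList S) n ≡ true → Nonempty (B ∩ S)
meets⇒Nonempty {n} B S eq with any<-elim n _ eq
... | i , lt , e with ∧-true {bit (toList B) i} e
... | i∈B , i∈S = fromℕ< lt , x∈p∩q⁺ (at B i∈B , at S i∈S)
  where
  at : (B : Subset n) → bit (toList B) i ≡ true → fromℕ< lt ∈ B
  at B e = bit⇒∈ B (fromℕ< lt) (subst (λ i → bit (toList B) i ≡ true) (sym (toℕ-fromℕ< lt)) e)

Nonempty⇒meets : (B S : Subset n) → Nonempty (B ∩ S) → meets (toList B) (toList S) n ≡ true
Nonempty⇒meets {n} B S (i , p) with x∈p∩q⁻ B S p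
... | i∈B , i∈S = any<-intro n _ (toℕ i) (toℕ<n i) (true-∧ (∈⇒bit B i i∈B) (∈⇒bit S i i∈S))

prefix : ℕ → Str → Str
prefix n s = tab n (bit s)

tab-vec : ∀ n φ → ∃[ B ] toList {n = n} B ≡ tab n φ
tab-vec zero    φ = [] , refl
tab-vec (suc n) φ = let B , eq = tab-vec n φ in φ n ∷ B , cong (φ n ∷_) eq

bit-++ : ∀ s b t → bit (s ++ b ∷ t) (length s) ≡ b
bit-++ []      true  t = refl
bit-++ []      false t = refl
bit-++ (_ ∷ s) b     t = bit-++ s b t

-- The tail is arbitrary for two reasons: the induction appends a bit behind `s`, and a witness is
-- padded to its prescribed length.
prefix-onto : (B : Vec Bool n) → ∃[ s ] length s ≡ n × (∀ t → prefix n (s ++ t) ≡ toList B)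
prefix-onto []      = [] , refl , λ t → refl
prefix-onto {suc n} (b ∷ B) with prefix-onto B
... | s , len , eq = s ++ [ b ] , trans (length-++ s) (trans (cong (_+ 1) len) (+-comm n 1)) , λ t →
  cong₂ _∷_ (trans (cong (bit ((s ++ [ b ]) ++ t)) (sym len)) (trans (cong (λ u → bit u (length s)) (++-assoc s [ b ] t)) (bit-++ s b t)))
            (trans (cong (prefix n) (++-assoc s [ b ] t)) (eq (b ∷ t)))

list-vec : ∀ {m} (s : Str) → length s ≡ m → ∃[ y ] toList {n = m} y ≡ s
list-vec s refl = fromList s , toList∘fromList s

-- tab lists its values downwards, so the witness stores B in reverse order.
prefix-vec : n ≤ m → (B : Vec Bool n) → ∃[ y ] prefix n (toList {n = m} y) ≡ toList B
prefix-vec {n} {m} n≤m B with prefix-onto B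
... | s , len , eq with list-vec {m} (s ++ List.replicate (m ∸ n) false)
                     (trans (length-++ s) (trans (cong₂ _+_ len (length-replicate (m ∸ n))) (m+[n∸m]≡n n≤m)))
... | y , y≡ = y , trans (cong (prefix n) y≡) (eq _)

-- Membership in Σ₂ᵖ

module Membership (Π : NPSProblem) where
  open NPSProblem Π

  check : Str → Str → Str → Str → Str → Bool
  check w d γ b s = included b d (length d) ∧ withinBudget γ b ∧ (meets b s (length d) ∨ not (V w s))

  -- The vector `d` has one bit per element, so its length is the size of the universe, and both
  -- witnesses are cut to this length without listing the universe.
  W : Str → Str → Str → Bool
  W x y z = check (π₁ x) d (π₂ (π₂ x)) (prefix (length d) y) (prefix (length d) z)
    where
    d = π₁ (π₂ x)

  Args : Set
  Args = Str × Str × Str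

  inp : Args → Str
  inp (x , y , z) = ⟨ x , ⟨ y , z ⟩ ⟩

  xP : inp ⇝ proj₁
  xP = fstP idP

  yzP : inp ⇝ (λ (_ , y , z) → ⟨ y , z ⟩)
  yzP = sndP {v = proj₁} idP

  yP : inp ⇝ (λ (_ , y , _) → y)
  yP = fstP yzP

  zP : inp ⇝ (λ (_ , _ , z) → z)
  zP = sndP {v = λ (_ , y , _) → y} yzP

  dOf : Args → Str
  dOf (x , _) = π₁ (π₂ x)

  dP : inp ⇝ dOf
  dP = π₁P (π₂P xP)

  open Index inp dOf

  prefixP : ∀ {s} → inp ⇝ s → inp ⇝ (λ a → prefix (length (dOf a)) (s a))
  prefixP f = tabP dP (bitAtP (liftP f) indexP)

  bP : inp ⇝ (λ a → prefix (length (dOf a)) (proj₁ (proj₂ a)))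
  bP = prefixP yP

  sP : inp ⇝ (λ a → prefix (length (dOf a)) (proj₂ (proj₂ a)))
  sP = prefixP zP

  vP : inp ⇝ (λ a → [ V (π₁ (proj₁ a)) (prefix (length (dOf a)) (proj₂ (proj₂ a))) ])
  vP = appP (λ a → π₁ (proj₁ a) , prefix (length (dOf a)) (proj₂ (proj₂ a))) (fromPolyTime V-poly) (pairP (π₁P xP) sP)

  W-program : inp ⇝ (λ (x , y , z) → [ W x y z ])
  W-program = andP (allP dP (orP (notP (bitAtP (liftP bP) indexP)) (bitAtP (liftP dP) indexP)))
    (andP (andP (notP (topP isTrue γP)) (unreachedP (tailP γP) bP))
          (orP (anyP dP (andP (bitAtP (liftP bP) indexP) (bitAtP (liftP sP) indexP))) (notP vP)))
    where
    γP : inp ⇝ (λ (x , _) → π₂ (π₂ x))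
    γP = π₂P (π₂P xP)

  open DecisionProblem (Interdiction Π) renaming (code to encode)

  W-code : ∀ ((I , D , Γ) : Input) y z (B S : SubsetOf𝓤 I) → prefix (length (𝓤 I)) y ≡ toList B → prefix (length (𝓤 I)) z ≡ toList S →
           W (encode (I , D , Γ)) y z ≡ check (proj₁ I) (toList D) (encodeℤ Γ) (toList B) (toList S)
  W-code (I , D , Γ) y z B S eqB eqS
    rewrite π₂-pair (proj₁ I) {⟨ toList D , encodeℤ Γ ⟩} | π₁-pair (proj₁ I) {⟨ toList D , encodeℤ Γ ⟩}
          | π₁-pair (toList D) {encodeℤ Γ} | π₂-pair (toList D) {encodeℤ Γ} | length-toList D | eqB | eqS = refl

  check⇒ : ∀ ((I , D , Γ) : Input) (B S : SubsetOf𝓤 I) →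
           check (proj₁ I) (toList D) (encodeℤ Γ) (toList B) (toList S) ≡ true →
           B ⊆ D × + ∣ B ∣ ℤ.≤ Γ × (𝓢 I S → Nonempty (B ∩ S))
  check⇒ (I , D , Γ) B S eq rewrite length-toList D
    with inc , rest ← ∧-true {included (toList B) (toList D) (length (𝓤 I))} eq
    with bud , hit ← ∧-true {withinBudget (encodeℤ Γ) (toList B)} rest =
    included⇒⊆ B D inc , withinBudget⇒≤ Γ B bud , λ S∈ → meets⇒Nonempty B S (resolve (∨-true hit) S∈)
    where
    resolve : meets (toList B) (toList S) (length (𝓤 I)) ≡ true ⊎ not (V (proj₁ I) (toList S)) ≡ true → 𝓢 I S →
              meets (toList B) (toList S) (length (𝓤 I)) ≡ true
    resolve (inj₁ h) S∈ = h
    resolve (inj₂ h) S∈ = contradiction (trans (sym (Equivalence.from (V-spec I S) S∈)) (not-true h)) λ ()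

  check⇐ : ∀ ((I , D , Γ) : Input) (B S : SubsetOf𝓤 I) → B ⊆ D → + ∣ B ∣ ℤ.≤ Γ → (𝓢 I S → Nonempty (B ∩ S)) →
           check (proj₁ I) (toList D) (encodeℤ Γ) (toList B) (toList S) ≡ true
  check⇐ (I , D , Γ) B S sub bud hit rewrite length-toList D =
    true-∧ (⊆⇒included B D sub) (true-∧ (≤⇒withinBudget Γ B bud) last)
    where
    last : meets (toList B) (toList S) (length (𝓤 I)) ∨ not (V (proj₁ I) (toList S)) ≡ true
    last with V (proj₁ I) (toList S) in eq
    ... | true  = ∨-trueˡ (Nonempty⇒meets B S (hit (Equivalence.to (V-spec I S) eq)))
    ... | false = ∨-trueʳ (meets (toList B) (toList S) (length (𝓤 I))) refl

  -- The identity polynomial: the vector of D is part of the code, which is therefore at least as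
  -- long as the universe is large.
  bnd : Poly
  bnd = 0 ∷ 1 ∷ []

  fits : ∀ ((I , D , Γ) : Input) → length (𝓤 I) ≤ eval bnd (length (encode (I , D , Γ)))
  fits (I , D , Γ) = ≤-trans (≤-trans (≤-reflexive (sym (length-toList D)))
    (≤-trans (≤-trans (≤-reflexive (cong length (sym (π₁-pair (toList D) {encodeℤ Γ})))) (length-π₁ ⟨ toList D , encodeℤ Γ ⟩))
    (≤-trans (≤-reflexive (cong length (sym (π₂-pair (proj₁ I))))) (length-π₂ (encode (I , D , Γ))))))
    (bound (lenᵇ {inp = encode}) (I , D , Γ))

  W-correct : ∀ x → let m = eval bnd (length (encode x)) in
              Yes x ⇔ (Σ (Vec Bool m) λ y → (z : Vec Bool m) → W (encode x) (toList y) (toList z) ≡ true)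
  W-correct x@(I , D , Γ) = mk⇔ to from
    where
    M = eval bnd (length (encode x))
    to : Yes x → Σ (Vec Bool M) λ y → (z : Vec Bool M) → W (encode x) (toList y) (toList z) ≡ true
    to (B , sub , bud , hit) with prefix-vec {m = M} (fits x) B
    ... | y , yB = y , λ z → let S , zS = tab-vec (length (𝓤 I)) (bit (toList z)) in
                     trans (W-code x (toList y) (toList z) B S yB (sym zS)) (check⇐ x B S sub bud (hit S))
    from : (Σ (Vec Bool M) λ y → (z : Vec Bool M) → W (encode x) (toList y) (toList z) ≡ true) → Yes x
    from (y , ok) with tab-vec (length (𝓤 I)) (bit (toList y))
    -- The conditions on B alone are tested anew for each z. Any subset serves to read them off, and
    -- B is at hand.
    ... | B , By = B , proj₁ (facts B) , proj₁ (proj₂ (facts B)) , λ S → proj₂ (proj₂ (facts S))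
      where
      facts : ∀ S → B ⊆ D × + ∣ B ∣ ℤ.≤ Γ × (𝓢 I S → Nonempty (B ∩ S))
      facts S with prefix-vec {m = M} (fits x) S
      ... | z , zS = check⇒ x B S (trans (sym (W-code x (toList y) (toList z) B S (sym By) zS)) (ok z))

  inΣ₂ᵖ : InΣ₂ᵖ (Interdiction Π)
  inΣ₂ᵖ = record { bound = bnd ; W = W ; W-poly = toPolyTime W-program ; W-spec = W-correct }

-- Blockers under an embedding of universes

does-true : {P : Set} (d : Dec P) → does d ≡ true → P
does-true (yes p) eq = p

∈image⁺ : (f : Fin n → Fin N) {S : Subset n} → ∀ {i} → i ∈ S → f i ∈ image f S
∈image⁺ f {S} {i} p = lookup⇒[]= (f i) (image f S) (trans (lookup∘tabulate _ (f i))
  (dec-true (any? λ i′ → (i′ ∈? S) ×-dec (f i′ ≟ f i)) (i , p , refl)))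

∈image⁻ : (f : Fin n → Fin N) {S : Subset n} → ∀ {j} → j ∈ image f S → ∃[ i ] i ∈ S × f i ≡ j
∈image⁻ f {S} {j} p = does-true (any? λ i → (i ∈? S) ×-dec (f i ≟ j)) (trans (sym (lookup∘tabulate _ j)) ([]=⇒lookup p))

-- A relation instead of a function lets the same count serve `f` and its partial inverse. The
-- induction removes from `Q` the partner of the first element of `P`.
card-≤ : (R : Fin n → Fin N → Set) → (∀ {i i′ j} → R i j → R i′ j → i ≡ i′) → (P : Subset n) (Q : Subset N) →
         (∀ {i} → i ∈ P → ∃[ j ] j ∈ Q × R i j) → ∣ P ∣ ≤ ∣ Q ∣
card-≤ R inj []          Q h = z≤n
card-≤ R inj (false ∷ P) Q h = card-≤ (R ∘ suc) (λ r s → Fin.suc-injective (inj r s)) P Q (h ∘ there)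
card-≤ R inj (true ∷ P)  Q h with h here
... | j₀ , j₀∈Q , r₀ = ≤-<-trans (card-≤ (R ∘ suc) (λ r s → Fin.suc-injective (inj r s)) P (Q - j₀) avoiding) (x∈p⇒∣p-x∣<∣p∣ j₀∈Q)
  where
  avoiding : ∀ {i} → i ∈ P → ∃[ j ] j ∈ Q - j₀ × R (suc i) j
  avoiding i∈P with h (there i∈P)
  ... | j , j∈Q , r = j , x∈p∧x≢y⇒x∈p-y j∈Q (λ { refl → contradiction (inj r r₀) λ () }) , r

Blocks : (𝓢 : Pred (Subset n) 0ℓ) (D : Subset n) (c : ℕ) → Set
Blocks 𝓢 D c = ∃[ B ] B ⊆ D × ∣ B ∣ ≤ c × (∀ S → 𝓢 S → Nonempty (B ∩ S))

module _ (f : Fin n → Fin N) (f-inj : Injective _≡_ _≡_ f) {𝓢 : Pred (Subset n) 0ℓ} {𝓢′ : Pred (Subset N) 0ℓ}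
         (embedding : (λ T → ∃[ S ] 𝓢 S × T ≡ image f S) ≐ (λ T → ∃[ S′ ] 𝓢′ S′ × T ≡ S′ ∩ image f ⊤))
         (D : Subset n) (c : ℕ) where

  -- Blockers are carried forward by image and back by preimage. Going forward, a solution of the
  -- target has to come from one of the source, which is the second inclusion of `embedding`; going
  -- back, a solution of the source has to extend to the target, which is the first.
  blocks-image : Blocks 𝓢 D c ⇔ Blocks 𝓢′ (image f D) c
  blocks-image = mk⇔ to from
    where
    to : Blocks 𝓢 D c → Blocks 𝓢′ (image f D) c
    to (B , B⊆D , B≤c , hit) = image f B , sub , ≤-trans small B≤c , hit′
      where
      sub : image f B ⊆ image f D
      sub p with ∈image⁻ f p
      ... | i , i∈B , refl = ∈image⁺ f (B⊆D i∈B)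
      small : ∣ image f B ∣ ≤ ∣ B ∣
      small = card-≤ (λ j i → f i ≡ j) (λ { refl refl → refl }) (image f B) B (∈image⁻ f)
      hit′ : ∀ S′ → 𝓢′ S′ → Nonempty (image f B ∩ S′)
      hit′ S′ S′∈ with proj₂ embedding (S′ , S′∈ , refl)
      ... | S , S∈ , eq with hit S S∈
      ... | i , p with x∈p∩q⁻ B S p
      ... | i∈B , i∈S = f i , x∈p∩q⁺ (∈image⁺ f i∈B ,
                          proj₁ (x∈p∩q⁻ S′ (image f ⊤) (subst (f i ∈_) (sym eq) (∈image⁺ f i∈S))))
    from : Blocks 𝓢′ (image f D) c → Blocks 𝓢 D c
    from (B′ , B′⊆ , B′≤c , hit) = B , sub , ≤-trans small B′≤c , hit′
      where
      B : Subset n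
      B = tabulate (lookup B′ ∘ f)
      B⁺ : ∀ {i} → f i ∈ B′ → i ∈ B
      B⁺ {i} p = lookup⇒[]= i B (trans (lookup∘tabulate (lookup B′ ∘ f) i) ([]=⇒lookup p))
      B⁻ : ∀ {i} → i ∈ B → f i ∈ B′
      B⁻ {i} p = lookup⇒[]= (f i) B′ (trans (sym (lookup∘tabulate (lookup B′ ∘ f) i)) ([]=⇒lookup p))
      sub : B ⊆ D
      sub p with ∈image⁻ f (B′⊆ (B⁻ p))
      ... | i , i∈D , eq = subst (_∈ D) (f-inj eq) i∈D
      small : ∣ B ∣ ≤ ∣ B′ ∣
      small = card-≤ (λ i j → f i ≡ j) (λ p q → f-inj (trans p (sym q))) B B′ λ p → _ , B⁻ p , refl
      hit′ : ∀ S → 𝓢 S → Nonempty (B ∩ S)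
      hit′ S S∈ with proj₁ embedding (S , S∈ , refl)
      ... | S′ , S′∈ , eq with hit S′ S′∈
      ... | j , p with x∈p∩q⁻ B′ S′ p
      ... | j∈B′ , j∈S′ with ∈image⁻ f (B′⊆ j∈B′)
      -- The common element of `B′` and `S′` is an image, as `B′` contains nothing else; so it lies
      -- in the trace of `S′` and comes from `S`.
      ... | i , _ , refl with ∈image⁻ f (subst (f i ∈_) (sym eq) (x∈p∩q⁺ (j∈S′ , ∈image⁺ f ∈⊤)))
      ... | i′ , i′∈S , eq′ = i , x∈p∩q⁺ (B⁺ j∈B′ , subst (_∈ S) (f-inj eq′) i′∈S)

-- The hard problem and its blockers

-- The kinds k₀, k₁, k₂ are those of the elements aᵢ, bᵢ, cᵢ.
Kind : Set
Kind = Fin 3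

pattern k₀ = zero
pattern k₁ = suc zero
pattern k₂ = suc (suc zero)

el : Kind → ℕ → Str
el k₀ n = true ∷ true ∷ ones n
el k₁ n = true ∷ false ∷ ones n
el k₂ n = false ∷ false ∷ ones n

-- The numbers descend because the list is produced by recursion on a unary number. Hence the triple
-- at position i bears the number `opposite i`.
els : ℕ → List Str
els zero    = []
els (suc n) = el k₀ n ∷ el k₁ n ∷ el k₂ n ∷ els n

pos : Kind → Fin m → Fin (length (els m))
pos k₀ zero    = zero
pos k₁ zero    = suc zero
pos k₂ zero    = suc (suc zero)
pos k  (suc i) = suc (suc (suc (pos k i)))

data View : ∀ {m} → Fin (length (els m)) → Set where
  at : (k : Kind) (i : Fin m) → View {m} (pos k i)

view : ∀ {m} (x : Fin (length (els m))) → View {m} x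
view {suc m} zero             = at k₀ zero
view {suc m} (suc zero)       = at k₁ zero
view {suc m} (suc (suc zero)) = at k₂ zero
view {suc m} (suc (suc (suc x))) with view {m} x
... | at k₀ i = at k₀ (suc i)
... | at k₁ i = at k₁ (suc i)
... | at k₂ i = at k₂ (suc i)

lookup-els : ∀ m k (i : Fin m) → List.lookup (els m) (pos k i) ≡ el k (toℕ (opposite i))
lookup-els (suc m) k₀ zero = cong (el k₀) (sym (Fin.toℕ-fromℕ m))
lookup-els (suc m) k₁ zero = cong (el k₁) (sym (Fin.toℕ-fromℕ m))
lookup-els (suc m) k₂ zero = cong (el k₂) (sym (Fin.toℕ-fromℕ m))
lookup-els (suc m) k₀ (suc i) = trans (lookup-els m k₀ i) (cong (el k₀) (sym (Fin.toℕ-inject₁ (opposite i))))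
lookup-els (suc m) k₁ (suc i) = trans (lookup-els m k₁ i) (cong (el k₁) (sym (Fin.toℕ-inject₁ (opposite i))))
lookup-els (suc m) k₂ (suc i) = trans (lookup-els m k₂ i) (cong (el k₂) (sym (Fin.toℕ-inject₁ (opposite i))))

select : ∀ m → (Kind → ℕ → Bool) → Subset (length (els m))
select zero    φ = []
select (suc m) φ = φ k₀ 0 ∷ φ k₁ 0 ∷ φ k₂ 0 ∷ select m (λ k i → φ k (suc i))

lookup-select : ∀ φ k (i : Fin m) → lookup (select m φ) (pos k i) ≡ φ k (toℕ i)
lookup-select φ k₀ zero    = refl
lookup-select φ k₁ zero    = refl
lookup-select φ k₂ zero    = refl
lookup-select φ k₀ (suc i) = lookup-select (λ k i → φ k (suc i)) k₀ i
lookup-select φ k₁ (suc i) = lookup-select (λ k i → φ k (suc i)) k₁ i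
lookup-select φ k₂ (suc i) = lookup-select (λ k i → φ k (suc i)) k₂ i

-- Three single drops per index make this directly a loop of tail operations, with no multiplication
-- of the index by three.
triples : ℕ → Str → Str
triples zero    c = c
triples (suc i) c = drop 1 (drop 1 (drop 1 (triples i c)))

tribit : Kind → Str → ℕ → Bool
tribit k c i = bit (triples i c) (toℕ k)

triples-suc : ∀ i a b d c → triples (suc i) (a ∷ b ∷ d ∷ c) ≡ triples i c
triples-suc zero    a b d c = refl
triples-suc (suc i) a b d c = cong (drop 1 ∘ drop 1 ∘ drop 1) (triples-suc i a b d c)

tribit-lookup : ∀ k (C : Subset (length (els m))) (i : Fin m) → tribit k (toList C) (toℕ i) ≡ lookup C (pos k i)
tribit-lookup k₀ (a ∷ C) zero = bit-lookup (a ∷ []) zero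
tribit-lookup k₁ (_ ∷ a ∷ C) zero = bit-lookup (a ∷ []) zero
tribit-lookup k₂ (_ ∷ _ ∷ a ∷ C) zero = bit-lookup (a ∷ []) zero
tribit-lookup k₀ (a ∷ b ∷ d ∷ C) (suc i) = trans (cong (λ s → bit s 0) (triples-suc (toℕ i) a b d (toList C))) (tribit-lookup k₀ C i)
tribit-lookup k₁ (a ∷ b ∷ d ∷ C) (suc i) = trans (cong (λ s → bit s 1) (triples-suc (toℕ i) a b d (toList C))) (tribit-lookup k₁ C i)
tribit-lookup k₂ (a ∷ b ∷ d ∷ C) (suc i) = trans (cong (λ s → bit s 2) (triples-suc (toℕ i) a b d (toList C))) (tribit-lookup k₂ C i)

tribit-select : ∀ φ k i → i < m → tribit k (toList (select m φ)) i ≡ φ k i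
tribit-select {m} φ k i lt = subst (λ i → tribit k (toList (select m φ)) i ≡ φ k i) (toℕ-fromℕ< lt)
  (trans (tribit-lookup k (select m φ) (fromℕ< lt)) (lookup-select φ k (fromℕ< lt)))

bit⇒∈pos : ∀ k (C : Subset (length (els m))) {i} (lt : i < m) → tribit k (toList C) i ≡ true → pos k (fromℕ< lt) ∈ C
bit⇒∈pos {m} k C {i} lt eq = lookup⇒[]= (pos k (fromℕ< lt)) C
  (trans (sym (tribit-lookup {m} k C (fromℕ< lt))) (subst (λ i → tribit k (toList C) i ≡ true) (sym (toℕ-fromℕ< lt)) eq))

∈pos⇒bit : ∀ k (C : Subset (length (els m))) i → pos k i ∈ C → tribit k (toList C) (toℕ i) ≡ true
∈pos⇒bit {m} k C i p = trans (tribit-lookup {m} k C i) ([]=⇒lookup p)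

tab-cong : ∀ n {φ ψ : ℕ → Bool} → (∀ i → i < n → φ i ≡ ψ i) → tab n φ ≡ tab n ψ
tab-cong zero    h = refl
tab-cong (suc n) h = cong₂ _∷_ (h n ≤-refl) (tab-cong n λ i lt → h i (m≤n⇒m≤1+n lt))

vec-tab : (y : Vec Bool n) → ∃[ φ ] tab n φ ≡ toList y
vec-tab y = let s , _ , eq = prefix-onto y in bit (s ++ []) , eq []

Literals : ∀ m → Subset (length (els m))
Literals m = select m λ { k₂ _ → false ; _ _ → true }

Covered : ∀ m → Subset (length (els m)) → Set
Covered m B = ∀ (i : Fin m) → lookup B (pos k₀ i) ∨ lookup B (pos k₁ i) ≡ true

count-covered : ∀ m (B : Subset (length (els m))) → Covered m B → m ≤ ∣ B ∣
count-covered zero    B h = z≤n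
count-covered (suc m) (a ∷ b ∷ d ∷ B) h = go a b d (h zero) (count-covered m B (h ∘ suc))
  where
  go : ∀ a b d → a ∨ b ≡ true → m ≤ ∣ B ∣ → suc m ≤ ∣ a ∷ b ∷ d ∷ B ∣
  go true  true  true  _ le = s≤s (m≤n⇒m≤1+n (m≤n⇒m≤1+n le))
  go true  true  false _ le = s≤s (m≤n⇒m≤1+n le)
  go true  false true  _ le = s≤s (m≤n⇒m≤1+n le)
  go true  false false _ le = s≤s le
  go false true  true  _ le = s≤s (m≤n⇒m≤1+n le)
  go false true  false _ le = s≤s le

-- Each triple contributes at least one literal and the doubled one contributes two. A blocker
-- within the budget m therefore contains no pair completely.
count-doubled : ∀ m (B : Subset (length (els m))) → Covered m B → (i : Fin m) →
                lookup B (pos k₀ i) ≡ true → lookup B (pos k₁ i) ≡ true → m < ∣ B ∣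
count-doubled (suc m) (true ∷ true ∷ false ∷ B) h zero p q = s≤s (s≤s (count-covered m B (h ∘ suc)))
count-doubled (suc m) (true ∷ true ∷ true ∷ B)  h zero p q = s≤s (s≤s (m≤n⇒m≤1+n (count-covered m B (h ∘ suc))))
count-doubled (suc m) (a ∷ b ∷ d ∷ B) h (suc i) p q = go a b d (h zero) (count-doubled m B (h ∘ suc) i p q)
  where
  go : ∀ a b d → a ∨ b ≡ true → m < ∣ B ∣ → suc m < ∣ a ∷ b ∷ d ∷ B ∣
  go true  true  true  _ le = s≤s (m≤n⇒m≤1+n (m≤n⇒m≤1+n le))
  go true  true  false _ le = s≤s (m≤n⇒m≤1+n le)
  go true  false true  _ le = s≤s (m≤n⇒m≤1+n le)
  go true  false false _ le = s≤s le
  go false true  true  _ le = s≤s (m≤n⇒m≤1+n le)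
  go false true  false _ le = s≤s le

complementary : (ℕ → Bool) → (ℕ → Bool) → Kind → ℕ → Bool
complementary β ζ k₀ i = β i
complementary β ζ k₁ i = not (β i)
complementary β ζ k₂ i = ζ i

count-select : ∀ m φ → (∀ i → φ k₁ i ≡ not (φ k₀ i)) → (∀ i → φ k₂ i ≡ false) → ∣ select m φ ∣ ≡ m
count-select zero    φ h g = refl
count-select (suc m) φ h g with φ k₀ 0 | φ k₁ 0 | h 0 | φ k₂ 0 | g 0 | count-select m (λ k i → φ k (suc i)) (h ∘ suc) (g ∘ suc)
... | true  | _ | refl | _ | refl | eq = cong suc eq
... | false | _ | refl | _ | refl | eq = cong suc eq

-- In the second clause one literal or more per pair is enough, since a set that contains both of
-- some pair is accepted by the first clause anyway.
accepts : ℕ → (Str → Str → Bool) → Str → Bool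
accepts m W c =
  any< m (λ i → tribit k₀ c i ∧ tribit k₁ c i) ∨
  (all< m (λ i → tribit k₀ c i ∨ tribit k₁ c i) ∧ not (W (tab m (tribit k₁ c)) (tab m (tribit k₂ c))))

blocks-accepts : ∀ m (W : Str → Str → Bool) →
  Blocks (λ C → accepts m W (toList C) ≡ true) (Literals m) m ⇔ (Σ (Vec Bool m) λ y → (z : Vec Bool m) → W (toList y) (toList z) ≡ true)
blocks-accepts m W = mk⇔ to from
  where
  𝓢 : Pred (Subset (length (els m))) 0ℓ
  𝓢 C = accepts m W (toList C) ≡ true

  from : (Σ (Vec Bool m) λ y → (z : Vec Bool m) → W (toList y) (toList z) ≡ true) → Blocks 𝓢 (Literals m) m
  from (y , ok) with vec-tab y
  ... | β , y≡ = B , sub , ≤-reflexive (count-select m (complementary β λ _ → false) (λ _ → refl) (λ _ → refl)) , hit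
    where
    B : Subset (length (els m))
    -- `aᵢ` for a true bit of y and `bᵢ` for a false one: one literal per pair, hence m in all.
    B = select m (complementary β λ _ → false)
    sub : B ⊆ Literals m
    sub {x} p with view {m} x
    ... | at k₀ i = lookup⇒[]= _ (Literals m) (lookup-select _ k₀ i)
    ... | at k₁ i = lookup⇒[]= _ (Literals m) (lookup-select _ k₁ i)
    ... | at k₂ i with () ← trans (sym ([]=⇒lookup p)) (lookup-select (complementary β λ _ → false) k₂ i)
    hit : ∀ C → 𝓢 C → Nonempty (B ∩ C)
    -- Decides whether B and C share a literal, the bits of B being `β` and its negation. If they do
    -- not, C cannot contain a full pair, and covering all pairs it must encode the y of B, for
    -- which no z refutes `W`.
    hit C C∈ with any< m (λ i → (β i ∧ tribit k₀ (toList C) i) ∨ (not (β i) ∧ tribit k₁ (toList C) i)) in eq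
    ... | true  = let i , lt , e = any<-elim m _ eq in meet i lt (∨-true e)
      where
      meet : ∀ i → i < m → β i ∧ tribit k₀ (toList C) i ≡ true ⊎ not (β i) ∧ tribit k₁ (toList C) i ≡ true → Nonempty (B ∩ C)
      meet i lt (inj₁ e) with b , c ← ∧-true {β i} e = pos k₀ (fromℕ< lt) , x∈p∩q⁺
        (bit⇒∈pos k₀ B lt (trans (tribit-select (complementary β λ _ → false) k₀ i lt) b) , bit⇒∈pos k₀ C lt c)
      meet i lt (inj₂ e) with b , c ← ∧-true {not (β i)} e = pos k₁ (fromℕ< lt) , x∈p∩q⁺
        (bit⇒∈pos k₁ B lt (trans (tribit-select (complementary β λ _ → false) k₁ i lt) b) , bit⇒∈pos k₁ C lt c)
    ... | false = contradiction (∨-true C∈) λ { (inj₁ e) → no-double e ; (inj₂ e) → no-refutation e }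
      where
      apart : ∀ i → i < m → (β i ∧ tribit k₀ (toList C) i) ∨ (not (β i) ∧ tribit k₁ (toList C) i) ≡ false
      apart i lt with (β i ∧ tribit k₀ (toList C) i) ∨ (not (β i) ∧ tribit k₁ (toList C) i) in e
      ... | false = refl
      ... | true  = trans (sym (any<-intro m _ i lt e)) eq
      no-double : any< m (λ i → tribit k₀ (toList C) i ∧ tribit k₁ (toList C) i) ≡ true → ⊥
      no-double e with any<-elim m _ e
      ... | i , lt , e′ with ∧-true {tribit k₀ (toList C) i} e′
      ... | a , b = contradiction (subst₂ (λ s t → (β i ∧ s) ∨ (not (β i) ∧ t) ≡ false) a b (apart i lt)) (lemma (β i))
        where
        lemma : ∀ b → (b ∧ true) ∨ (not b ∧ true) ≢ false
        lemma true  ()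
        lemma false ()
      no-refutation : all< m (λ i → tribit k₀ (toList C) i ∨ tribit k₁ (toList C) i) ∧
                      not (W (tab m (tribit k₁ (toList C))) (tab m (tribit k₂ (toList C)))) ≡ true → ⊥
      no-refutation e with ∧-true {all< m (λ i → tribit k₀ (toList C) i ∨ tribit k₁ (toList C) i)} e
      ... | cov , ref with tab-vec m (tribit k₂ (toList C))
      ... | z , z≡ = contradiction (trans (sym (ok z)) (trans (cong₂ W (trans (sym y≡) (tab-cong m same-bits)) z≡) (not-true ref))) λ ()
        where
        same-bits : ∀ i → i < m → β i ≡ tribit k₁ (toList C) i
        same-bits i lt = lemma (β i) _ _ (apart i lt) (all<-elim m _ cov i lt)
          where
          lemma : ∀ b a c → (b ∧ a) ∨ (not b ∧ c) ≡ false → a ∨ c ≡ true → b ≡ c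
          lemma true  false true  _ _ = refl
          lemma false a     false _ _ = refl

  to : Blocks 𝓢 (Literals m) m → Σ (Vec Bool m) λ y → (z : Vec Bool m) → W (toList y) (toList z) ≡ true
  to (B , B⊆ , B≤m , hit) with tab-vec m (tribit k₀ (toList B))
  ... | y , y≡ = y , holds
    where
    β : ℕ → Bool
    β = tribit k₀ (toList B)
    literal : ∀ (i : Fin m) → ¬ pos k₂ i ∈ B
    literal i p with () ← trans (sym (lookup-select _ k₂ i)) ([]=⇒lookup (B⊆ p))
    -- The solution made up of the two literals with index j alone. It forces B to take one of them.
    only : ℕ → Kind → ℕ → Bool
    only j k₀ i = does (i ℕ.≟ j)
    only j k₁ i = does (i ℕ.≟ j)
    only j k₂ i = false
    covered : Covered m B
    covered j with hit (select m (only (toℕ j))) (∨-trueˡ (any<-intro m _ (toℕ j) (toℕ<n j)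
                     (true-∧ (trans (tribit-select (only (toℕ j)) k₀ (toℕ j) (toℕ<n j)) (dec-true (toℕ j ℕ.≟ toℕ j) refl))
                             (trans (tribit-select (only (toℕ j)) k₁ (toℕ j) (toℕ<n j)) (dec-true (toℕ j ℕ.≟ toℕ j) refl)))))
    ... | x , p with x∈p∩q⁻ B (select m (only (toℕ j))) p
    ... | x∈B , x∈S with view {m} x
    ... | at k₀ i = ∨-trueˡ (trans (cong (λ i → lookup B (pos k₀ i)) (sym i≡j)) ([]=⇒lookup x∈B))
      where
      i≡j : i ≡ j
      i≡j = Fin.toℕ-injective (does-true (toℕ i ℕ.≟ toℕ j)
              (trans (sym (lookup-select (only (toℕ j)) k₀ i)) ([]=⇒lookup x∈S)))
    ... | at k₁ i = ∨-trueʳ (lookup B (pos k₀ j)) (trans (cong (λ i → lookup B (pos k₁ i)) (sym i≡j)) ([]=⇒lookup x∈B))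
      where
      i≡j : i ≡ j
      i≡j = Fin.toℕ-injective (does-true (toℕ i ℕ.≟ toℕ j)
              (trans (sym (lookup-select (only (toℕ j)) k₁ i)) ([]=⇒lookup x∈S)))
    ... | at k₂ i = contradiction x∈B (literal i)
    exclusive : ∀ i → pos k₀ i ∈ B → ¬ pos k₁ i ∈ B
    exclusive i p q = <⇒≱ (count-doubled m B covered i ([]=⇒lookup p) ([]=⇒lookup q)) B≤m
    holds : ∀ z → W (toList y) (toList z) ≡ true
    holds z with W (toList y) (toList z) in eq
    ... | true  = refl
    ... | false with vec-tab z
    ... | ζ , z≡ with hit C (∨-trueʳ (any< m _) (true-∧ (all<-intro m _ either)
                        (false-not (trans (cong₂ W (trans (tab-cong m same₁) (sym y≡)) (trans (tab-cong m same₂) z≡)) eq))))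
      where
      -- On the literals this is complementary to B, and it is a solution because `W` rejects y and
      -- z. B could meet it only in some `cᵢ`, which `D` excludes, or in a `bᵢ` whose `aᵢ` is also
      -- in B, which the budget excludes.
      φ : Kind → ℕ → Bool
      φ k₀ i = not (β i)
      φ k₁ i = β i
      φ k₂ i = ζ i
      C : Subset (length (els m))
      C = select m φ
      same₁ : ∀ i → i < m → tribit k₁ (toList C) i ≡ β i
      same₁ i lt = tribit-select φ k₁ i lt
      same₂ : ∀ i → i < m → tribit k₂ (toList C) i ≡ ζ i
      same₂ i lt = tribit-select φ k₂ i lt
      either : ∀ i → i < m → tribit k₀ (toList C) i ∨ tribit k₁ (toList C) i ≡ true
      either i lt = subst₂ (λ a b → a ∨ b ≡ true) (sym (tribit-select φ k₀ i lt)) (sym (tribit-select φ k₁ i lt)) (lemma (β i))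
        where
        lemma : ∀ b → not b ∨ b ≡ true
        lemma true  = refl
        lemma false = refl
    ... | x , p with x∈p∩q⁻ B _ p
    ... | x∈B , x∈C with view {m} x
    ... | at k₀ i = contradiction (trans (sym (lookup-select _ k₀ i)) ([]=⇒lookup x∈C))
                      λ e → contradiction (trans (sym (∈pos⇒bit {m} k₀ B i x∈B)) (not-true e)) λ ()
    ... | at k₁ i = contradiction x∈B (exclusive i (lookup⇒[]= _ B (trans (sym (tribit-lookup {m} k₀ B i))
                      (trans (sym (lookup-select _ k₁ i)) ([]=⇒lookup x∈C)))))
    ... | at k₂ i = contradiction x∈B (literal i)

-- The hard problem belongs to NP-S

length-el : ∀ k n → length (el k n) ≡ 2 + n
length-el k₀ n = cong (λ l → 2 + l) (length-replicate n {true})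
length-el k₁ n = cong (λ l → 2 + l) (length-replicate n {true})
length-el k₂ n = cong (λ l → 2 + l) (length-replicate n {true})

els-short : ∀ n → All (λ e → length e < 2 + n) (els n)
els-short zero    = []
els-short (suc n) = short k₀ ∷ short k₁ ∷ short k₂ ∷ All.map m≤n⇒m≤1+n (els-short n)
  where
  short : ∀ k → length (el k n) < 3 + n
  short k = s≤s (≤-reflexive (length-el k n))

-- Names in one triple differ in their two leading bits, names in different triples in their length.
els-unique : ∀ n → Unique (els n)
els-unique zero    = []
els-unique (suc n) = ((λ ()) ∷ (λ ()) ∷ fresh k₀) ∷ ((λ ()) ∷ fresh k₁) ∷ fresh k₂ ∷ els-unique n
  where
  fresh : ∀ k → All (el k n ≢_) (els n)
  fresh k = All.map (λ { lt refl → <-irrefl (length-el k n) lt }) (els-short n)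

length-els : ∀ n → length (els n) ≡ 3 * n
length-els zero    = refl
length-els (suc n) = trans (cong (λ l → 3 + l) (length-els n)) (sym (*-suc 3 n))

-- An element el k i with i < n adds 2 (2 + i) + 1 ≤ n + n + 5 bits to the encoded list.
tripleCost : ℕ → ℕ
tripleCost n = 3 * (n + n + 5)

-- The cost per triple is frozen at N, so that a single bound covers all intermediate states of the
-- loop in `elsP`.
length-encode-els : ∀ n {N} → n ≤ N → length (encodeList (els n)) ≤ n * tripleCost N
length-encode-els zero    le = z≤n
length-encode-els (suc n) {N} le = begin
  length (encodeList (els (suc n)))                           ≡⟨ step k₀ (⟨ el k₁ n , ⟨ el k₂ n , rest ⟩ ⟩) ⟩
  n + n + 5 + length ⟨ el k₁ n , ⟨ el k₂ n , rest ⟩ ⟩         ≡⟨ cong (λ l → n + n + 5 + l) (step k₁ ⟨ el k₂ n , rest ⟩) ⟩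
  n + n + 5 + (n + n + 5 + length ⟨ el k₂ n , rest ⟩)         ≡⟨ cong (λ l → n + n + 5 + (n + n + 5 + l)) (step k₂ rest) ⟩
  n + n + 5 + (n + n + 5 + (n + n + 5 + length rest))         ≤⟨ +-mono-≤ small (+-mono-≤ small (+-mono-≤ small (length-encode-els n (<⇒≤ le)))) ⟩
  c + (c + (c + n * tripleCost N))                            ≡⟨ collect c (n * tripleCost N) ⟩
  tripleCost N + n * tripleCost N                             ∎
  where
  open ≤-Reasoning
  rest = encodeList (els n)
  c = N + N + 5
  small : n + n + 5 ≤ c
  small = +-monoˡ-≤ 5 (+-mono-≤ (<⇒≤ le) (<⇒≤ le))
  collect : ∀ c x → c + (c + (c + x)) ≡ 3 * c + x
  collect c x rewrite +-identityʳ c | +-assoc c (c + c) x | +-assoc c c x = refl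
  step : ∀ k w → length ⟨ el k n , w ⟩ ≡ n + n + 5 + length w
  step k w rewrite length-pair (el k n) {w} | length-el k n = arith n (length w)
    where
    arith : ∀ n l → 2 + n + (2 + n) + suc l ≡ n + n + 5 + l
    arith = solve-∀

module _ {inp : A → Str} where

  elP : ∀ k {c} → inp ⇝ c → inp ⇝ (λ a → el k (length (c a)))
  elP k₀ f = consP true (consP true (onesP f))
  elP k₁ f = consP true (consP false (onesP f))
  elP k₂ f = consP false (consP false (onesP f))

module _ {inp : A → Str} where

  elsP : ∀ {c} → inp ⇝ c → inp ⇝ (λ a → encodeList (els (length (c a))))
  elsP {c} f = recP (outᵇ f *ᵇ (constᵇ 3 *ᵇ (outᵇ f +ᵇ outᵇ f +ᵇ constᵇ 5)))
    (λ a ys le → ≤-trans (length-encode-els (length ys) le) (*-monoˡ-≤ (tripleCost (length (c a))) le)) f (constP [])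
    (pairP (elP k₀ restP) (pairP (elP k₁ restP) (pairP (elP k₂ restP) prevP)))
    where open Rec {inp = inp} {c} (λ a ys → encodeList (els (length ys)))

  triplesP : ∀ {c s} → inp ⇝ c → inp ⇝ s → inp ⇝ (λ a → triples (length (c a)) (s a))
  triplesP {c} {s} f g = recP (outᵇ g) (λ a ys _ → small (length ys) (s a)) f g (tailP (tailP (tailP prevP)))
    where
    open Rec {inp = inp} {c} (λ a ys → triples (length ys) (s a))
    small : ∀ n s → length (triples n s) ≤ length s
    small zero    s = ≤-refl
    small (suc n) s = ≤-trans (length-drop1 (drop 1 (drop 1 t))) (≤-trans (length-drop1 (drop 1 t)) (≤-trans (length-drop1 t) (small n s)))
      where t = triples n s

  tribitP : ∀ k {c s} → inp ⇝ c → inp ⇝ s → inp ⇝ (λ a → [ tribit k (s a) (length (c a)) ])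
  tribitP k₀ f g = topP isTrue (triplesP f g)
  tribitP k₁ f g = topP isTrue (tailP (triplesP f g))
  tribitP k₂ {c} {s} f g = ⇝-ext (topP isTrue (tailP (tailP (triplesP f g)))) λ a → cong (λ t → [ isTrue (top t) ]) (drop-1-1 (triples (length (c a)) (s a)))
    where
    drop-1-1 : ∀ (t : Str) → drop 1 (drop 1 t) ≡ drop 2 t
    drop-1-1 []          = refl
    drop-1-1 (_ ∷ [])    = refl
    drop-1-1 (_ ∷ _ ∷ t) = refl

module WitnessProblem (p : Poly) (W : Str → Str → Str → Bool)
  (W-poly : PolyTime {A = Str × Str × Str} (λ (x , y , z) → ⟨ x , ⟨ y , z ⟩ ⟩) (λ (x , y , z) → [ W x y z ])) where

  size′ : Str → ℕ
  size′ w = eval p (length w)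

  pairStr : Str × Str → Str
  pairStr (w , c) = ⟨ w , c ⟩

  verify : Str → Str → Bool
  verify w c = accepts (size′ w) (W w) c

  onesOf : Str × Str → Str
  onesOf (w , _) = ones (size′ w)

  wP : pairStr ⇝ proj₁
  wP = fstP idP

  cP : pairStr ⇝ proj₂
  cP = sndP {v = proj₁} idP

  mP : pairStr ⇝ onesOf
  mP = evalP p wP

  open Index pairStr onesOf

  bitsP : ∀ k → indexInp ⇝ (λ ((_ , c) , ys , _) → [ tribit k c (length ys) ])
  bitsP k = tribitP k indexP (liftP cP)

  tableP : ∀ k → pairStr ⇝ (λ (w , c) → tab (size′ w) (tribit k c))
  tableP k = ⇝-ext (tabP mP (bitsP k)) λ (w , c) → cong (λ n → tab n (tribit k c)) (length-replicate (size′ w))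

  verifyP : pairStr ⇝ (λ (w , c) → [ verify w c ])
  verifyP = ⇝-ext
    (orP (anyP mP (andP (bitsP k₀) (bitsP k₁)))
      (andP (allP mP (orP (bitsP k₀) (bitsP k₁)))
        (notP (appP (λ (w , c) → w , tab (size′ w) (tribit k₁ c) , tab (size′ w) (tribit k₂ c)) (fromPolyTime W-poly)
          (pairP wP (pairP (tableP k₁) (tableP k₂)))))))
    λ (w , c) → cong (λ n → [ any< n (λ i → tribit k₀ c i ∧ tribit k₁ c i) ∨
       (all< n (λ i → tribit k₀ c i ∨ tribit k₁ c i) ∧ not (W w (tab (size′ w) (tribit k₁ c)) (tab (size′ w) (tribit k₂ c)))) ])
       (length-replicate (size′ w))

  problem : NPSProblem
  problem = record
    -- All strings can be instances, as `W-poly` speaks about all triples of strings.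
    { 𝓘        = λ _ → Unit.⊤
    ; 𝓤        = λ (w , _) → els (size′ w)
    ; 𝓤-unique = λ (w , _) → els-unique (size′ w)
    ; 𝓢        = λ (w , _) C → verify w (toList C) ≡ true
    ; 𝓤-size   = map (3 *_) p , λ (w , _) → ≤-reflexive (trans (length-els (size′ w)) (sym (eval-map 3 p (length w))))
    ; 𝓤-listed = toPolyTime (⇝-ext (elsP (evalP p idP)) λ (w , _) → cong (encodeList ∘ els) (length-replicate (size′ w)))
    ; V        = verify
    ; V-poly   = toPolyTime verifyP
    ; V-spec   = λ I C → mk⇔ id id
    }

-- The reduction from a problem in Σ₂ᵖ

toList-tabulate : ∀ (us : List Str) (h : Fin (length us) → Bool) φ → (∀ j → h j ≡ φ (List.lookup us j)) →
                  toList (tabulate h) ≡ map φ us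
toList-tabulate []       h φ eq = refl
toList-tabulate (u ∷ us) h φ eq = cong₂ _∷_ (eq zero) (toList-tabulate us (h ∘ suc) φ (eq ∘ suc))

unique-lookup : ∀ {us : List Str} → Unique us → ∀ i j → List.lookup us i ≡ List.lookup us j → i ≡ j
unique-lookup (a ∷ u) zero    zero    eq = refl
unique-lookup (a ∷ u) zero    (suc j) eq = contradiction eq (All.lookup a (∈-lookup j))
unique-lookup (a ∷ u) (suc i) zero    eq = contradiction (sym eq) (All.lookup a (∈-lookup i))
unique-lookup (a ∷ u) (suc i) (suc j) eq = cong suc (unique-lookup u i j eq)

popcount-ones : ∀ n → popcount (ones n) ≡ n
popcount-ones zero    = refl
popcount-ones (suc n) = cong suc (popcount-ones n)

module Hardness (Π : NPSProblem) (complete : NPSComplete Π) (L : DecisionProblem) (L∈ : InΣ₂ᵖ L) where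
  open DecisionProblem L renaming (code to encode)
  open InΣ₂ᵖ L∈ using (W-poly; W-spec) renaming (bound to p; W to R)
  open WitnessProblem p R W-poly using (problem; size′)
  private
    module Π = NPSProblem Π
    module Π′ = NPSProblem problem
    module SE = _≤SE_ (complete problem)

  inst : Input → Π′.Instance
  inst x = encode x , tt

  target : Input → Π.Instance
  target x = SE.g (inst x)

  D : ∀ x → Π.SubsetOf𝓤 (target x)
  D x = image (SE.f (inst x)) (Literals (size′ (encode x)))

  reduction : Input → DecisionProblem.Input (Interdiction Π)
  reduction x = target x , D x , + size′ (encode x)

  correct : ∀ x → Yes x ⇔ DecisionProblem.Yes (Interdiction Π) (reduction x)
  correct x = to-ℤ ⇔-∘ (blocks-image (SE.f (inst x)) (SE.f-inj (inst x)) (SE.embedding (inst x)) (Literals M) M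
    ⇔-∘ (⇔-sym (blocks-accepts M (R (encode x))) ⇔-∘ W-spec x))
    where
    M = size′ (encode x)
    to-ℤ : Blocks (Π.𝓢 (target x)) (D x) M ⇔ DecisionProblem.Yes (Interdiction Π) (reduction x)
    to-ℤ = mk⇔ (λ (B , sub , le , hit) → B , sub , ℤ.+≤+ le , hit) (λ { (B , sub , ℤ.+≤+ le , hit) → B , sub , le , hit })

  element : ∀ x (k : Kind) {j} → j < size′ (encode x) → Π′.Element (inst x)
  element x k lt = pos k (opposite (fromℕ< lt))

  lookup-element : ∀ x k {j} (lt : j < size′ (encode x)) → List.lookup (Π′.𝓤 (inst x)) (element x k lt) ≡ el k j
  lookup-element x k lt = trans (lookup-els (size′ (encode x)) k (opposite (fromℕ< lt)))
    (cong (el k) (trans (cong toℕ (opposite-involutive (fromℕ< lt))) (toℕ-fromℕ< lt)))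

  -- [] is a junk value for j out of range.
  literal : Input → Kind → ℕ → Str
  literal x k j with j <? size′ (encode x)
  ... | yes lt = List.lookup (Π.𝓤 (target x)) (SE.f (inst x) (element x k lt))
  ... | no _   = []

  -- The element handed to `SE.f` is built from a proof that j is in range; irrelevance of such
  -- proofs makes the choice immaterial.
  literal-< : ∀ x k j (lt : j < size′ (encode x)) →
              literal x k j ≡ List.lookup (Π.𝓤 (target x)) (SE.f (inst x) (element x k lt))
  literal-< x k j lt with j <? size′ (encode x)
  ... | yes lt′ = cong (λ lt → List.lookup (Π.𝓤 (target x)) (SE.f (inst x) (element x k lt))) (<-irrelevant lt′ lt)
  ... | no  nlt = contradiction lt nlt

  -- The machine for `SE.f` yields the name of an element, whereas `D` is a vector over positions.
  -- So the target universe is listed and each entry is compared with the images of all literals;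
  -- since the list has no repetitions, equal names mean equal positions.
  isLiteral : Input → Str → Bool
  isLiteral x u = any< (size′ (encode x)) λ j → eqStr u (literal x k₀ j) ∨ eqStr u (literal x k₁ j)

  D-map : ∀ x → toList (D x) ≡ map (isLiteral x) (Π.𝓤 (target x))
  D-map x = toList-tabulate us _ (isLiteral x) λ j → ⇔→≡ {z = true} (mk⇔ (to j) (from j))
    where
    us = Π.𝓤 (target x)
    f = SE.f (inst x)
    M = size′ (encode x)
    lit : Kind → ℕ → Str
    lit = literal x
    to : ∀ j → _ ≡ true → isLiteral x (List.lookup us j) ≡ true
    to j e with ∈image⁻ f {Literals M} {j} (lookup⇒[]= j (D x) (trans (lookup∘tabulate _ j) e))
    ... | i , i∈ , refl with view {M} i
    ... | at k i′ = any<-intro M _ (toℕ (opposite i′)) (toℕ<n (opposite i′)) (by-kind k i∈ (trans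
              (literal-< x k (toℕ (opposite i′)) (toℕ<n (opposite i′)))
              (cong (λ i → List.lookup us (f (pos k i))) (trans (cong opposite (Fin.fromℕ<-toℕ (opposite i′) (toℕ<n (opposite i′)))) (opposite-involutive i′)))))
      where
      j′ = toℕ (opposite i′)
      by-kind : ∀ k → pos k i′ ∈ Literals M → lit k j′ ≡ List.lookup us (f (pos k i′)) →
                eqStr (List.lookup us (f (pos k i′))) (lit k₀ j′) ∨ eqStr (List.lookup us (f (pos k i′))) (lit k₁ j′) ≡ true
      by-kind k₀ p e = ∨-trueˡ {c = eqStr (List.lookup us (f (pos k₀ i′))) (lit k₁ j′)}
        (trans (cong (eqStr (List.lookup us (f (pos k₀ i′)))) e) (eqStr-refl (List.lookup us (f (pos k₀ i′)))))
      by-kind k₁ p e = ∨-trueʳ (eqStr (List.lookup us (f (pos k₁ i′))) (lit k₀ j′))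
        (trans (cong (eqStr (List.lookup us (f (pos k₁ i′)))) e) (eqStr-refl (List.lookup us (f (pos k₁ i′)))))
      by-kind k₂ p e with () ← trans (sym (lookup-select _ k₂ i′)) ([]=⇒lookup p)
    from : ∀ j → isLiteral x (List.lookup us j) ≡ true → _ ≡ true
    from j e with any<-elim M _ e
    ... | j′ , lt , e′ = trans (sym (lookup∘tabulate _ j)) ([]=⇒lookup (found (∨-true e′)))
      where
      at-literal : ∀ k → pos k (opposite (fromℕ< lt)) ∈ Literals M → eqStr (List.lookup us j) (lit k j′) ≡ true → j ∈ D x
      at-literal k p e = subst (_∈ D x)
        (sym (unique-lookup (Π.𝓤-unique (target x)) j (f (element x k lt)) (trans (eqStr-≡ (List.lookup us j) (lit k j′) e) (literal-< x k j′ lt)))) (∈image⁺ f p)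
      found : eqStr (List.lookup us j) (lit k₀ j′) ≡ true ⊎ eqStr (List.lookup us j) (lit k₁ j′) ≡ true → j ∈ D x
      found (inj₁ e) = at-literal k₀ (lookup⇒[]= _ (Literals M) (lookup-select _ k₀ (opposite (fromℕ< lt)))) e
      found (inj₂ e) = at-literal k₁ (lookup⇒[]= _ (Literals M) (lookup-select _ k₁ (opposite (fromℕ< lt)))) e

  gP : encode ⇝ (proj₁ ∘ target)
  gP = appP inst (fromPolyTime SE.g-poly) idP

  universeP : encode ⇝ (encodeList ∘ Π.𝓤 ∘ target)
  universeP = appP target (fromPolyTime Π.𝓤-listed) gP

  unary : Input → Str
  unary x = ones (size′ (encode x))

  unaryP : encode ⇝ unary
  unaryP = evalP p idP

  candidate : Input × Str → Str
  candidate = pairInp encode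

  onesOf : Input × Str → Str
  onesOf (x , _) = unary x

  open Index candidate onesOf

  xP : candidate ⇝ (encode ∘ proj₁)
  xP = fstP idP

  uP : candidate ⇝ proj₂
  uP = sndP {v = encode ∘ proj₁} idP

  inRange : ∀ (((x , u) , ys , lt) : Below onesOf) → length ys < size′ (encode x)
  inRange ((x , u) , ys , lt) = subst (length ys <_) (length-replicate (size′ (encode x))) lt

  literalP : ∀ k → indexInp ⇝ (λ ((x , u) , ys , _) → literal x k (length ys))
  literalP k = ⇝-ext
    -- The bound on the index provides a genuine element of the source universe; on other strings
    -- the machine for `SE.f` is unspecified.
    (appP (λ b → inst (proj₁ (proj₁ b)) , element (proj₁ (proj₁ b)) k (inRange b)) (fromPolyTime SE.f-poly)
      (pairP (liftP xP) (⇝-ext (elP k indexP) λ b → sym (lookup-element (proj₁ (proj₁ b)) k (inRange b)))))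
    λ b → sym (literal-< (proj₁ (proj₁ b)) k (length (proj₁ (proj₂ b))) (inRange b))

  isLiteralP : candidate ⇝ (λ (x , u) → [ isLiteral x u ])
  isLiteralP = ⇝-ext
    (anyP (appP proj₁ unaryP xP) (orP (eqP (liftP uP) (literalP k₀)) (eqP (liftP uP) (literalP k₁))))
    λ (x , u) → cong (λ n → [ any< n (λ j → eqStr u (literal x k₀ j) ∨ eqStr u (literal x k₁ j)) ]) (length-replicate (size′ (encode x)))

  DP : encode ⇝ (λ x → toList (D x))
  DP = ⇝-ext (mapP (Π.𝓤 ∘ target) isLiteral universeP isLiteralP) (sym ∘ D-map)

  budgetP : encode ⇝ (λ x → encodeℤ (+ size′ (encode x)))
  -- The leading `false` is the sign. The magnitude is obtained by counting the bits of the unary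
  -- bound.
  budgetP = consP false (⇝-ext (binP unaryP) λ x → cong bin (popcount-ones (size′ (encode x))))

  hard : L ≤ₚ Interdiction Π
  hard = record { reduce = reduction ; poly = toPolyTime (pairP gP (pairP DP budgetP)) ; correct = correct }

theorem15 : (Π : NPSProblem) → NPSComplete Π → Σ₂ᵖ-Complete (Interdiction Π)
theorem15 Π complete = Membership.inΣ₂ᵖ Π , Hardness.hard Π complete
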